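{- Suppose $q=q_n \le b\sqrt{n}$ for a constant $b<1/2$ not depending on $n$. Then there exist a constant $C=C(b)>0$ and a polynomial $f=f_n:\mathbb{R}^{\binom n2}\to\mathbb{R}$ of degree at most $C\log n$ that strongly separates $G(n,1/2)$ and $\mathcal{R}_q$.
   Context: Graphs on $[n]$ are encoded as $X\in\{\pm1\}^{\binom n2}$ ($+1$ = edge present, $-1$ = absent). $G(n,1/2)$ is the Erdős–Rényi random graph, i.e., uniform on $\{\pm1\}^{\binom n2}$. $\mathcal{R}_q\subseteq\{\pm1\}^{\binom n2}$ is the set of $q$-colorable graphs. A polynomial $f$ strongly separates a distribution $\mathbb{Q}$ and a set $\mathcal{R}$ if $f(X)\ge 1$ for all $X\in\mathcal{R}$ and $\mathbb{E}_{\mathbb{Q}}[f^2]=o(1)$ as $n\to\infty$. -}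

module Defs where

open import Data.Nat as ℕ using (ℕ; zero; suc)
open import Data.Nat.Logarithm using (⌈log₂_⌉)
open import Data.Fin as Fin using (Fin)
open import Data.Fin.Properties using (_<?_)
open import Data.Bool using (Bool; true; false)
open import Data.List using (List; []; _∷_; length; lookup; filter; cartesianProduct; allFin)
open import Data.Product using (_×_; _,_; proj₁; proj₂; Σ; ∃)
open import Data.Sum using (_⊎_)
open import Data.Integer using (+_)
open import Data.Rational using (ℚ; 0ℚ; 1ℚ; ½; _+_; _*_; -_; _≤_; _<_; _/_; _⊔_)
import Data.Vec.Functional as VF
open import Relation.Binary.PropositionalEquality using (_≡_; _≢_)

ℕ→ℚ : ℕ → ℚ
ℕ→ℚ k = + k / 1

pairs : (n : ℕ) → List (Fin n × Fin n)
pairs n = filter (λ p → proj₁ p <? proj₂ p) (cartesianProduct (allFin n) (allFin n))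

N : ℕ → ℕ
N n = length (pairs n)

-- a point of {±1}^{binom n 2}: true = +1 (edge present), false = -1 (absent)
Graph : ℕ → Set
Graph n = Fin (N n) → Bool

sign : Bool → ℚ
sign true  = 1ℚ
sign false = - 1ℚ

Colorable : (n q : ℕ) → Graph n → Set
Colorable n q X = Σ (Fin n → Fin q) λ c →
  (e : Fin (N n)) → X e ≡ true →
    c (proj₁ (lookup (pairs n) e)) ≢ c (proj₂ (lookup (pairs n) e))

-- Polynomials in m real variables (here with rational coefficients):
-- a finite list of terms (coefficient , monomial), a monomial being a
-- list of variable indices (repetitions allowed = powers).

Monomial : ℕ → Set
Monomial m = List (Fin m)

Poly : ℕ → Set
Poly m = List (ℚ × Monomial m)

degree : ∀ {m} → Poly m → ℕ
degree []            = 0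
degree ((_ , μ) ∷ p) = length μ ℕ.⊔ degree p

evalMono : ∀ {m} → (Fin m → ℚ) → Monomial m → ℚ
evalMono x []      = 1ℚ
evalMono x (i ∷ μ) = x i * evalMono x μ

eval : ∀ {m} → Poly m → (Fin m → ℚ) → ℚ
eval []            x = 0ℚ
eval ((a , μ) ∷ p) x = a * evalMono x μ + eval p x

evalPM : ∀ {m} → Poly m → (Fin m → Bool) → ℚ
evalPM f X = eval f (λ i → sign (X i))

Exp : (m : ℕ) → ((Fin m → Bool) → ℚ) → ℚ
Exp zero    g = g (λ ())
Exp (suc m) g = ½ * (Exp m (λ x → g (true VF.∷ x)) + Exp m (λ x → g (false VF.∷ x)))

E-G-sq : (n : ℕ) → Poly (N n) → ℚ
E-G-sq n f = Exp (N n) (λ X → evalPM f X * evalPM f X)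

-- a_n = o(1): for every ε > 0, eventually a_n ≤ ε  (here a_n ≥ 0)
IsLittleO1 : (ℕ → ℚ) → Set
IsLittleO1 a = (ε : ℚ) → 0ℚ < ε → ∃ λ n₀ → (n : ℕ) → n₀ ℕ.≤ n → a n ≤ ε

StronglySeparates : (q : ℕ → ℕ) → ((n : ℕ) → Poly (N n)) → Set
StronglySeparates q f =
  ((n : ℕ) (X : Graph n) → Colorable n (q n) X → 1ℚ ≤ evalPM (f n) X)
  × IsLittleO1 (λ n → E-G-sq n (f n))

-- q ≤ b √n, for q n : ℕ and b : ℚ (exact, without square roots):
-- since q ≥ 0, this holds iff (b ≥ 0 and q² ≤ b² n), or q = n = 0.
LeBSqrt : ℚ → ℕ → ℕ → Set
LeBSqrt b q n = (q ≡ 0 × n ≡ 0) ⊎ (0ℚ ≤ b × ℕ→ℚ (q ℕ.* q) ≤ b * b * ℕ→ℚ n)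

logN : ℕ → ℕ
logN n = ⌈log₂ n ⌉

{-# OPTIONS --safe #-}
module Submission where

-- Trace method. Let A be the ±1 adjacency matrix with zero diagonal; f is a multiple of tr A^{2m} with m a power of two of order log n.
-- A q-colouring has a class of size s ≥ n/q ≥ √n/b, on which A equals I - J, so A has a Rayleigh quotient of absolute value s - 1; since
-- m is a power of two, repeated Cauchy–Schwarz turns this into tr A^{2m} ≥ (s - 1)^{2m}, beyond (2√n)^{2m} by an exponential factor.
-- For the second moment, (tr A^{2m})² ≤ n tr A^{4m}, and E tr A^{4m} is bounded by about (2√n)^{4m} through loop equations: on the cube,
-- E[x_e p] ≤ E[∂_e p] for polynomials p with nonnegative coefficients, which gives a recursive inequality for F(a₁,…,a_k) = E ∏ tr A^{a_i}
--   F(a+2, …) ≤ Σ_{s+t=a} F(s, t, …) + (a+1) F(a, …) + Σ_i 2 a_i F(a + a_i, …),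
-- dominated by products of Catalan-like weights as long as the lengths are polylogarithmic in n.

open import Defs
open import Data.Nat as ℕ using (ℕ; zero; suc)
import Data.Nat.Properties as ℕₚ
open import Data.Nat.Induction using (<-rec)
open import Data.Nat.Logarithm using (⌈log₂_⌉; ⌈log₂⌉-mono-≤; ⌈log₂⌈n/2⌉⌉≡⌈log₂n⌉∸1; ⌈log₂2^n⌉≡n)
import Data.Nat.Tactic.RingSolver as ℕ-Solver
open import Data.Integer as ℤ using ()
import Data.Integer.Properties as ℤₚ
open import Data.Fin as Fin using (Fin; zero; suc)
import Data.Fin.Properties as Finₚ
open import Data.List using (List; []; _∷_; _++_; length; lookup)
open import Data.List.Properties using (length-++)
open import Data.List.Relation.Unary.All using (All; []; _∷_)
open import Data.List.Relation.Unary.All.Properties using (++⁺)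
open import Data.List.Relation.Unary.Any using (here; there; index)
open import Data.List.Relation.Unary.Any.Properties using (lookup-index)
open import Data.List.Membership.Propositional using (_∈_; _∉_)
open import Data.List.Membership.Propositional.Properties using (∈-filter⁺; ∈-cartesianProduct⁺; ∈-allFin)
open import Data.List.Membership.DecPropositional using (_∈?_)
open import Data.Nat.ListAction using (sum)
import Data.Vec.Functional as VF
open import Data.Bool using (Bool; true; false; not)
open import Data.Product using (Σ; _×_; _,_; proj₁; proj₂; ∃)
open import Data.Sum using (_⊎_; inj₁; inj₂)
open import Data.Rational using (ℚ; mkℚ; 0ℚ; 1ℚ; ½; _+_; _*_; -_; _-_; _≤_; _<_; _/_; _⊔_; 1/_; toℚᵘ; positive; nonNegative; nonPositive; ↥_; ↧ₙ_)
open import Data.Rational.Properties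
import Data.Rational.Unnormalised as ℚᵘ
import Data.Rational.Unnormalised.Properties as ℚᵘₚ
open import Algebra.Bundles using (CommutativeRing)
open import Tactic.RingSolver using (solve-∀)
open import Tactic.RingSolver.Core.AlmostCommutativeRing using (AlmostCommutativeRing; fromCommutativeRing)
open import Relation.Nullary using (Dec; yes; no; ¬_; contradiction; _×-dec_)
open import Relation.Nullary.Decidable using (dec⇒maybe; toWitness)
open import Data.Empty using (⊥-elim)
open import Relation.Binary using (Tri; tri<; tri≈; tri>)
open import Relation.Binary.PropositionalEquality using (_≡_; _≢_; refl; sym; trans; cong; cong₂; subst; subst₂; module ≡-Reasoning)
open import Function using (_∘_; case_of_)
open import Algebra.Properties.Semiring.Sum (CommutativeRing.semiring +-*-commutativeRing)
  using (sum-cong-≗; ∑-distrib-+; ∑-comm; *-distribˡ-sum; *-distribʳ-sum)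
  renaming (sum to ∑)
open import Algebra.Properties.CommutativeSemiring.Exp (CommutativeRing.commutativeSemiring +-*-commutativeRing)
  using (_^_; ^-homo-*; ^-assocʳ; ^-distrib-*)

-- The discrete derivative of the cube would give equality in the integration by parts, but it obeys
-- no plain product rule. The formal derivative does obey it, and it dominates in expectation
-- because every monomial has nonnegative mean. The recursion for a single trace does not close:
-- cutting a loop leaves two loops, and the derivative may hit the other factors, so all products of
-- traces are bounded together. The splitting term is the Catalan recursion. With mass α at length
-- zero its normalised generating function solves G = α + G², which has a solution only for α ≤ ¼.
-- This is where b < ½ enters: if `c` bounds q²/n, there is room for c < μ < α < ¼, where `n/μ` lies
-- below the squared signal and `n/α` is the squared scale of the noise. The ratio μ/α < 1, raised
-- to a power of order log n, beats the polynomial losses in n. Everything is measured on the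
-- squared scale, so that neither square roots nor eigenvalues are needed over ℚ.

ℚ-ring : AlmostCommutativeRing _ _
ℚ-ring = fromCommutativeRing +-*-commutativeRing (λ x → dec⇒maybe (0ℚ ≟ x))

-- Ordered-field facts

2ℚ : ℚ
2ℚ = 1ℚ + 1ℚ

0≤1 : 0ℚ ≤ 1ℚ
0≤1 = nonNegative⁻¹ 1ℚ

*-monoˡ-≤ : ∀ {r p q} → 0ℚ ≤ r → p ≤ q → r * p ≤ r * q
*-monoˡ-≤ {r} 0≤r = *-monoˡ-≤-nonNeg r {{nonNegative 0≤r}}

*-monoʳ-≤ : ∀ {r p q} → 0ℚ ≤ r → p ≤ q → p * r ≤ q * r
*-monoʳ-≤ {r} 0≤r = *-monoʳ-≤-nonNeg r {{nonNegative 0≤r}}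

*-nonNeg : ∀ {p q} → 0ℚ ≤ p → 0ℚ ≤ q → 0ℚ ≤ p * q
*-nonNeg {p} {q} 0≤p 0≤q = subst (_≤ p * q) (*-zeroʳ p) (*-monoˡ-≤ 0≤p 0≤q)

*-pos : ∀ {p q} → 0ℚ < p → 0ℚ < q → 0ℚ < p * q
*-pos {p} {q} 0<p 0<q = subst (_< p * q) (*-zeroʳ p) (*-monoʳ-<-pos p {{positive 0<p}} 0<q)

*-mono-≤ : ∀ {p q r s} → 0ℚ ≤ p → p ≤ q → 0ℚ ≤ r → r ≤ s → p * r ≤ q * s
*-mono-≤ 0≤p p≤q 0≤r r≤s = ≤-trans (*-monoʳ-≤ 0≤r p≤q) (*-monoˡ-≤ (≤-trans 0≤p p≤q) r≤s)

+-nonNeg : ∀ {p q} → 0ℚ ≤ p → 0ℚ ≤ q → 0ℚ ≤ p + q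
+-nonNeg = +-mono-≤

p≤p+q : ∀ {p q} → 0ℚ ≤ q → p ≤ p + q
p≤p+q {p} {q} 0≤q = subst (_≤ p + q) (+-identityʳ p) (+-monoʳ-≤ p 0≤q)

p≤q+p : ∀ {p q} → 0ℚ ≤ q → p ≤ q + p
p≤q+p {p} {q} 0≤q = subst (_≤ q + p) (+-identityˡ p) (+-monoˡ-≤ p 0≤q)

≤⇒0≤- : ∀ {p q} → p ≤ q → 0ℚ ≤ q - p
≤⇒0≤- {p} {q} p≤q = subst (_≤ q - p) (+-inverseʳ p) (+-monoˡ-≤ (- p) p≤q)

0≤-⇒≤ : ∀ {p q} → 0ℚ ≤ q - p → p ≤ q
0≤-⇒≤ {p} {q} h = subst₂ _≤_ (+-identityˡ p) (lemma q p) (+-monoˡ-≤ p h)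
  where
  lemma : ∀ q p → q - p + p ≡ q
  lemma = solve-∀ ℚ-ring

<⇒0<- : ∀ {p q} → p < q → 0ℚ < q - p
<⇒0<- {p} {q} p<q = subst (_< q - p) (+-inverseʳ p) (+-monoˡ-< (- p) p<q)

*-cancelˡ-≤ : ∀ {r p q} → 0ℚ < r → r * p ≤ r * q → p ≤ q
*-cancelˡ-≤ {r} 0<r = *-cancelˡ-≤-pos r {{positive 0<r}}

square-nonNeg : ∀ p → 0ℚ ≤ p * p
square-nonNeg p with ≤-total 0ℚ p
... | inj₁ 0≤p = *-nonNeg 0≤p 0≤p
... | inj₂ p≤0 = subst (_≤ p * p) (*-zeroʳ p) (*-monoˡ-≤-nonPos p {{nonPositive p≤0}} p≤0)

square-cancel-≤ : ∀ {p q} → 0ℚ ≤ q → p * p ≤ q * q → p ≤ q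
square-cancel-≤ {p} {q} 0≤q p²≤q² with p ≤? q
... | yes p≤q = p≤q
... | no p≰q = contradiction p²≤q² (<⇒≱ (≤-<-trans (*-monoˡ-≤ 0≤q (<⇒≤ q<p)) (*-monoˡ-<-pos p {{positive 0<p}} q<p)))
  where
  q<p = ≰⇒> p≰q
  0<p = ≤-<-trans 0≤q q<p
  <⇒≱ : ∀ {x y} → x < y → ¬ (y ≤ x)
  <⇒≱ x<y y≤x = <-irrefl refl (<-≤-trans x<y y≤x)

reciprocal : ∀ {p} → 0ℚ < p → Σ ℚ λ p⁻¹ → 0ℚ < p⁻¹ × p⁻¹ * p ≡ 1ℚ
reciprocal {p} 0<p = 1/ p , positive⁻¹ (1/ p) {{1/pos⇒pos p}} , *-inverseˡ p
  where
  instance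
    p-pos = positive 0<p
    p-nonZero = pos⇒nonZero p

^-nonNeg : ∀ {p} k → 0ℚ ≤ p → 0ℚ ≤ p ^ k
^-nonNeg zero 0≤p = 0≤1
^-nonNeg (suc k) 0≤p = *-nonNeg 0≤p (^-nonNeg k 0≤p)

^-mono-≤ : ∀ {p q} k → 0ℚ ≤ p → p ≤ q → p ^ k ≤ q ^ k
^-mono-≤ zero 0≤p p≤q = ≤-refl
^-mono-≤ (suc k) 0≤p p≤q = *-mono-≤ 0≤p p≤q (^-nonNeg k 0≤p) (^-mono-≤ k 0≤p p≤q)

1^k≡1 : ∀ k → 1ℚ ^ k ≡ 1ℚ
1^k≡1 zero = refl
1^k≡1 (suc k) = trans (*-identityˡ _) (1^k≡1 k)

^-antimono-≤ : ∀ {p j k} → 0ℚ ≤ p → p ≤ 1ℚ → j ℕ.≤ k → p ^ k ≤ p ^ j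
^-antimono-≤ {p} {k = k} 0≤p p≤1 ℕ.z≤n = subst (p ^ k ≤_) (1^k≡1 k) (^-mono-≤ k 0≤p p≤1)
^-antimono-≤ 0≤p p≤1 (ℕ.s≤s j≤k) = *-monoˡ-≤ 0≤p (^-antimono-≤ 0≤p p≤1 j≤k)

-- The embedding of the naturals

toℚᵘ-ℕ→ℚ : ∀ k → toℚᵘ (ℕ→ℚ k) ℚᵘ.≃ ℚᵘ.mkℚᵘ (ℤ.+ k) 0
toℚᵘ-ℕ→ℚ k = toℚᵘ-fromℚᵘ (ℚᵘ.mkℚᵘ (ℤ.+ k) 0)

ℕ→ℚ-+ : ∀ j k → ℕ→ℚ (j ℕ.+ k) ≡ ℕ→ℚ j + ℕ→ℚ k
ℕ→ℚ-+ j k = toℚᵘ-injective (begin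
  toℚᵘ (ℕ→ℚ (j ℕ.+ k))                ≈⟨ toℚᵘ-ℕ→ℚ (j ℕ.+ k) ⟩
  ℚᵘ.mkℚᵘ (ℤ.+ (j ℕ.+ k)) 0             ≈⟨ ℚᵘ.*≡* (cong (ℤ._* ℤ.+ 1) (sym (cong₂ ℤ._+_ (ℤₚ.*-identityʳ (ℤ.+ j)) (ℤₚ.*-identityʳ (ℤ.+ k))))) ⟩
  ℚᵘ.mkℚᵘ (ℤ.+ j) 0 ℚᵘ.+ ℚᵘ.mkℚᵘ (ℤ.+ k) 0 ≈⟨ ℚᵘₚ.≃-sym (ℚᵘₚ.+-cong (toℚᵘ-ℕ→ℚ j) (toℚᵘ-ℕ→ℚ k)) ⟩
  toℚᵘ (ℕ→ℚ j) ℚᵘ.+ toℚᵘ (ℕ→ℚ k)     ≈⟨ ℚᵘₚ.≃-sym (toℚᵘ-homo-+ (ℕ→ℚ j) (ℕ→ℚ k)) ⟩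
  toℚᵘ (ℕ→ℚ j + ℕ→ℚ k)               ∎)
  where open ℚᵘₚ.≃-Reasoning

ℕ→ℚ-suc : ∀ k → ℕ→ℚ (suc k) ≡ 1ℚ + ℕ→ℚ k
ℕ→ℚ-suc = ℕ→ℚ-+ 1

ℕ→ℚ-* : ∀ j k → ℕ→ℚ (j ℕ.* k) ≡ ℕ→ℚ j * ℕ→ℚ k
ℕ→ℚ-* zero k = sym (*-zeroˡ (ℕ→ℚ k))
ℕ→ℚ-* (suc j) k = begin
  ℕ→ℚ (k ℕ.+ j ℕ.* k)          ≡⟨ ℕ→ℚ-+ k (j ℕ.* k) ⟩
  ℕ→ℚ k + ℕ→ℚ (j ℕ.* k)        ≡⟨ cong (ℕ→ℚ k +_) (ℕ→ℚ-* j k) ⟩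
  ℕ→ℚ k + ℕ→ℚ j * ℕ→ℚ k        ≡⟨ lemma (ℕ→ℚ k) (ℕ→ℚ j) ⟩
  (1ℚ + ℕ→ℚ j) * ℕ→ℚ k         ≡⟨ cong (_* ℕ→ℚ k) (sym (ℕ→ℚ-suc j)) ⟩
  ℕ→ℚ (suc j) * ℕ→ℚ k          ∎
  where
  open ≡-Reasoning
  lemma : ∀ x y → x + y * x ≡ (1ℚ + y) * x
  lemma = solve-∀ ℚ-ring

0≤ℕ→ℚ : ∀ k → 0ℚ ≤ ℕ→ℚ k
0≤ℕ→ℚ zero = ≤-refl
0≤ℕ→ℚ (suc k) = subst (0ℚ ≤_) (sym (ℕ→ℚ-suc k)) (+-nonNeg 0≤1 (0≤ℕ→ℚ k))

ℕ→ℚ-mono-≤ : ∀ {j k} → j ℕ.≤ k → ℕ→ℚ j ≤ ℕ→ℚ k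
ℕ→ℚ-mono-≤ {j} {k} j≤k with ℕₚ.m≤n⇒∃[o]m+o≡n j≤k
... | o , refl = subst (ℕ→ℚ j ≤_) (sym (ℕ→ℚ-+ j o)) (p≤p+q (0≤ℕ→ℚ o))

ℕ→ℚ-^ : ∀ j k → ℕ→ℚ (j ℕ.^ k) ≡ ℕ→ℚ j ^ k
ℕ→ℚ-^ j zero = refl
ℕ→ℚ-^ j (suc k) = trans (ℕ→ℚ-* j (j ℕ.^ k)) (cong (ℕ→ℚ j *_) (ℕ→ℚ-^ j k))

1≤ℕ→ℚ : ∀ {k} → 0 ℕ.< k → 1ℚ ≤ ℕ→ℚ k
1≤ℕ→ℚ 0<k = ℕ→ℚ-mono-≤ 0<k

0<ℕ→ℚ : ∀ {k} → 0 ℕ.< k → 0ℚ < ℕ→ℚ k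
0<ℕ→ℚ 0<k = <-≤-trans (positive⁻¹ 1ℚ) (1≤ℕ→ℚ 0<k)

-- A rational is at most the absolute value of its numerator, and a positive `p` times its
-- denominator is a positive integer, hence at least one.
archimedean : ∀ {p} → 0ℚ < p → ∀ q → ∃ λ k → q ≤ ℕ→ℚ k * p
archimedean {p} 0<p q = numerator q ℕ.* denominator p , (begin
  q                              ≤⟨ p≤numerator q ⟩
  ℕ→ℚ (numerator q)              ≡⟨ sym (*-identityʳ (ℕ→ℚ (numerator q))) ⟩
  ℕ→ℚ (numerator q) * 1ℚ         ≤⟨ *-monoˡ-≤ (0≤ℕ→ℚ (numerator q)) (1≤denominator*p p 0<p) ⟩
  ℕ→ℚ (numerator q) * (ℕ→ℚ (denominator p) * p) ≡⟨ sym (*-assoc (ℕ→ℚ (numerator q)) (ℕ→ℚ (denominator p)) p) ⟩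
  ℕ→ℚ (numerator q) * ℕ→ℚ (denominator p) * p   ≡⟨ cong (_* p) (sym (ℕ→ℚ-* (numerator q) (denominator p))) ⟩
  ℕ→ℚ (numerator q ℕ.* denominator p) * p       ∎)
  where
  open ≤-Reasoning
  numerator denominator : ℚ → ℕ
  numerator q = ℤ.∣ ↥ q ∣
  denominator = ↧ₙ_
  p≤numerator : ∀ q → q ≤ ℕ→ℚ (numerator q)
  p≤numerator q@(mkℚ i d-1 _) = toℚᵘ-cancel-≤ (ℚᵘₚ.≤-respʳ-≃ (ℚᵘₚ.≃-sym (toℚᵘ-ℕ→ℚ (numerator q))) (ℚᵘ.*≤* (lemma i)))
    where
    lemma : ∀ i → i ℤ.* ℤ.+ 1 ℤ.≤ ℤ.+ ℤ.∣ i ∣ ℤ.* ℤ.+ suc d-1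
    lemma (ℤ.+ k) = subst₂ ℤ._≤_ (ℤₚ.pos-* k 1) (ℤₚ.pos-* k (suc d-1)) (ℤ.+≤+ (ℕₚ.*-monoʳ-≤ k (ℕ.s≤s ℕ.z≤n)))
    lemma (ℤ.-[1+ k ]) = ℤ.-≤+
  1≤denominator*p : ∀ p → 0ℚ < p → 1ℚ ≤ ℕ→ℚ (denominator p) * p
  1≤denominator*p p@(mkℚ i d-1 _) 0<p = toℚᵘ-cancel-≤ (ℚᵘₚ.≤-respʳ-≃ (ℚᵘₚ.≃-sym (ℚᵘₚ.≃-trans (toℚᵘ-homo-* (ℕ→ℚ (denominator p)) p) (ℚᵘₚ.*-congʳ (toℚᵘ-ℕ→ℚ (denominator p))))) (ℚᵘ.*≤* (lemma i (drop-*<* 0<p))))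
    where
    lemma : ∀ i → ℤ.+ 0 ℤ.* ℤ.+ suc d-1 ℤ.< i ℤ.* ℤ.+ 1 → ℤ.+ 1 ℤ.* ℤ.+ (1 ℕ.* suc d-1) ℤ.≤ (ℤ.+ suc d-1 ℤ.* i) ℤ.* ℤ.+ 1
    lemma ℤ.+[1+ k ] _ = ℤ.+≤+ (begin′ d-1 k)
      where
      begin′ : ∀ d k → 1 ℕ.* (1 ℕ.* suc d) ℕ.≤ suc (k ℕ.+ d ℕ.* suc k) ℕ.* 1
      begin′ d k rewrite ℕₚ.*-identityˡ (1 ℕ.* suc d) | ℕₚ.*-identityˡ (suc d) | ℕₚ.*-identityʳ (suc (k ℕ.+ d ℕ.* suc k)) = ℕₚ.m≤m*n (suc d) (suc k)
    lemma (ℤ.+ 0) (ℤ.+<+ ())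

-- Finite sums

∑-mono-≤ : ∀ {n} {f g : Fin n → ℚ} → (∀ i → f i ≤ g i) → ∑ f ≤ ∑ g
∑-mono-≤ {zero} f≤g = ≤-refl
∑-mono-≤ {suc n} f≤g = +-mono-≤ (f≤g zero) (∑-mono-≤ (f≤g ∘ suc))

∑-const : ∀ n c → ∑ {n} (λ _ → c) ≡ ℕ→ℚ n * c
∑-const zero c = sym (*-zeroˡ c)
∑-const (suc n) c = begin
  c + ∑ {n} (λ _ → c)     ≡⟨ cong (c +_) (∑-const n c) ⟩
  c + ℕ→ℚ n * c           ≡⟨ lemma c (ℕ→ℚ n) ⟩
  (1ℚ + ℕ→ℚ n) * c        ≡⟨ cong (_* c) (sym (ℕ→ℚ-suc n)) ⟩
  ℕ→ℚ (suc n) * c         ∎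
  where
  open ≡-Reasoning
  lemma : ∀ c n → c + n * c ≡ (1ℚ + n) * c
  lemma = solve-∀ ℚ-ring

∑-zero : ∀ n → ∑ {n} (λ _ → 0ℚ) ≡ 0ℚ
∑-zero n = trans (∑-const n 0ℚ) (*-zeroʳ (ℕ→ℚ n))

∑-nonNeg : ∀ {n} {f : Fin n → ℚ} → (∀ i → 0ℚ ≤ f i) → 0ℚ ≤ ∑ f
∑-nonNeg {n} {f} 0≤f = subst (_≤ ∑ f) (∑-zero n) (∑-mono-≤ 0≤f)

term≤∑ : ∀ {n} {f : Fin n → ℚ} → (∀ i → 0ℚ ≤ f i) → ∀ i → f i ≤ ∑ f
term≤∑ 0≤f zero = p≤p+q (∑-nonNeg (0≤f ∘ suc))
term≤∑ 0≤f (suc i) = ≤-trans (term≤∑ (0≤f ∘ suc) i) (p≤q+p (0≤f zero))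

∑∑-* : ∀ {m n} (f : Fin m → ℚ) (g : Fin n → ℚ) → ∑ (λ i → ∑ λ j → f i * g j) ≡ ∑ f * ∑ g
∑∑-* f g = trans (sum-cong-≗ (λ i → sym (*-distribˡ-sum (f i) g))) (sym (*-distribʳ-sum (∑ g) f))

-- Lagrange's identity: the squares of all 2 by 2 minors of the pair (a, b) sum to twice the
-- difference of the two sides.
cauchy-schwarz : ∀ {n} (a b : Fin n → ℚ) →
  ∑ (λ i → a i * b i) * ∑ (λ i → a i * b i) ≤ ∑ (λ i → a i * a i) * ∑ (λ i → b i * b i)
cauchy-schwarz a b = *-cancelˡ-≤ {2ℚ} (positive⁻¹ 2ℚ) (0≤-⇒≤ (subst (0ℚ ≤_) (begin
  ∑ (λ i → ∑ λ j → minor i j * minor i j)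
    ≡⟨ sum-cong-≗ (λ i → trans (sum-cong-≗ (λ j → expand (a i) (b i) (a j) (b j))) (trans
         (∑-distrib-+ (λ j → aa i * bb j + bb i * aa j) (λ j → ab i * (- 2ℚ * ab j)))
         (cong (_+ ∑ λ j → ab i * (- 2ℚ * ab j)) (∑-distrib-+ (λ j → aa i * bb j) (λ j → bb i * aa j))))) ⟩
  ∑ (λ i → ∑ (λ j → aa i * bb j) + ∑ (λ j → bb i * aa j) + ∑ (λ j → ab i * (- 2ℚ * ab j)))
    ≡⟨ trans (∑-distrib-+ (λ i → ∑ (λ j → aa i * bb j) + ∑ (λ j → bb i * aa j)) (λ i → ∑ (λ j → ab i * (- 2ℚ * ab j))))
         (cong (_+ ∑ (λ i → ∑ λ j → ab i * (- 2ℚ * ab j))) (∑-distrib-+ (λ i → ∑ λ j → aa i * bb j) (λ i → ∑ λ j → bb i * aa j))) ⟩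
  ∑ (λ i → ∑ (λ j → aa i * bb j)) + ∑ (λ i → ∑ (λ j → bb i * aa j)) + ∑ (λ i → ∑ (λ j → ab i * (- 2ℚ * ab j)))
    ≡⟨ cong₂ _+_ (cong₂ _+_ (∑∑-* aa bb) (∑∑-* bb aa)) (trans (∑∑-* ab (λ j → - 2ℚ * ab j)) (cong (∑ ab *_) (sym (*-distribˡ-sum (- 2ℚ) ab)))) ⟩
  ∑ aa * ∑ bb + ∑ bb * ∑ aa + ∑ ab * (- 2ℚ * ∑ ab)
    ≡⟨ collect (∑ aa) (∑ bb) (∑ ab) ⟩
  2ℚ * (∑ aa * ∑ bb) - 2ℚ * (∑ ab * ∑ ab) ∎) (∑-nonNeg (λ i → ∑-nonNeg (λ j → square-nonNeg (minor i j))))))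
  where
  open ≡-Reasoning
  minor : _ → _ → ℚ
  minor i j = a i * b j - a j * b i
  aa bb ab : _ → ℚ
  aa i = a i * a i
  bb i = b i * b i
  ab i = a i * b i
  expand : ∀ a b c d → (a * d - c * b) * (a * d - c * b) ≡ a * a * (d * d) + b * b * (c * c) + a * b * (- 2ℚ * (c * d))
  expand = solve-∀ ℚ-ring
  collect : ∀ x y z → x * y + y * x + z * (- 2ℚ * z) ≡ 2ℚ * (x * y) - 2ℚ * (z * z)
  collect = solve-∀ ℚ-ring

-- The Kronecker delta

δ : ∀ {n} → Fin n → Fin n → ℚ
δ zero zero = 1ℚ
δ zero (suc j) = 0ℚ
δ (suc i) zero = 0ℚ
δ (suc i) (suc j) = δ i j

δ-refl : ∀ {n} (i : Fin n) → δ i i ≡ 1ℚ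
δ-refl zero = refl
δ-refl (suc i) = δ-refl i

δ-≢ : ∀ {n} (i j : Fin n) → i ≢ j → δ i j ≡ 0ℚ
δ-≢ zero zero i≢j = contradiction refl i≢j
δ-≢ zero (suc j) i≢j = refl
δ-≢ (suc i) zero i≢j = refl
δ-≢ (suc i) (suc j) i≢j = δ-≢ i j (i≢j ∘ cong suc)

δ-sym : ∀ {n} (i j : Fin n) → δ i j ≡ δ j i
δ-sym zero zero = refl
δ-sym zero (suc j) = refl
δ-sym (suc i) zero = refl
δ-sym (suc i) (suc j) = δ-sym i j

0≤δ : ∀ {n} (i j : Fin n) → 0ℚ ≤ δ i j
0≤δ zero zero = 0≤1
0≤δ zero (suc j) = ≤-refl
0≤δ (suc i) zero = ≤-refl
0≤δ (suc i) (suc j) = 0≤δ i j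

∑-δ : ∀ {n} (i : Fin n) (f : Fin n → ℚ) → ∑ (λ k → δ i k * f k) ≡ f i
∑-δ {suc n} zero f = begin
  1ℚ * f zero + ∑ (λ k → 0ℚ * f (suc k)) ≡⟨ cong₂ _+_ (*-identityˡ (f zero)) (trans (sum-cong-≗ (λ k → *-zeroˡ (f (suc k)))) (∑-zero n)) ⟩
  f zero + 0ℚ                            ≡⟨ +-identityʳ (f zero) ⟩
  f zero                                 ∎
  where open ≡-Reasoning
∑-δ (suc i) f = trans (cong₂ _+_ (*-zeroˡ (f zero)) (∑-δ i (f ∘ suc))) (+-identityˡ (f (suc i)))

-- Expectations over the cube

Cube : ℕ → Set
Cube m = Fin m → Bool

Exp-cong : ∀ m {g h : Cube m → ℚ} → (∀ X → g X ≡ h X) → Exp m g ≡ Exp m h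
Exp-cong zero g≗h = g≗h (λ ())
Exp-cong (suc m) g≗h = cong (½ *_) (cong₂ _+_ (Exp-cong m (λ X → g≗h _)) (Exp-cong m (λ X → g≗h _)))

Exp-mono-≤ : ∀ m {g h : Cube m → ℚ} → (∀ X → g X ≤ h X) → Exp m g ≤ Exp m h
Exp-mono-≤ zero g≤h = g≤h (λ ())
Exp-mono-≤ (suc m) g≤h = *-monoˡ-≤ (nonNegative⁻¹ ½) (+-mono-≤ (Exp-mono-≤ m (λ X → g≤h _)) (Exp-mono-≤ m (λ X → g≤h _)))

Exp-+ : ∀ m (g h : Cube m → ℚ) → Exp m (λ X → g X + h X) ≡ Exp m g + Exp m h
Exp-+ zero g h = refl
Exp-+ (suc m) g h = trans (cong (½ *_) (cong₂ _+_ (Exp-+ m (g ∘ (true VF.∷_)) (h ∘ (true VF.∷_))) (Exp-+ m (g ∘ (false VF.∷_)) (h ∘ (false VF.∷_)))))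
  (lemma (Exp m (g ∘ (true VF.∷_))) (Exp m (h ∘ (true VF.∷_))) (Exp m (g ∘ (false VF.∷_))) (Exp m (h ∘ (false VF.∷_))))
  where
  lemma : ∀ a b c d → ½ * ((a + b) + (c + d)) ≡ ½ * (a + c) + ½ * (b + d)
  lemma = solve-∀ ℚ-ring

Exp-*ˡ : ∀ m c (g : Cube m → ℚ) → Exp m (λ X → c * g X) ≡ c * Exp m g
Exp-*ˡ zero c g = refl
Exp-*ˡ (suc m) c g = trans (cong (½ *_) (cong₂ _+_ (Exp-*ˡ m c (g ∘ (true VF.∷_))) (Exp-*ˡ m c (g ∘ (false VF.∷_)))))
  (lemma c (Exp m (g ∘ (true VF.∷_))) (Exp m (g ∘ (false VF.∷_))))
  where
  lemma : ∀ c a b → ½ * (c * a + c * b) ≡ c * (½ * (a + b))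
  lemma = solve-∀ ℚ-ring

Exp-0 : ∀ m → Exp m (λ _ → 0ℚ) ≡ 0ℚ
Exp-0 zero = refl
Exp-0 (suc m) = cong (λ z → ½ * (z + z)) (Exp-0 m)

Exp-∑ : ∀ m {k} (g : Fin k → Cube m → ℚ) → Exp m (λ X → ∑ λ i → g i X) ≡ ∑ λ i → Exp m (g i)
Exp-∑ m {zero} g = Exp-0 m
Exp-∑ m {suc k} g = trans (Exp-+ m (g zero) (λ X → ∑ λ i → g (suc i) X)) (cong (Exp m (g zero) +_) (Exp-∑ m (g ∘ suc)))

-- A pointwise relation rather than an update function, so that it holds of `true VF.∷ X` and
-- `false VF.∷ X` without function extensionality.
FlippedAt : ∀ {m} → Fin m → Cube m → Cube m → Set
FlippedAt e X Y = Y e ≡ not (X e) × (∀ i → i ≢ e → Y i ≡ X i)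

-- The points of the cube pair up along the coordinate `e`, and the two values of each pair cancel.
Exp-odd : ∀ m (e : Fin m) {g : Cube m → ℚ} → (∀ X Y → FlippedAt e X Y → g Y ≡ - g X) → Exp m g ≡ 0ℚ
Exp-odd (suc m) zero {g} odd = begin
  ½ * (Exp m (g ∘ (true VF.∷_)) + Exp m (g ∘ (false VF.∷_)))           ≡⟨ cong (λ z → ½ * (Exp m (g ∘ (true VF.∷_)) + z)) (Exp-cong m (λ X → odd _ _ (refl , flipped X))) ⟩
  ½ * (Exp m (g ∘ (true VF.∷_)) + Exp m (λ X → - g (true VF.∷ X)))     ≡⟨ cong (½ *_) (sym (Exp-+ m (g ∘ (true VF.∷_)) (λ X → - g (true VF.∷ X)))) ⟩
  ½ * Exp m (λ X → g (true VF.∷ X) - g (true VF.∷ X))                  ≡⟨ cong (½ *_) (trans (Exp-cong m (λ X → +-inverseʳ (g (true VF.∷ X)))) (Exp-0 m)) ⟩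
  ½ * 0ℚ                                                               ≡⟨⟩
  0ℚ                                                                   ∎
  where
  open ≡-Reasoning
  flipped : ∀ X i → i ≢ zero → (false VF.∷ X) i ≡ (true VF.∷ X) i
  flipped X zero i≢0 = contradiction refl i≢0
  flipped X (suc i) _ = refl
Exp-odd (suc m) (suc e) {g} odd = cong₂ (λ y z → ½ * (y + z)) (half true) (half false)
  where
  half : ∀ b → Exp m (g ∘ (b VF.∷_)) ≡ 0ℚ
  half b = Exp-odd m e (λ X Y (eq , neq) → odd _ _ (eq , λ { zero _ → refl ; (suc i) i≢e → neq i (i≢e ∘ cong suc) }))

-- Formal polynomials and their derivatives

mulTerm : ∀ {m} → ℚ × Monomial m → Poly m → Poly m
mulTerm (c , μ) [] = []
mulTerm (c , μ) ((d , ν) ∷ p) = (c * d , μ ++ ν) ∷ mulTerm (c , μ) p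

infixl 7 _⊗_
_⊗_ : ∀ {m} → Poly m → Poly m → Poly m
[] ⊗ q = []
(t ∷ p) ⊗ q = mulTerm t q ++ p ⊗ q

∑ᴾ : ∀ {m k} → (Fin k → Poly m) → Poly m
∑ᴾ {k = zero} p = []
∑ᴾ {k = suc k} p = p zero ++ ∑ᴾ (p ∘ suc)

-- One term per position, kept with coefficient `δ e i` even when it is zero; the Leibniz rules then
-- need no case distinction on equality of variables.
∂ᵐ : ∀ {m} → Fin m → Monomial m → Poly m
∂ᵐ e [] = []
∂ᵐ e (i ∷ μ) = (δ e i , μ) ∷ mulTerm (1ℚ , i ∷ []) (∂ᵐ e μ)

∂ : ∀ {m} → Fin m → Poly m → Poly m
∂ e [] = []
∂ e ((c , μ) ∷ p) = mulTerm (c , []) (∂ᵐ e μ) ++ ∂ e p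

module _ {m} (x : Fin m → ℚ) where

  evalMono-++ : ∀ μ ν → evalMono x (μ ++ ν) ≡ evalMono x μ * evalMono x ν
  evalMono-++ [] ν = sym (*-identityˡ (evalMono x ν))
  evalMono-++ (i ∷ μ) ν = trans (cong (x i *_) (evalMono-++ μ ν)) (sym (*-assoc (x i) (evalMono x μ) (evalMono x ν)))

  eval-++ : ∀ p q → eval (p ++ q) x ≡ eval p x + eval q x
  eval-++ [] q = sym (+-identityˡ (eval q x))
  eval-++ ((c , μ) ∷ p) q = trans (cong (c * evalMono x μ +_) (eval-++ p q)) (sym (+-assoc (c * evalMono x μ) (eval p x) (eval q x)))

  eval-mulTerm : ∀ c μ p → eval (mulTerm (c , μ) p) x ≡ c * evalMono x μ * eval p x
  eval-mulTerm c μ [] = sym (*-zeroʳ (c * evalMono x μ))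
  eval-mulTerm c μ ((d , ν) ∷ p) = trans (cong₂ (λ y z → c * d * y + z) (evalMono-++ μ ν) (eval-mulTerm c μ p)) (lemma c d (evalMono x μ) (evalMono x ν) (eval p x))
    where
    lemma : ∀ c d μ ν p → c * d * (μ * ν) + c * μ * p ≡ c * μ * (d * ν + p)
    lemma = solve-∀ ℚ-ring

  eval-⊗ : ∀ p q → eval (p ⊗ q) x ≡ eval p x * eval q x
  eval-⊗ [] q = sym (*-zeroˡ (eval q x))
  eval-⊗ ((c , μ) ∷ p) q = trans (eval-++ (mulTerm (c , μ) q) (p ⊗ q)) (trans (cong₂ _+_ (eval-mulTerm c μ q) (eval-⊗ p q)) (sym (*-distribʳ-+ (eval q x) (c * evalMono x μ) (eval p x))))

  eval-∑ᴾ : ∀ {k} (p : Fin k → Poly m) → eval (∑ᴾ p) x ≡ ∑ λ i → eval (p i) x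
  eval-∑ᴾ {zero} p = refl
  eval-∑ᴾ {suc k} p = trans (eval-++ (p zero) (∑ᴾ (p ∘ suc))) (cong (eval (p zero) x +_) (eval-∑ᴾ (p ∘ suc)))

  module _ (e : Fin m) where

    eval-∂ᵐ-++ : ∀ μ ν → eval (∂ᵐ e (μ ++ ν)) x ≡ eval (∂ᵐ e μ) x * evalMono x ν + evalMono x μ * eval (∂ᵐ e ν) x
    eval-∂ᵐ-++ [] ν = lemma (evalMono x ν) (eval (∂ᵐ e ν) x)
      where
      lemma : ∀ ν ∂ν → ∂ν ≡ 0ℚ * ν + 1ℚ * ∂ν
      lemma = solve-∀ ℚ-ring
    eval-∂ᵐ-++ (i ∷ μ) ν = begin
      δ e i * evalMono x (μ ++ ν) + eval (mulTerm (1ℚ , i ∷ []) (∂ᵐ e (μ ++ ν))) x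
        ≡⟨ cong₂ (λ y z → δ e i * y + z) (evalMono-++ μ ν) (trans (eval-mulTerm 1ℚ (i ∷ []) (∂ᵐ e (μ ++ ν))) (cong (1ℚ * (x i * 1ℚ) *_) (eval-∂ᵐ-++ μ ν))) ⟩
      δ e i * (evalMono x μ * evalMono x ν) + 1ℚ * (x i * 1ℚ) * (eval (∂ᵐ e μ) x * evalMono x ν + evalMono x μ * eval (∂ᵐ e ν) x)
        ≡⟨ lemma (δ e i) (x i) (evalMono x μ) (evalMono x ν) (eval (∂ᵐ e μ) x) (eval (∂ᵐ e ν) x) ⟩
      (δ e i * evalMono x μ + 1ℚ * (x i * 1ℚ) * eval (∂ᵐ e μ) x) * evalMono x ν + x i * evalMono x μ * eval (∂ᵐ e ν) x
        ≡⟨ cong (λ y → (δ e i * evalMono x μ + y) * evalMono x ν + x i * evalMono x μ * eval (∂ᵐ e ν) x) (sym (eval-mulTerm 1ℚ (i ∷ []) (∂ᵐ e μ))) ⟩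
      (δ e i * evalMono x μ + eval (mulTerm (1ℚ , i ∷ []) (∂ᵐ e μ)) x) * evalMono x ν + x i * evalMono x μ * eval (∂ᵐ e ν) x ∎
      where
      open ≡-Reasoning
      lemma : ∀ d x μ ν ∂μ ∂ν → d * (μ * ν) + 1ℚ * (x * 1ℚ) * (∂μ * ν + μ * ∂ν) ≡ (d * μ + 1ℚ * (x * 1ℚ) * ∂μ) * ν + x * μ * ∂ν
      lemma = solve-∀ ℚ-ring

    eval-∂-∷ : ∀ c μ p → eval (∂ e ((c , μ) ∷ p)) x ≡ c * eval (∂ᵐ e μ) x + eval (∂ e p) x
    eval-∂-∷ c μ p = trans (eval-++ (mulTerm (c , []) (∂ᵐ e μ)) (∂ e p)) (cong (_+ eval (∂ e p) x) (trans (eval-mulTerm c [] (∂ᵐ e μ)) (cong (_* eval (∂ᵐ e μ) x) (*-identityʳ c))))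

    eval-∂-++ : ∀ p q → eval (∂ e (p ++ q)) x ≡ eval (∂ e p) x + eval (∂ e q) x
    eval-∂-++ [] q = sym (+-identityˡ (eval (∂ e q) x))
    eval-∂-++ ((c , μ) ∷ p) q = begin
      eval (∂ e ((c , μ) ∷ p ++ q)) x                              ≡⟨ eval-∂-∷ c μ (p ++ q) ⟩
      c * eval (∂ᵐ e μ) x + eval (∂ e (p ++ q)) x                  ≡⟨ cong (c * eval (∂ᵐ e μ) x +_) (eval-∂-++ p q) ⟩
      c * eval (∂ᵐ e μ) x + (eval (∂ e p) x + eval (∂ e q) x)      ≡⟨ sym (+-assoc (c * eval (∂ᵐ e μ) x) (eval (∂ e p) x) (eval (∂ e q) x)) ⟩
      c * eval (∂ᵐ e μ) x + eval (∂ e p) x + eval (∂ e q) x        ≡⟨ cong (_+ eval (∂ e q) x) (sym (eval-∂-∷ c μ p)) ⟩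
      eval (∂ e ((c , μ) ∷ p)) x + eval (∂ e q) x                  ∎
      where open ≡-Reasoning

    eval-∂-mulTerm : ∀ c μ p → eval (∂ e (mulTerm (c , μ) p)) x ≡ c * eval (∂ᵐ e μ) x * eval p x + c * evalMono x μ * eval (∂ e p) x
    eval-∂-mulTerm c μ [] = lemma (c * eval (∂ᵐ e μ) x) (c * evalMono x μ)
      where
      lemma : ∀ y z → 0ℚ ≡ y * 0ℚ + z * 0ℚ
      lemma = solve-∀ ℚ-ring
    eval-∂-mulTerm c μ ((d , ν) ∷ p) = begin
      eval (∂ e ((c * d , μ ++ ν) ∷ mulTerm (c , μ) p)) x
        ≡⟨ eval-∂-∷ (c * d) (μ ++ ν) (mulTerm (c , μ) p) ⟩
      c * d * eval (∂ᵐ e (μ ++ ν)) x + eval (∂ e (mulTerm (c , μ) p)) x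
        ≡⟨ cong₂ (λ y z → c * d * y + z) (eval-∂ᵐ-++ μ ν) (eval-∂-mulTerm c μ p) ⟩
      c * d * (∂μ * ν′ + μ′ * ∂ν) + (c * ∂μ * eval p x + c * μ′ * eval (∂ e p) x)
        ≡⟨ lemma c d μ′ ν′ ∂μ ∂ν (eval p x) (eval (∂ e p) x) ⟩
      c * ∂μ * (d * ν′ + eval p x) + c * μ′ * (d * ∂ν + eval (∂ e p) x)
        ≡⟨ cong (λ y → c * ∂μ * (d * ν′ + eval p x) + c * μ′ * y) (sym (eval-∂-∷ d ν p)) ⟩
      c * ∂μ * (d * ν′ + eval p x) + c * μ′ * eval (∂ e ((d , ν) ∷ p)) x ∎
      where
      open ≡-Reasoning
      ∂μ = eval (∂ᵐ e μ) x
      ∂ν = eval (∂ᵐ e ν) x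
      μ′ = evalMono x μ
      ν′ = evalMono x ν
      lemma : ∀ c d μ ν ∂μ ∂ν p ∂p → c * d * (∂μ * ν + μ * ∂ν) + (c * ∂μ * p + c * μ * ∂p) ≡ c * ∂μ * (d * ν + p) + c * μ * (d * ∂ν + ∂p)
      lemma = solve-∀ ℚ-ring

    eval-∂-⊗ : ∀ p q → eval (∂ e (p ⊗ q)) x ≡ eval (∂ e p) x * eval q x + eval p x * eval (∂ e q) x
    eval-∂-⊗ [] q = lemma (eval q x) (eval (∂ e q) x)
      where
      lemma : ∀ y z → 0ℚ ≡ 0ℚ * y + 0ℚ * z
      lemma = solve-∀ ℚ-ring
    eval-∂-⊗ ((c , μ) ∷ p) q = begin
      eval (∂ e (mulTerm (c , μ) q ++ p ⊗ q)) x
        ≡⟨ eval-∂-++ (mulTerm (c , μ) q) (p ⊗ q) ⟩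
      eval (∂ e (mulTerm (c , μ) q)) x + eval (∂ e (p ⊗ q)) x
        ≡⟨ cong₂ _+_ (eval-∂-mulTerm c μ q) (eval-∂-⊗ p q) ⟩
      c * ∂μ * q′ + c * μ′ * ∂q + (∂p * q′ + p′ * ∂q)
        ≡⟨ lemma c μ′ ∂μ p′ ∂p q′ ∂q ⟩
      (c * ∂μ + ∂p) * q′ + (c * μ′ + p′) * ∂q
        ≡⟨ cong (λ y → y * q′ + (c * μ′ + p′) * ∂q) (sym (eval-∂-∷ c μ p)) ⟩
      eval (∂ e ((c , μ) ∷ p)) x * q′ + (c * μ′ + p′) * ∂q ∎
      where
      open ≡-Reasoning
      ∂μ = eval (∂ᵐ e μ) x
      μ′ = evalMono x μ
      p′ = eval p x
      q′ = eval q x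
      ∂p = eval (∂ e p) x
      ∂q = eval (∂ e q) x
      lemma : ∀ c μ ∂μ p ∂p q ∂q → c * ∂μ * q + c * μ * ∂q + (∂p * q + p * ∂q) ≡ (c * ∂μ + ∂p) * q + (c * μ + p) * ∂q
      lemma = solve-∀ ℚ-ring

    eval-∂-∑ᴾ : ∀ {k} (p : Fin k → Poly m) → eval (∂ e (∑ᴾ p)) x ≡ ∑ λ i → eval (∂ e (p i)) x
    eval-∂-∑ᴾ {zero} p = refl
    eval-∂-∑ᴾ {suc k} p = trans (eval-∂-++ (p zero) (∑ᴾ (p ∘ suc))) (cong (eval (∂ e (p zero)) x +_) (eval-∂-∑ᴾ (p ∘ suc)))

-- Integration by parts on the cube

NonNeg : ∀ {m} → Poly m → Set
NonNeg = All (λ t → 0ℚ ≤ proj₁ t)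

mulTerm-nonNeg : ∀ {m c} (μ : Monomial m) {p} → 0ℚ ≤ c → NonNeg p → NonNeg (mulTerm (c , μ) p)
mulTerm-nonNeg μ 0≤c [] = []
mulTerm-nonNeg μ 0≤c (0≤d ∷ p≥0) = *-nonNeg 0≤c 0≤d ∷ mulTerm-nonNeg μ 0≤c p≥0

⊗-nonNeg : ∀ {m} {p q : Poly m} → NonNeg p → NonNeg q → NonNeg (p ⊗ q)
⊗-nonNeg [] q≥0 = []
⊗-nonNeg {p = (c , μ) ∷ p} (0≤c ∷ p≥0) q≥0 = ++⁺ (mulTerm-nonNeg μ 0≤c q≥0) (⊗-nonNeg p≥0 q≥0)

∑ᴾ-nonNeg : ∀ {m k} {p : Fin k → Poly m} → (∀ i → NonNeg (p i)) → NonNeg (∑ᴾ p)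
∑ᴾ-nonNeg {k = zero} p≥0 = []
∑ᴾ-nonNeg {k = suc k} p≥0 = ++⁺ (p≥0 zero) (∑ᴾ-nonNeg (p≥0 ∘ suc))

∂ᵐ-nonNeg : ∀ {m} (e : Fin m) μ → NonNeg (∂ᵐ e μ)
∂ᵐ-nonNeg e [] = []
∂ᵐ-nonNeg e (i ∷ μ) = 0≤δ e i ∷ mulTerm-nonNeg (i ∷ []) 0≤1 (∂ᵐ-nonNeg e μ)

-- Since x e ² = 1 on the cube, multiplying by x e cancels an occurrence of e in μ; that occurrence is also one of the terms of ∂ᵐ e μ.
record Cancellation {m} (e : Fin m) (μ : Monomial m) : Set where
  field
    cancelled : Monomial m
    others : Poly m
    others-nonNeg : NonNeg others
    shorter : length cancelled ℕ.< length μ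
    product : ∀ x → x e * x e ≡ 1ℚ → x e * evalMono x μ ≡ evalMono x cancelled
    derivative : ∀ x → eval (∂ᵐ e μ) x ≡ evalMono x cancelled + eval others x

cancellation : ∀ {m} {e : Fin m} {μ} → e ∈ μ → Cancellation e μ
cancellation {e = e} {_ ∷ μ} (here refl) = record
  { cancelled = μ
  ; others = mulTerm (1ℚ , e ∷ []) (∂ᵐ e μ)
  ; others-nonNeg = mulTerm-nonNeg (e ∷ []) 0≤1 (∂ᵐ-nonNeg e μ)
  ; shorter = ℕₚ.≤-refl
  ; product = λ x x²≡1 → trans (sym (*-assoc (x e) (x e) (evalMono x μ))) (trans (cong (_* evalMono x μ) x²≡1) (*-identityˡ (evalMono x μ)))
  ; derivative = λ x → cong (_+ eval (mulTerm (1ℚ , e ∷ []) (∂ᵐ e μ)) x) (trans (cong (_* evalMono x μ) (δ-refl e)) (*-identityˡ (evalMono x μ)))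
  }
cancellation {e = e} {i ∷ μ} (there e∈μ) = record
  { cancelled = i ∷ cancelled
  ; others = (δ e i , μ) ∷ mulTerm (1ℚ , i ∷ []) others
  ; others-nonNeg = 0≤δ e i ∷ mulTerm-nonNeg (i ∷ []) 0≤1 others-nonNeg
  ; shorter = ℕ.s≤s shorter
  ; product = λ x x²≡1 → trans (swap (x e) (x i) (evalMono x μ)) (cong (x i *_) (product x x²≡1))
  ; derivative = λ x → begin
      δ e i * evalMono x μ + eval (mulTerm (1ℚ , i ∷ []) (∂ᵐ e μ)) x
        ≡⟨ cong (δ e i * evalMono x μ +_) (trans (eval-mulTerm x 1ℚ (i ∷ []) (∂ᵐ e μ)) (cong (1ℚ * (x i * 1ℚ) *_) (derivative x))) ⟩
      δ e i * evalMono x μ + 1ℚ * (x i * 1ℚ) * (evalMono x cancelled + eval others x)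
        ≡⟨ collect (δ e i * evalMono x μ) (x i) (evalMono x cancelled) (eval others x) ⟩
      x i * evalMono x cancelled + (δ e i * evalMono x μ + 1ℚ * (x i * 1ℚ) * eval others x)
        ≡⟨ cong (λ y → x i * evalMono x cancelled + (δ e i * evalMono x μ + y)) (sym (eval-mulTerm x 1ℚ (i ∷ []) others)) ⟩
      x i * evalMono x cancelled + (δ e i * evalMono x μ + eval (mulTerm (1ℚ , i ∷ []) others) x) ∎
  }
  where
  open Cancellation (cancellation e∈μ)
  open ≡-Reasoning
  swap : ∀ a b c → a * (b * c) ≡ b * (a * c)
  swap = solve-∀ ℚ-ring
  collect : ∀ d x c o → d + 1ℚ * (x * 1ℚ) * (c + o) ≡ x * c + (d + 1ℚ * (x * 1ℚ) * o)
  collect = solve-∀ ℚ-ring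

sign²≡1 : ∀ b → sign b * sign b ≡ 1ℚ
sign²≡1 true = refl
sign²≡1 false = refl

sign-not : ∀ b → sign (not b) ≡ - sign b
sign-not true = refl
sign-not false = refl

monoPM : ∀ {m} → Monomial m → Cube m → ℚ
monoPM μ X = evalMono (sign ∘ X) μ

monoPM-flipped : ∀ {m} {e : Fin m} {X Y} μ → e ∉ μ → FlippedAt e X Y → monoPM μ Y ≡ monoPM μ X
monoPM-flipped [] e∉μ flip = refl
monoPM-flipped (i ∷ μ) e∉μ flip = cong₂ _*_ (cong sign (proj₂ flip i (λ i≡e → e∉μ (here (sym i≡e))))) (monoPM-flipped μ (e∉μ ∘ there) flip)

Exp-monomial-∉ : ∀ {m} (e : Fin m) {μ} → e ∉ μ → Exp m (λ X → sign (X e) * monoPM μ X) ≡ 0ℚ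
Exp-monomial-∉ e {μ} e∉μ = Exp-odd _ e λ X Y flip →
  trans (cong₂ _*_ (trans (cong sign (proj₁ flip)) (sign-not (X e))) (monoPM-flipped μ e∉μ flip)) (sym (neg-distribˡ-* (sign (X e)) (monoPM μ X)))

Exp-monomial-∈ : ∀ {m} {e : Fin m} {μ} (e∈μ : e ∈ μ) → Exp m (λ X → sign (X e) * monoPM μ X) ≡ Exp m (monoPM (Cancellation.cancelled (cancellation e∈μ)))
Exp-monomial-∈ {e = e} e∈μ = Exp-cong _ (λ X → Cancellation.product (cancellation e∈μ) (sign ∘ X) (sign²≡1 (X e)))

-- Equal variables cancel in pairs. Either this ends at the empty monomial, of expectation one, or
-- some variable is left without a partner and its sign flip makes the expectation vanish.
Exp-monomial-nonNeg : ∀ {m} (μ : Monomial m) → 0ℚ ≤ Exp m (monoPM μ)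
Exp-monomial-nonNeg μ = bounded (length μ) μ ℕₚ.≤-refl
  where
  -- `cancelled` is shorter than the monomial but not a structural part of it, so the recursion runs
  -- on a bound `k` for the length.
  bounded : ∀ {m} k (μ : Monomial m) → length μ ℕ.≤ k → 0ℚ ≤ Exp m (monoPM μ)
  bounded {m} k [] _ = subst (_≤ Exp m (λ _ → 1ℚ)) (Exp-0 m) (Exp-mono-≤ m (λ _ → 0≤1))
  bounded {m} (suc k) (e ∷ μ) (ℕ.s≤s |μ|≤k) with _∈?_ Finₚ._≟_ e μ
  ... | yes e∈μ = subst (0ℚ ≤_) (sym (Exp-monomial-∈ e∈μ)) (bounded k cancelled (ℕₚ.≤-trans (ℕₚ.<⇒≤ shorter) |μ|≤k))
    where open Cancellation (cancellation e∈μ)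
  ... | no e∉μ = ≤-reflexive (sym (Exp-monomial-∉ e e∉μ))

Exp-∷ : ∀ {m} c (μ : Monomial m) p → Exp m (evalPM ((c , μ) ∷ p)) ≡ c * Exp m (monoPM μ) + Exp m (evalPM p)
Exp-∷ {m} c μ p = trans (Exp-+ m (λ X → c * monoPM μ X) (evalPM p)) (cong (_+ Exp m (evalPM p)) (Exp-*ˡ m c (monoPM μ)))

Exp-poly-nonNeg : ∀ {m} {p : Poly m} → NonNeg p → 0ℚ ≤ Exp m (evalPM p)
Exp-poly-nonNeg {m} [] = ≤-reflexive (sym (Exp-0 m))
Exp-poly-nonNeg {m} {(c , μ) ∷ p} (0≤c ∷ p≥0) = subst (0ℚ ≤_) (sym (Exp-∷ c μ p)) (+-nonNeg (*-nonNeg 0≤c (Exp-monomial-nonNeg μ)) (Exp-poly-nonNeg p≥0))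

-- If `e` does not occur, the left side vanishes by oddness. If it occurs, multiplying by it has the
-- same effect as deleting one occurrence, which is one term of the derivative; the other terms have
-- nonnegative mean. The inequality is strict in general because the derivative deletes every
-- occurrence in turn.
Exp-monomial-parts : ∀ {m} (e : Fin m) μ → Exp m (λ X → sign (X e) * monoPM μ X) ≤ Exp m (evalPM (∂ᵐ e μ))
Exp-monomial-parts {m} e μ with _∈?_ Finₚ._≟_ e μ
... | no e∉μ = subst (_≤ Exp m (evalPM (∂ᵐ e μ))) (sym (Exp-monomial-∉ e e∉μ)) (Exp-poly-nonNeg (∂ᵐ-nonNeg e μ))
... | yes e∈μ = begin
  Exp m (λ X → sign (X e) * monoPM μ X)             ≡⟨ Exp-monomial-∈ e∈μ ⟩
  Exp m (monoPM cancelled)                          ≤⟨ p≤p+q (Exp-poly-nonNeg others-nonNeg) ⟩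
  Exp m (monoPM cancelled) + Exp m (evalPM others)  ≡⟨ sym (Exp-+ m (monoPM cancelled) (evalPM others)) ⟩
  Exp m (λ X → monoPM cancelled X + evalPM others X) ≡⟨ Exp-cong m (λ X → sym (derivative (sign ∘ X))) ⟩
  Exp m (evalPM (∂ᵐ e μ))                           ∎
  where
  open ≤-Reasoning
  open Cancellation (cancellation e∈μ)

-- The inequality replacing Gaussian integration by parts.
Exp-parts : ∀ {m} (e : Fin m) {p} → NonNeg p → Exp m (λ X → sign (X e) * evalPM p X) ≤ Exp m (evalPM (∂ e p))
Exp-parts {m} e [] = ≤-reflexive (Exp-cong m (λ X → *-zeroʳ (sign (X e))))
Exp-parts {m} e {(c , μ) ∷ p} (0≤c ∷ p≥0) = begin
  Exp m (λ X → sign (X e) * (c * monoPM μ X + evalPM p X))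
    ≡⟨ Exp-cong m (λ X → expand (sign (X e)) c (monoPM μ X) (evalPM p X)) ⟩
  Exp m (λ X → c * (sign (X e) * monoPM μ X) + sign (X e) * evalPM p X)
    ≡⟨ Exp-+ m (λ X → c * (sign (X e) * monoPM μ X)) (λ X → sign (X e) * evalPM p X) ⟩
  Exp m (λ X → c * (sign (X e) * monoPM μ X)) + Exp m (λ X → sign (X e) * evalPM p X)
    ≡⟨ cong (_+ Exp m (λ X → sign (X e) * evalPM p X)) (Exp-*ˡ m c (λ X → sign (X e) * monoPM μ X)) ⟩
  c * Exp m (λ X → sign (X e) * monoPM μ X) + Exp m (λ X → sign (X e) * evalPM p X)
    ≤⟨ +-mono-≤ (*-monoˡ-≤ 0≤c (Exp-monomial-parts e μ)) (Exp-parts e p≥0) ⟩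
  c * Exp m (evalPM (∂ᵐ e μ)) + Exp m (evalPM (∂ e p))
    ≡⟨ cong (_+ Exp m (evalPM (∂ e p))) (sym (Exp-*ˡ m c (evalPM (∂ᵐ e μ)))) ⟩
  Exp m (λ X → c * evalPM (∂ᵐ e μ) X) + Exp m (evalPM (∂ e p))
    ≡⟨ sym (Exp-+ m (λ X → c * evalPM (∂ᵐ e μ) X) (evalPM (∂ e p))) ⟩
  Exp m (λ X → c * evalPM (∂ᵐ e μ) X + evalPM (∂ e p) X)
    ≡⟨ Exp-cong m (λ X → sym (eval-∂-∷ (sign ∘ X) e c μ p)) ⟩
  Exp m (evalPM (∂ e ((c , μ) ∷ p))) ∎
  where
  open ≤-Reasoning
  expand : ∀ s c μ p → s * (c * μ + p) ≡ c * (s * μ) + s * p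
  expand = solve-∀ ℚ-ring

-- Powers of a symmetric matrix

Mat : ℕ → Set
Mat n = Fin n → Fin n → ℚ

pow : ∀ {n} → Mat n → ℕ → Mat n
pow A zero = δ
pow A (suc a) i j = ∑ λ k → A i k * pow A a k j

tr : ∀ {n} → Mat n → ℚ
tr A = ∑ λ i → A i i

Symmetric : ∀ {n} → Mat n → Set
Symmetric A = ∀ i j → A i j ≡ A j i

module _ {n} (A : Mat n) where

  pow-+ : ∀ a b i j → pow A (a ℕ.+ b) i j ≡ ∑ λ k → pow A a i k * pow A b k j
  pow-+ zero b i j = sym (∑-δ i (λ k → pow A b k j))
  pow-+ (suc a) b i j = begin
    ∑ (λ k → A i k * pow A (a ℕ.+ b) k j)
      ≡⟨ sum-cong-≗ (λ k → trans (cong (A i k *_) (pow-+ a b k j)) (*-distribˡ-sum (A i k) (λ l → pow A a k l * pow A b l j))) ⟩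
    ∑ (λ k → ∑ λ l → A i k * (pow A a k l * pow A b l j))
      ≡⟨ ∑-comm (λ k l → A i k * (pow A a k l * pow A b l j)) ⟩
    ∑ (λ l → ∑ λ k → A i k * (pow A a k l * pow A b l j))
      ≡⟨ sum-cong-≗ (λ l → trans (sum-cong-≗ (λ k → sym (*-assoc (A i k) (pow A a k l) (pow A b l j)))) (sym (*-distribʳ-sum (pow A b l j) (λ k → A i k * pow A a k l)))) ⟩
    ∑ (λ l → pow A (suc a) i l * pow A b l j) ∎
    where open ≡-Reasoning

  pow-1 : ∀ i j → pow A 1 i j ≡ A i j
  pow-1 i j = trans (sum-cong-≗ (λ k → trans (cong (A i k *_) (δ-sym k j)) (*-comm (A i k) (δ j k)))) (∑-δ j (A i))

  pow-sucʳ : ∀ a i j → pow A (suc a) i j ≡ ∑ λ k → pow A a i k * A k j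
  pow-sucʳ a i j = trans (cong (λ b → pow A b i j) (ℕₚ.+-comm 1 a)) (trans (pow-+ a 1 i j) (sum-cong-≗ (λ k → cong (pow A a i k *_) (pow-1 k j))))

  pow-symmetric : Symmetric A → ∀ a → Symmetric (pow A a)
  pow-symmetric A-sym zero i j = δ-sym i j
  pow-symmetric A-sym (suc a) i j = begin
    ∑ (λ k → A i k * pow A a k j)  ≡⟨ sum-cong-≗ (λ k → trans (cong₂ _*_ (A-sym i k) (pow-symmetric A-sym a k j)) (*-comm (A k i) (pow A a j k))) ⟩
    ∑ (λ k → pow A a j k * A k i)  ≡⟨ sym (pow-sucʳ a j i) ⟩
    pow A (suc a) j i              ∎
    where open ≡-Reasoning

-- Sums over s + t = a

conv : (ℕ → ℕ → ℚ) → ℕ → ℚ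
conv h zero = h 0 0
conv h (suc a) = h 0 (suc a) + conv (λ s → h (suc s)) a

conv-cong : ∀ {h k : ℕ → ℕ → ℚ} → (∀ s t → h s t ≡ k s t) → ∀ a → conv h a ≡ conv k a
conv-cong h≗k zero = h≗k 0 0
conv-cong h≗k (suc a) = cong₂ _+_ (h≗k 0 (suc a)) (conv-cong (λ s → h≗k (suc s)) a)

conv-mono-≤ : ∀ {h k : ℕ → ℕ → ℚ} a → (∀ s t → s ℕ.+ t ≡ a → h s t ≤ k s t) → conv h a ≤ conv k a
conv-mono-≤ zero h≤k = h≤k 0 0 refl
conv-mono-≤ (suc a) h≤k = +-mono-≤ (h≤k 0 (suc a) refl) (conv-mono-≤ a (λ s t eq → h≤k (suc s) t (cong suc eq)))

conv-+ : ∀ (h k : ℕ → ℕ → ℚ) a → conv (λ s t → h s t + k s t) a ≡ conv h a + conv k a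
conv-+ h k zero = refl
conv-+ h k (suc a) = trans (cong (h 0 (suc a) + k 0 (suc a) +_) (conv-+ (λ s → h (suc s)) (λ s → k (suc s)) a))
  (lemma (h 0 (suc a)) (k 0 (suc a)) (conv (λ s → h (suc s)) a) (conv (λ s → k (suc s)) a))
  where
  lemma : ∀ a b c d → a + b + (c + d) ≡ a + c + (b + d)
  lemma = solve-∀ ℚ-ring

conv-*ˡ : ∀ c (h : ℕ → ℕ → ℚ) a → conv (λ s t → c * h s t) a ≡ c * conv h a
conv-*ˡ c h zero = refl
conv-*ˡ c h (suc a) = trans (cong (c * h 0 (suc a) +_) (conv-*ˡ c (λ s → h (suc s)) a)) (sym (*-distribˡ-+ c (h 0 (suc a)) (conv (λ s → h (suc s)) a)))

conv-∑ : ∀ {n} (h : Fin n → ℕ → ℕ → ℚ) a → ∑ (λ i → conv (h i) a) ≡ conv (λ s t → ∑ λ i → h i s t) a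
conv-∑ h zero = refl
conv-∑ h (suc a) = trans (∑-distrib-+ (λ i → h i 0 (suc a)) (λ i → conv (λ s → h i (suc s)) a)) (cong (∑ (λ i → h i 0 (suc a)) +_) (conv-∑ (λ i s → h i (suc s)) a))

conv-diagonal : ∀ (g : ℕ → ℚ) a → conv (λ s t → g (s ℕ.+ t)) a ≡ ℕ→ℚ (suc a) * g a
conv-diagonal g zero = sym (*-identityˡ (g 0))
conv-diagonal g (suc a) = begin
  g (suc a) + conv (λ s t → g (suc (s ℕ.+ t))) a ≡⟨ cong (g (suc a) +_) (conv-diagonal (g ∘ suc) a) ⟩
  g (suc a) + ℕ→ℚ (suc a) * g (suc a)            ≡⟨ lemma (g (suc a)) (ℕ→ℚ (suc a)) ⟩
  (1ℚ + ℕ→ℚ (suc a)) * g (suc a)                 ≡⟨ cong (_* g (suc a)) (sym (ℕ→ℚ-suc (suc a))) ⟩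
  ℕ→ℚ (suc (suc a)) * g (suc a)                  ∎
  where
  open ≡-Reasoning
  lemma : ∀ g a → g + a * g ≡ (1ℚ + a) * g
  lemma = solve-∀ ℚ-ring

Exp-conv : ∀ m (g : ℕ → ℕ → Cube m → ℚ) a → Exp m (λ X → conv (λ s t → g s t X) a) ≡ conv (λ s t → Exp m (g s t)) a
Exp-conv m g zero = refl
Exp-conv m g (suc a) = trans (Exp-+ m (g 0 (suc a)) (λ X → conv (λ s t → g (suc s) t X) a)) (cong (Exp m (g 0 (suc a)) +_) (Exp-conv m (λ s → g (suc s)) a))

-- Double sums and the fusion of loops

∑∑ : ∀ {n} → (Fin n → Fin n → ℚ) → ℚ
∑∑ f = ∑ λ x → ∑ λ y → f x y

∑∑-cong : ∀ {n} {f g : Fin n → Fin n → ℚ} → (∀ x y → f x y ≡ g x y) → ∑∑ f ≡ ∑∑ g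
∑∑-cong f≗g = sum-cong-≗ λ x → sum-cong-≗ (f≗g x)

∑∑-+ : ∀ {n} (f g : Fin n → Fin n → ℚ) → ∑∑ (λ x y → f x y + g x y) ≡ ∑∑ f + ∑∑ g
∑∑-+ f g = trans (sum-cong-≗ λ x → ∑-distrib-+ (f x) (g x)) (∑-distrib-+ (λ x → ∑ (f x)) (λ x → ∑ (g x)))

∑∑-*ˡ : ∀ {n} c (f : Fin n → Fin n → ℚ) → ∑∑ (λ x y → c * f x y) ≡ c * ∑∑ f
∑∑-*ˡ c f = trans (sum-cong-≗ λ x → sym (*-distribˡ-sum c (f x))) (sym (*-distribˡ-sum c (λ x → ∑ (f x))))

-- Sums over the ways of fusing a loop of length a + 2 with one of the loops in a list; φ is applied to the resulting list of lengths.
fuse : ℕ → (List ℕ → ℚ) → List ℕ → ℚ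
fuse a φ [] = 0ℚ
fuse a φ (b ∷ bs) = 2ℚ * ℕ→ℚ b * φ (a ℕ.+ b ∷ bs) + fuse a (λ cs → φ (b ∷ cs)) bs

fuse-*ˡ : ∀ a c φ bs → fuse a (λ cs → c * φ cs) bs ≡ c * fuse a φ bs
fuse-*ˡ a c φ [] = sym (*-zeroʳ c)
fuse-*ˡ a c φ (b ∷ bs) = trans (cong (2ℚ * ℕ→ℚ b * (c * φ (a ℕ.+ b ∷ bs)) +_) (fuse-*ˡ a c (λ cs → φ (b ∷ cs)) bs))
  (lemma (2ℚ * ℕ→ℚ b) c (φ (a ℕ.+ b ∷ bs)) (fuse a (λ cs → φ (b ∷ cs)) bs))
  where
  lemma : ∀ b c p f → b * (c * p) + c * f ≡ c * (b * p + f)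
  lemma = solve-∀ ℚ-ring

fuse-mono-≤ : ∀ a {φ ψ : List ℕ → ℚ} bs → (∀ cs → sum cs ≡ a ℕ.+ sum bs → φ cs ≤ ψ cs) → fuse a φ bs ≤ fuse a ψ bs
fuse-mono-≤ a [] φ≤ψ = ≤-refl
fuse-mono-≤ a (b ∷ bs) φ≤ψ = +-mono-≤ (*-monoˡ-≤ (*-nonNeg (nonNegative⁻¹ 2ℚ) (0≤ℕ→ℚ b)) (φ≤ψ (a ℕ.+ b ∷ bs) (ℕₚ.+-assoc a b (sum bs))))
  (fuse-mono-≤ a bs (λ cs eq → φ≤ψ (b ∷ cs) (trans (cong (b ℕ.+_) eq) (trans (sym (ℕₚ.+-assoc b a (sum bs))) (trans (cong (ℕ._+ sum bs) (ℕₚ.+-comm b a)) (ℕₚ.+-assoc a b (sum bs)))))))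

Exp-fuse : ∀ m a (φ : Cube m → List ℕ → ℚ) bs → Exp m (λ X → fuse a (φ X) bs) ≡ fuse a (λ cs → Exp m (λ X → φ X cs)) bs
Exp-fuse m a φ [] = Exp-0 m
Exp-fuse m a φ (b ∷ bs) = trans (Exp-+ m (λ X → 2ℚ * ℕ→ℚ b * φ X (a ℕ.+ b ∷ bs)) (λ X → fuse a (λ cs → φ X (b ∷ cs)) bs))
  (cong₂ _+_ (Exp-*ˡ m (2ℚ * ℕ→ℚ b) (λ X → φ X (a ℕ.+ b ∷ bs))) (Exp-fuse m a (λ X cs → φ X (b ∷ cs)) bs))

-- The adjacency matrix

edge : ∀ {n} {x y : Fin n} → x Fin.< y → Fin (N n)
edge {x = x} {y} x<y = index (∈-filter⁺ (λ p → proj₁ p Finₚ.<? proj₂ p) (∈-cartesianProduct⁺ (∈-allFin x) (∈-allFin y)) x<y)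

lookup-edge : ∀ {n} {x y : Fin n} (x<y : x Fin.< y) → lookup (pairs n) (edge x<y) ≡ (x , y)
lookup-edge {x = x} {y} x<y = sym (lookup-index (∈-filter⁺ (λ p → proj₁ p Finₚ.<? proj₂ p) (∈-cartesianProduct⁺ (∈-allFin x) (∈-allFin y)) x<y))

δδ-≡0 : ∀ {m n} (i x : Fin m) (j y : Fin n) → ¬ (i ≡ x × j ≡ y) → δ i x * δ j y ≡ 0ℚ
δδ-≡0 i x j y ne with i Finₚ.≟ x
... | no i≢x = trans (cong (_* δ j y) (δ-≢ i x i≢x)) (*-zeroˡ (δ j y))
... | yes i≡x = trans (cong (δ i x *_) (δ-≢ j y (λ j≡y → ne (i≡x , j≡y)))) (*-zeroʳ (δ i x))

module _ {n : ℕ} where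

  δ-edge : ∀ {x y i j : Fin n} (x<y : x Fin.< y) (i<j : i Fin.< j) → δ (edge x<y) (edge i<j) ≡ δ i x * δ j y
  δ-edge {x} {y} {i} {j} x<y i<j with edge x<y Finₚ.≟ edge i<j
  ... | no e≢e′ = trans (δ-≢ (edge x<y) (edge i<j) e≢e′) (sym (δδ-≡0 i x j y λ { (refl , refl) → e≢e′ (cong edge (ℕₚ.<-irrelevant x<y i<j)) }))
  ... | yes e≡e′ with trans (sym (lookup-edge x<y)) (trans (cong (lookup (pairs n)) e≡e′) (lookup-edge i<j))
  ...   | refl = trans (cong (δ (edge x<y)) (sym e≡e′)) (trans (δ-refl (edge x<y)) (sym (cong₂ _*_ (δ-refl x) (δ-refl y))))

  -- The comparison is an argument, so that one `with` on `Finₚ.<-cmp x y` reduces the matrix entry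
  -- and `edgeOf` together.
  edgeTerm : ∀ {x y : Fin n} → Tri (x Fin.< y) (x ≡ y) (y Fin.< x) → Poly (N n)
  edgeTerm (tri< x<y _ _) = (1ℚ , edge x<y ∷ []) ∷ []
  edgeTerm (tri≈ _ _ _) = []
  edgeTerm (tri> _ _ y<x) = (1ℚ , edge y<x ∷ []) ∷ []

  adjᴾ : Fin n → Fin n → Poly (N n)
  adjᴾ x y = edgeTerm (Finₚ.<-cmp x y)

  adj : Graph n → Mat n
  adj X x y = evalPM (adjᴾ x y) X

  edgeOf : ∀ {x y : Fin n} → x ≢ y → Tri (x Fin.< y) (x ≡ y) (y Fin.< x) → Fin (N n)
  edgeOf x≢y (tri< x<y _ _) = edge x<y
  edgeOf x≢y (tri≈ _ x≡y _) = contradiction x≡y x≢y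
  edgeOf x≢y (tri> _ _ y<x) = edge y<x

  between : ∀ {x y : Fin n} → x ≢ y → Fin (N n)
  between {x} {y} x≢y = edgeOf x≢y (Finₚ.<-cmp x y)

  adj-≢ : ∀ {x y : Fin n} (x≢y : x ≢ y) X → adj X x y ≡ sign (X (between x≢y))
  adj-≢ {x} {y} x≢y X with Finₚ.<-cmp x y
  ... | tri< x<y _ _ = lemma (sign (X (edge x<y)))
    where
    lemma : ∀ s → 1ℚ * (s * 1ℚ) + 0ℚ ≡ s
    lemma = solve-∀ ℚ-ring
  ... | tri≈ _ x≡y _ = contradiction x≡y x≢y
  ... | tri> _ _ y<x = lemma (sign (X (edge y<x)))
    where
    lemma : ∀ s → 1ℚ * (s * 1ℚ) + 0ℚ ≡ s
    lemma = solve-∀ ℚ-ring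

  adj-diagonal : ∀ x X → adj X x x ≡ 0ℚ
  adj-diagonal x X with Finₚ.<-cmp x x
  ... | tri< x<x _ _ = contradiction x<x (ℕₚ.<-irrefl refl)
  ... | tri≈ _ _ _ = refl
  ... | tri> _ _ x<x = contradiction x<x (ℕₚ.<-irrefl refl)

  adj-symmetric : ∀ (X : Graph n) → Symmetric (adj X)
  adj-symmetric X x y with Finₚ.<-cmp x y | Finₚ.<-cmp y x
  ... | tri< x<y _ _ | tri> _ _ x<y′ = cong (λ p → evalPM ((1ℚ , edge p ∷ []) ∷ []) X) (ℕₚ.<-irrelevant x<y x<y′)
  ... | tri≈ _ _ _ | tri≈ _ _ _ = refl
  ... | tri> _ _ y<x | tri< y<x′ _ _ = cong (λ p → evalPM ((1ℚ , edge p ∷ []) ∷ []) X) (ℕₚ.<-irrelevant y<x y<x′)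
  ... | tri< _ x≢y _ | tri≈ _ y≡x _ = ⊥-elim (x≢y (sym y≡x))
  ... | tri< x<y _ _ | tri< y<x _ _ = ⊥-elim (ℕₚ.<-asym y<x x<y)
  ... | tri≈ _ x≡y _ | tri< _ y≢x _ = ⊥-elim (y≢x (sym x≡y))
  ... | tri≈ _ x≡y _ | tri> _ y≢x _ = ⊥-elim (y≢x (sym x≡y))
  ... | tri> _ x≢y _ | tri≈ _ y≡x _ = ⊥-elim (x≢y (sym y≡x))
  ... | tri> _ _ y<x | tri> _ _ x<y = ⊥-elim (ℕₚ.<-asym y<x x<y)

  eval-∂-edge : ∀ (e e′ : Fin (N n)) (X : Graph n) → evalPM (∂ e ((1ℚ , e′ ∷ []) ∷ [])) X ≡ δ e e′
  eval-∂-edge e e′ X = lemma (δ e e′)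
    where
    lemma : ∀ d → 1ℚ * d * 1ℚ + 0ℚ ≡ d
    lemma = solve-∀ ℚ-ring

  -- An undirected edge variable sits in both entries xy and yx, hence two products; as x ≠ y, at
  -- most one of them is nonzero.
  eval-∂-adjᴾ : ∀ {x y} (x≢y : x ≢ y) i j X → evalPM (∂ (between x≢y) (adjᴾ i j)) X ≡ δ i x * δ j y + δ i y * δ j x
  eval-∂-adjᴾ {x} {y} x≢y i j X with Finₚ.<-cmp x y | Finₚ.<-cmp i j
  ... | tri≈ _ x≡y _ | _ = ⊥-elim (x≢y x≡y)
  ... | tri< _ _ _ | tri≈ _ i≡j _ = sym (cong₂ _+_ (δδ-≡0 i x j y λ { (refl , refl) → x≢y i≡j }) (δδ-≡0 i y j x λ { (refl , refl) → x≢y (sym i≡j) }))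
  ... | tri> _ _ _ | tri≈ _ i≡j _ = sym (cong₂ _+_ (δδ-≡0 i x j y λ { (refl , refl) → x≢y i≡j }) (δδ-≡0 i y j x λ { (refl , refl) → x≢y (sym i≡j) }))
  ... | tri< x<y _ _ | tri< i<j _ _ = begin
    evalPM (∂ (edge x<y) ((1ℚ , edge i<j ∷ []) ∷ [])) X ≡⟨ eval-∂-edge (edge x<y) (edge i<j) X ⟩
    δ (edge x<y) (edge i<j)                             ≡⟨ δ-edge x<y i<j ⟩
    δ i x * δ j y                                       ≡⟨ sym (+-identityʳ (δ i x * δ j y)) ⟩
    δ i x * δ j y + 0ℚ                                  ≡⟨ cong (δ i x * δ j y +_) (sym (δδ-≡0 i y j x λ { (refl , refl) → ℕₚ.<-asym x<y i<j })) ⟩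
    δ i x * δ j y + δ i y * δ j x                       ∎
    where open ≡-Reasoning
  ... | tri< x<y _ _ | tri> _ _ j<i = begin
    evalPM (∂ (edge x<y) ((1ℚ , edge j<i ∷ []) ∷ [])) X ≡⟨ eval-∂-edge (edge x<y) (edge j<i) X ⟩
    δ (edge x<y) (edge j<i)                             ≡⟨ δ-edge x<y j<i ⟩
    δ j x * δ i y                                       ≡⟨ *-comm (δ j x) (δ i y) ⟩
    δ i y * δ j x                                       ≡⟨ sym (+-identityˡ (δ i y * δ j x)) ⟩
    0ℚ + δ i y * δ j x                                  ≡⟨ cong (_+ δ i y * δ j x) (sym (δδ-≡0 i x j y λ { (refl , refl) → ℕₚ.<-asym x<y j<i })) ⟩
    δ i x * δ j y + δ i y * δ j x                       ∎
    where open ≡-Reasoning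
  ... | tri> _ _ y<x | tri< i<j _ _ = begin
    evalPM (∂ (edge y<x) ((1ℚ , edge i<j ∷ []) ∷ [])) X ≡⟨ eval-∂-edge (edge y<x) (edge i<j) X ⟩
    δ (edge y<x) (edge i<j)                             ≡⟨ δ-edge y<x i<j ⟩
    δ i y * δ j x                                       ≡⟨ sym (+-identityˡ (δ i y * δ j x)) ⟩
    0ℚ + δ i y * δ j x                                  ≡⟨ cong (_+ δ i y * δ j x) (sym (δδ-≡0 i x j y λ { (refl , refl) → ℕₚ.<-asym y<x i<j })) ⟩
    δ i x * δ j y + δ i y * δ j x                       ∎
    where open ≡-Reasoning
  ... | tri> _ _ y<x | tri> _ _ j<i = begin
    evalPM (∂ (edge y<x) ((1ℚ , edge j<i ∷ []) ∷ [])) X ≡⟨ eval-∂-edge (edge y<x) (edge j<i) X ⟩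
    δ (edge y<x) (edge j<i)                             ≡⟨ δ-edge y<x j<i ⟩
    δ j y * δ i x                                       ≡⟨ *-comm (δ j y) (δ i x) ⟩
    δ i x * δ j y                                       ≡⟨ sym (+-identityʳ (δ i x * δ j y)) ⟩
    δ i x * δ j y + 0ℚ                                  ≡⟨ cong (δ i x * δ j y +_) (sym (δδ-≡0 i y j x λ { (refl , refl) → ℕₚ.<-asym y<x j<i })) ⟩
    δ i x * δ j y + δ i y * δ j x                       ∎
    where open ≡-Reasoning

  -- Products of traces of powers as polynomials

  powᴾ : ℕ → Fin n → Fin n → Poly (N n)
  powᴾ zero i j = (δ i j , []) ∷ []
  powᴾ (suc a) i j = ∑ᴾ λ k → adjᴾ i k ⊗ powᴾ a k j

  trᴾ : ℕ → Poly (N n)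
  trᴾ a = ∑ᴾ λ i → powᴾ a i i

  trsᴾ : List ℕ → Poly (N n)
  trsᴾ [] = (1ℚ , []) ∷ []
  trsᴾ (a ∷ as) = trᴾ a ⊗ trsᴾ as

  P : Graph n → ℕ → Mat n
  P X = pow (adj X)

  trs : Graph n → List ℕ → ℚ
  trs X [] = 1ℚ
  trs X (a ∷ as) = tr (P X a) * trs X as

  eval-powᴾ : ∀ a i j X → evalPM (powᴾ a i j) X ≡ P X a i j
  eval-powᴾ zero i j X = lemma (δ i j)
    where
    lemma : ∀ d → d * 1ℚ + 0ℚ ≡ d
    lemma = solve-∀ ℚ-ring
  eval-powᴾ (suc a) i j X = trans (eval-∑ᴾ (sign ∘ X) (λ k → adjᴾ i k ⊗ powᴾ a k j))
    (sum-cong-≗ λ k → trans (eval-⊗ (sign ∘ X) (adjᴾ i k) (powᴾ a k j)) (cong (adj X i k *_) (eval-powᴾ a k j X)))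

  eval-trᴾ : ∀ a X → evalPM (trᴾ a) X ≡ tr (P X a)
  eval-trᴾ a X = trans (eval-∑ᴾ (sign ∘ X) (λ i → powᴾ a i i)) (sum-cong-≗ λ i → eval-powᴾ a i i X)

  eval-trsᴾ : ∀ as X → evalPM (trsᴾ as) X ≡ trs X as
  eval-trsᴾ [] X = refl
  eval-trsᴾ (a ∷ as) X = trans (eval-⊗ (sign ∘ X) (trᴾ a) (trsᴾ as)) (cong₂ _*_ (eval-trᴾ a X) (eval-trsᴾ as X))

  adjᴾ-nonNeg : ∀ x y → NonNeg (adjᴾ x y)
  adjᴾ-nonNeg x y with Finₚ.<-cmp x y
  ... | tri< _ _ _ = 0≤1 ∷ []
  ... | tri≈ _ _ _ = []
  ... | tri> _ _ _ = 0≤1 ∷ []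

  powᴾ-nonNeg : ∀ a i j → NonNeg (powᴾ a i j)
  powᴾ-nonNeg zero i j = 0≤δ i j ∷ []
  powᴾ-nonNeg (suc a) i j = ∑ᴾ-nonNeg λ k → ⊗-nonNeg (adjᴾ-nonNeg i k) (powᴾ-nonNeg a k j)

  trᴾ-nonNeg : ∀ a → NonNeg (trᴾ a)
  trᴾ-nonNeg a = ∑ᴾ-nonNeg λ i → powᴾ-nonNeg a i i

  trsᴾ-nonNeg : ∀ as → NonNeg (trsᴾ as)
  trsᴾ-nonNeg [] = 0≤1 ∷ []
  trsᴾ-nonNeg (a ∷ as) = ⊗-nonNeg (trᴾ-nonNeg a) (trsᴾ-nonNeg as)

  adjᴾ-degree : ∀ x y → degree (adjᴾ x y) ℕ.≤ 1
  adjᴾ-degree x y with Finₚ.<-cmp x y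
  ... | tri< _ _ _ = ℕₚ.≤-refl
  ... | tri≈ _ _ _ = ℕ.z≤n
  ... | tri> _ _ _ = ℕₚ.≤-refl

  -- An entry of A^(a+1) sums over walks from i to j. Differentiating deletes one step along the
  -- edge, in either direction, and leaves a walk of length s before it and one of length t after
  -- it, with s + t = a.
  eval-∂-powᴾ : ∀ {x y} (x≢y : x ≢ y) a i j X →
    evalPM (∂ (between x≢y) (powᴾ (suc a) i j)) X ≡ conv (λ s t → P X s i x * P X t y j + P X s i y * P X t x j) a
  eval-∂-powᴾ {x} {y} x≢y a i j X = begin
    evalPM (∂ e (powᴾ (suc a) i j)) X
      ≡⟨ eval-∂-∑ᴾ (sign ∘ X) e (λ k → adjᴾ i k ⊗ powᴾ a k j) ⟩
    ∑ (λ k → evalPM (∂ e (adjᴾ i k ⊗ powᴾ a k j)) X)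
      ≡⟨ sum-cong-≗ (λ k → trans (eval-∂-⊗ (sign ∘ X) e (adjᴾ i k) (powᴾ a k j)) (cong₂ (λ u v → u * v + adj X i k * ∂P a k) (eval-∂-adjᴾ x≢y i k X) (eval-powᴾ a k j X))) ⟩
    ∑ (λ k → (δ i x * δ k y + δ i y * δ k x) * P X a k j + adj X i k * ∂P a k)
      ≡⟨ ∑-distrib-+ (λ k → (δ i x * δ k y + δ i y * δ k x) * P X a k j) (λ k → adj X i k * ∂P a k) ⟩
    ∑ (λ k → (δ i x * δ k y + δ i y * δ k x) * P X a k j) + ∑ (λ k → adj X i k * ∂P a k)
      ≡⟨ cong (_+ ∑ (λ k → adj X i k * ∂P a k)) select ⟩
    δ i x * P X a y j + δ i y * P X a x j + ∑ (λ k → adj X i k * ∂P a k)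
      ≡⟨ later a ⟩
    conv (λ s t → P X s i x * P X t y j + P X s i y * P X t x j) a ∎
    where
    open ≡-Reasoning
    e : Fin (N n)
    e = between x≢y
    ∂P : ℕ → Fin n → ℚ
    ∂P a k = evalPM (∂ e (powᴾ a k j)) X
    h : Fin n → ℕ → ℕ → ℚ
    h i s t = P X s i x * P X t y j + P X s i y * P X t x j
    expand : ∀ c d e f p → (c * d + e * f) * p ≡ c * (d * p) + e * (f * p)
    expand = solve-∀ ℚ-ring
    select : ∑ (λ k → (δ i x * δ k y + δ i y * δ k x) * P X a k j) ≡ δ i x * P X a y j + δ i y * P X a x j
    select = begin
      ∑ (λ k → (δ i x * δ k y + δ i y * δ k x) * P X a k j)
        ≡⟨ sum-cong-≗ (λ k → trans (cong₂ (λ u v → (δ i x * u + δ i y * v) * P X a k j) (δ-sym k y) (δ-sym k x)) (expand (δ i x) (δ y k) (δ i y) (δ x k) (P X a k j))) ⟩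
      ∑ (λ k → δ i x * (δ y k * P X a k j) + δ i y * (δ x k * P X a k j))
        ≡⟨ ∑-distrib-+ (λ k → δ i x * (δ y k * P X a k j)) (λ k → δ i y * (δ x k * P X a k j)) ⟩
      ∑ (λ k → δ i x * (δ y k * P X a k j)) + ∑ (λ k → δ i y * (δ x k * P X a k j))
        ≡⟨ cong₂ _+_ (sym (*-distribˡ-sum (δ i x) (λ k → δ y k * P X a k j))) (sym (*-distribˡ-sum (δ i y) (λ k → δ x k * P X a k j))) ⟩
      δ i x * ∑ (λ k → δ y k * P X a k j) + δ i y * ∑ (λ k → δ x k * P X a k j)
        ≡⟨ cong₂ (λ u v → δ i x * u + δ i y * v) (∑-δ y (λ k → P X a k j)) (∑-δ x (λ k → P X a k j)) ⟩
      δ i x * P X a y j + δ i y * P X a x j ∎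
    -- The leading factor, when differentiated, gives the term s = 0. The other terms are those of
    -- the shorter power with one more factor A in front, which raises s by one.
    later : ∀ a → δ i x * P X a y j + δ i y * P X a x j + ∑ (λ k → adj X i k * ∂P a k) ≡ conv (h i) a
    later zero = trans (cong (h i 0 0 +_) (trans (sum-cong-≗ (λ k → trans (cong (adj X i k *_) (∂const (δ k j))) (*-zeroʳ (adj X i k)))) (∑-zero n))) (+-identityʳ (h i 0 0))
      where
      ∂const : ∀ c → evalPM (∂ e ((c , []) ∷ [])) X ≡ 0ℚ
      ∂const c = refl
    later (suc a) = cong (h i 0 (suc a) +_) (begin
      ∑ (λ k → adj X i k * ∂P (suc a) k)
        ≡⟨ sum-cong-≗ (λ k → trans (cong (adj X i k *_) (eval-∂-powᴾ x≢y a k j X)) (sym (conv-*ˡ (adj X i k) (h k) a))) ⟩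
      ∑ (λ k → conv (λ s t → adj X i k * h k s t) a)
        ≡⟨ conv-∑ (λ k s t → adj X i k * h k s t) a ⟩
      conv (λ s t → ∑ λ k → adj X i k * h k s t) a
        ≡⟨ conv-cong step a ⟩
      conv (λ s → h i (suc s)) a ∎)
      where
      expand′ : ∀ c d e f g → c * (d * e + f * g) ≡ c * d * e + c * f * g
      expand′ = solve-∀ ℚ-ring
      step : ∀ s t → ∑ (λ k → adj X i k * h k s t) ≡ h i (suc s) t
      step s t = begin
        ∑ (λ k → adj X i k * (P X s k x * P X t y j + P X s k y * P X t x j))
          ≡⟨ sum-cong-≗ (λ k → expand′ (adj X i k) (P X s k x) (P X t y j) (P X s k y) (P X t x j)) ⟩
        ∑ (λ k → adj X i k * P X s k x * P X t y j + adj X i k * P X s k y * P X t x j)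
          ≡⟨ ∑-distrib-+ (λ k → adj X i k * P X s k x * P X t y j) (λ k → adj X i k * P X s k y * P X t x j) ⟩
        ∑ (λ k → adj X i k * P X s k x * P X t y j) + ∑ (λ k → adj X i k * P X s k y * P X t x j)
          ≡⟨ cong₂ _+_ (sym (*-distribʳ-sum (P X t y j) (λ k → adj X i k * P X s k x))) (sym (*-distribʳ-sum (P X t x j) (λ k → adj X i k * P X s k y))) ⟩
        P X (suc s) i x * P X t y j + P X (suc s) i y * P X t x j ∎

  P-symmetric : ∀ (X : Graph n) a → Symmetric (P X a)
  P-symmetric X = pow-symmetric (adj X) (adj-symmetric X)

  ∑∑-P : ∀ (X : Graph n) s t → ∑ (λ x → ∑ λ y → P X s y x * P X t x y) ≡ tr (P X (s ℕ.+ t))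
  ∑∑-P X s t = trans (∑-comm (λ x y → P X s y x * P X t x y)) (sum-cong-≗ λ y → sym (pow-+ (adj X) s t y y))

  -- Half of the derivative of tr A^b with respect to the variable shared by the entries xy and yx.
  ∂tr : Graph n → ℕ → Mat n
  ∂tr X zero x y = 0ℚ
  ∂tr X (suc b) x y = ℕ→ℚ (suc b) * P X b x y

  ∂trs : Graph n → List ℕ → Mat n
  ∂trs X [] x y = 0ℚ
  ∂trs X (a ∷ as) x y = 2ℚ * ∂tr X a x y * trs X as + tr (P X a) * ∂trs X as x y

  -- Under the trace the two pieces left by a deleted step join cyclically into A^a, whatever the
  -- position of the step; the symmetry of A identifies the two directions, which accounts for the
  -- factor two.
  eval-∂-trᴾ : ∀ {x y} (x≢y : x ≢ y) a X → evalPM (∂ (between x≢y) (trᴾ a)) X ≡ 2ℚ * ∂tr X a x y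
  eval-∂-trᴾ {x} {y} x≢y zero X = trans (eval-∂-∑ᴾ (sign ∘ X) (between x≢y) (λ i → powᴾ 0 i i)) (∑-zero n)
  eval-∂-trᴾ {x} {y} x≢y (suc a) X = begin
    evalPM (∂ (between x≢y) (trᴾ (suc a))) X
      ≡⟨ eval-∂-∑ᴾ (sign ∘ X) (between x≢y) (λ i → powᴾ (suc a) i i) ⟩
    ∑ (λ i → evalPM (∂ (between x≢y) (powᴾ (suc a) i i)) X)
      ≡⟨ sum-cong-≗ (λ i → eval-∂-powᴾ x≢y a i i X) ⟩
    ∑ (λ i → conv (λ s t → P X s i x * P X t y i + P X s i y * P X t x i) a)
      ≡⟨ conv-∑ (λ i s t → P X s i x * P X t y i + P X s i y * P X t x i) a ⟩
    conv (λ s t → ∑ λ i → P X s i x * P X t y i + P X s i y * P X t x i) a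
      ≡⟨ conv-cong joined a ⟩
    conv (λ s t → 2ℚ * P X (s ℕ.+ t) x y) a
      ≡⟨ conv-*ˡ 2ℚ (λ s t → P X (s ℕ.+ t) x y) a ⟩
    2ℚ * conv (λ s t → P X (s ℕ.+ t) x y) a
      ≡⟨ cong (2ℚ *_) (conv-diagonal (λ c → P X c x y) a) ⟩
    2ℚ * (ℕ→ℚ (suc a) * P X a x y) ∎
    where
    open ≡-Reasoning
    half : ∀ s t u v → ∑ (λ i → P X s i u * P X t v i) ≡ P X (s ℕ.+ t) u v
    half s t u v = trans (sum-cong-≗ (λ i → cong₂ _*_ (P-symmetric X s i u) (P-symmetric X t v i))) (sym (pow-+ (adj X) s t u v))
    double : ∀ p → p + p ≡ 2ℚ * p
    double = solve-∀ ℚ-ring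
    joined : ∀ s t → ∑ (λ i → P X s i x * P X t y i + P X s i y * P X t x i) ≡ 2ℚ * P X (s ℕ.+ t) x y
    joined s t = begin
      ∑ (λ i → P X s i x * P X t y i + P X s i y * P X t x i)
        ≡⟨ ∑-distrib-+ (λ i → P X s i x * P X t y i) (λ i → P X s i y * P X t x i) ⟩
      ∑ (λ i → P X s i x * P X t y i) + ∑ (λ i → P X s i y * P X t x i)
        ≡⟨ cong₂ _+_ (half s t x y) (trans (half s t y x) (P-symmetric X (s ℕ.+ t) y x)) ⟩
      P X (s ℕ.+ t) x y + P X (s ℕ.+ t) x y
        ≡⟨ double (P X (s ℕ.+ t) x y) ⟩
      2ℚ * P X (s ℕ.+ t) x y ∎

  eval-∂-trsᴾ : ∀ {x y} (x≢y : x ≢ y) as X → evalPM (∂ (between x≢y) (trsᴾ as)) X ≡ ∂trs X as x y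
  eval-∂-trsᴾ x≢y [] X = refl
  eval-∂-trsᴾ x≢y (a ∷ as) X = trans (eval-∂-⊗ (sign ∘ X) (between x≢y) (trᴾ a) (trsᴾ as))
    (cong₂ _+_ (cong₂ _*_ (eval-∂-trᴾ x≢y a X) (eval-trsᴾ as X)) (cong₂ _*_ (eval-trᴾ a X) (eval-∂-trsᴾ x≢y as X)))

  -- Diagonal entries carry no edge variable, so Exp-parts does not apply to them; there the loop inequality only needs positivity.

  Positive-combination : (Graph n → ℚ) → Set
  Positive-combination g = Σ (Poly (N n)) λ p → NonNeg p × (∀ X → evalPM p X ≡ g X)

  Exp-nonNeg : ∀ {g} → Positive-combination g → 0ℚ ≤ Exp (N n) g
  Exp-nonNeg (p , p≥0 , eq) = subst (0ℚ ≤_) (Exp-cong (N n) eq) (Exp-poly-nonNeg p≥0)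

  pos-+ : ∀ {g h} → Positive-combination g → Positive-combination h → Positive-combination (λ X → g X + h X)
  pos-+ (p , p≥0 , eqp) (q , q≥0 , eqq) = p ++ q , ++⁺ p≥0 q≥0 , λ X → trans (eval-++ (sign ∘ X) p q) (cong₂ _+_ (eqp X) (eqq X))

  pos-* : ∀ {g h} → Positive-combination g → Positive-combination h → Positive-combination (λ X → g X * h X)
  pos-* (p , p≥0 , eqp) (q , q≥0 , eqq) = p ⊗ q , ⊗-nonNeg p≥0 q≥0 , λ X → trans (eval-⊗ (sign ∘ X) p q) (cong₂ _*_ (eqp X) (eqq X))

  pos-const : ∀ {c} → 0ℚ ≤ c → Positive-combination (λ _ → c)
  pos-const {c} 0≤c = (c , []) ∷ [] , 0≤c ∷ [] , λ X → lemma c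
    where
    lemma : ∀ c → c * 1ℚ + 0ℚ ≡ c
    lemma = solve-∀ ℚ-ring

  pos-conv : ∀ {h : ℕ → ℕ → Graph n → ℚ} → (∀ s t → Positive-combination (h s t)) → ∀ a → Positive-combination (λ X → conv (λ s t → h s t X) a)
  pos-conv pos zero = pos 0 0
  pos-conv pos (suc a) = pos-+ (pos 0 (suc a)) (pos-conv (λ s → pos (suc s)) a)

  pos-P : ∀ a i j → Positive-combination (λ X → P X a i j)
  pos-P a i j = powᴾ a i j , powᴾ-nonNeg a i j , eval-powᴾ a i j

  pos-tr : ∀ a → Positive-combination (λ X → tr (P X a))
  pos-tr a = trᴾ a , trᴾ-nonNeg a , eval-trᴾ a

  pos-trs : ∀ as → Positive-combination (λ X → trs X as)
  pos-trs as = trsᴾ as , trsᴾ-nonNeg as , eval-trsᴾ as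

  pos-∂tr : ∀ a x y → Positive-combination (λ X → ∂tr X a x y)
  pos-∂tr zero x y = pos-const ≤-refl
  pos-∂tr (suc a) x y = pos-* (pos-const (0≤ℕ→ℚ (suc a))) (pos-P a x y)

  pos-∂trs : ∀ as x y → Positive-combination (λ X → ∂trs X as x y)
  pos-∂trs [] x y = pos-const ≤-refl
  pos-∂trs (a ∷ as) x y = pos-+ (pos-* (pos-* (pos-const (nonNegative⁻¹ 2ℚ)) (pos-∂tr a x y)) (pos-trs as)) (pos-* (pos-tr a) (pos-∂trs as x y))

  -- The loop inequality

  F : List ℕ → ℚ
  F as = Exp (N n) (λ X → trs X as)

  -- For x ≠ y this is the derivative of `P X (suc a) y x * trs X as` in the variable of the edge
  -- xy. The same formula is used for x = y, where it merely bounds zero from above in expectation,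
  -- so that the sum over all x and y consists of complete traces.
  contraction : ℕ → List ℕ → Fin n → Fin n → Graph n → ℚ
  contraction a as x y X = conv (λ s t → P X s y x * P X t y x + P X s y y * P X t x x) a * trs X as + P X (suc a) y x * ∂trs X as x y

  Exp-adj-parts : ∀ a as x y → Exp (N n) (λ X → adj X x y * (P X (suc a) y x * trs X as)) ≤ Exp (N n) (contraction a as x y)
  Exp-adj-parts a as x y with x Finₚ.≟ y
  ... | yes refl = begin
    Exp (N n) (λ X → adj X x x * (P X (suc a) x x * trs X as))
      ≡⟨ Exp-cong (N n) (λ X → trans (cong (_* (P X (suc a) x x * trs X as)) (adj-diagonal x X)) (*-zeroˡ (P X (suc a) x x * trs X as))) ⟩
    Exp (N n) (λ _ → 0ℚ)
      ≡⟨ Exp-0 (N n) ⟩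
    0ℚ
      ≤⟨ Exp-nonNeg (pos-+ (pos-* (pos-conv (λ s t → pos-+ (pos-* (pos-P s x x) (pos-P t x x)) (pos-* (pos-P s x x) (pos-P t x x))) a) (pos-trs as)) (pos-* (pos-P (suc a) x x) (pos-∂trs as x x))) ⟩
    Exp (N n) (contraction a as x x) ∎
    where open ≤-Reasoning
  ... | no x≢y = begin
    Exp (N n) (λ X → adj X x y * (P X (suc a) y x * trs X as))
      ≡⟨ Exp-cong (N n) (λ X → cong₂ _*_ (adj-≢ x≢y X) (sym (trans (eval-⊗ (sign ∘ X) (powᴾ (suc a) y x) (trsᴾ as)) (cong₂ _*_ (eval-powᴾ (suc a) y x X) (eval-trsᴾ as X))))) ⟩
    Exp (N n) (λ X → sign (X e) * evalPM (powᴾ (suc a) y x ⊗ trsᴾ as) X)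
      ≤⟨ Exp-parts e (⊗-nonNeg (powᴾ-nonNeg (suc a) y x) (trsᴾ-nonNeg as)) ⟩
    Exp (N n) (evalPM (∂ e (powᴾ (suc a) y x ⊗ trsᴾ as)))
      ≡⟨ Exp-cong (N n) (λ X → trans (eval-∂-⊗ (sign ∘ X) e (powᴾ (suc a) y x) (trsᴾ as))
           (cong₂ _+_ (cong₂ _*_ (eval-∂-powᴾ x≢y a y x X) (eval-trsᴾ as X)) (cong₂ _*_ (eval-powᴾ (suc a) y x X) (eval-∂-trsᴾ x≢y as X)))) ⟩
    Exp (N n) (contraction a as x y) ∎
    where
    open ≤-Reasoning
    e : Fin (N n)
    e = between x≢y

  -- Two loops, each opened at a step between x and y, are joined at these endpoints into one. The
  -- `b` choices of the step in the second loop give the factor.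
  ∑∑-P∂tr : ∀ (X : Graph n) a b → ∑∑ (λ x y → P X (suc a) y x * ∂tr X b x y) ≡ ℕ→ℚ b * tr (P X (a ℕ.+ b))
  ∑∑-P∂tr X a zero = trans (∑∑-cong (λ x y → *-zeroʳ (P X (suc a) y x))) (trans (sum-cong-≗ {n} (λ x → ∑-zero n)) (trans (∑-zero n) (sym (*-zeroˡ (tr (P X (a ℕ.+ 0)))))))
  ∑∑-P∂tr X a (suc b) = begin
    ∑∑ (λ x y → P X (suc a) y x * (ℕ→ℚ (suc b) * P X b x y))
      ≡⟨ ∑∑-cong (λ x y → swap (P X (suc a) y x) (ℕ→ℚ (suc b)) (P X b x y)) ⟩
    ∑∑ (λ x y → ℕ→ℚ (suc b) * (P X (suc a) y x * P X b x y))
      ≡⟨ ∑∑-*ˡ (ℕ→ℚ (suc b)) (λ x y → P X (suc a) y x * P X b x y) ⟩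
    ℕ→ℚ (suc b) * ∑∑ (λ x y → P X (suc a) y x * P X b x y)
      ≡⟨ cong (ℕ→ℚ (suc b) *_) (trans (∑∑-P X (suc a) b) (cong (λ c → tr (P X c)) (sym (ℕₚ.+-suc a b)))) ⟩
    ℕ→ℚ (suc b) * tr (P X (a ℕ.+ suc b)) ∎
    where
    open ≡-Reasoning
    swap : ∀ p b q → p * (b * q) ≡ b * (p * q)
    swap = solve-∀ ℚ-ring

  ∑∑-P∂trs : ∀ (X : Graph n) a bs → ∑∑ (λ x y → P X (suc a) y x * ∂trs X bs x y) ≡ fuse a (trs X) bs
  ∑∑-P∂trs X a [] = trans (∑∑-cong (λ x y → *-zeroʳ (P X (suc a) y x))) (trans (sum-cong-≗ {n} (λ x → ∑-zero n)) (∑-zero n))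
  ∑∑-P∂trs X a (b ∷ bs) = begin
    ∑∑ (λ x y → P X (suc a) y x * (2ℚ * ∂tr X b x y * trs X bs + tr (P X b) * ∂trs X bs x y))
      ≡⟨ ∑∑-cong (λ x y → rearrange (P X (suc a) y x) (∂tr X b x y) (trs X bs) (tr (P X b)) (∂trs X bs x y)) ⟩
    ∑∑ (λ x y → 2ℚ * trs X bs * (P X (suc a) y x * ∂tr X b x y) + tr (P X b) * (P X (suc a) y x * ∂trs X bs x y))
      ≡⟨ ∑∑-+ (λ x y → 2ℚ * trs X bs * (P X (suc a) y x * ∂tr X b x y)) (λ x y → tr (P X b) * (P X (suc a) y x * ∂trs X bs x y)) ⟩
    ∑∑ (λ x y → 2ℚ * trs X bs * (P X (suc a) y x * ∂tr X b x y)) + ∑∑ (λ x y → tr (P X b) * (P X (suc a) y x * ∂trs X bs x y))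
      ≡⟨ cong₂ _+_ (∑∑-*ˡ (2ℚ * trs X bs) (λ x y → P X (suc a) y x * ∂tr X b x y)) (∑∑-*ˡ (tr (P X b)) (λ x y → P X (suc a) y x * ∂trs X bs x y)) ⟩
    2ℚ * trs X bs * ∑∑ (λ x y → P X (suc a) y x * ∂tr X b x y) + tr (P X b) * ∑∑ (λ x y → P X (suc a) y x * ∂trs X bs x y)
      ≡⟨ cong₂ (λ u v → 2ℚ * trs X bs * u + tr (P X b) * v) (∑∑-P∂tr X a b) (∑∑-P∂trs X a bs) ⟩
    2ℚ * trs X bs * (ℕ→ℚ b * tr (P X (a ℕ.+ b))) + tr (P X b) * fuse a (trs X) bs
      ≡⟨ cong₂ _+_ (reorder (trs X bs) (ℕ→ℚ b) (tr (P X (a ℕ.+ b)))) (sym (fuse-*ˡ a (tr (P X b)) (trs X) bs)) ⟩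
    2ℚ * ℕ→ℚ b * (tr (P X (a ℕ.+ b)) * trs X bs) + fuse a (λ cs → tr (P X b) * trs X cs) bs ∎
    where
    open ≡-Reasoning
    rearrange : ∀ p d t u e → p * (2ℚ * d * t + u * e) ≡ 2ℚ * t * (p * d) + u * (p * e)
    rearrange = solve-∀ ℚ-ring
    reorder : ∀ t b u → 2ℚ * t * (b * u) ≡ 2ℚ * b * (u * t)
    reorder = solve-∀ ℚ-ring

  -- Three ways to remove a second step along the edge xy. Within the same loop, the two diagonal
  -- entries give two separate loops; the other product, due to the symmetry of A, reverses one
  -- piece and reconnects a single loop, once for each of the a + 1 pairs (s, t). A step in another
  -- loop gives a fusion.
  ∑∑-contraction : ∀ (X : Graph n) a as → ∑∑ (λ x y → contraction a as x y X) ≡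
    conv (λ s t → trs X (s ∷ t ∷ as)) a + ℕ→ℚ (suc a) * trs X (a ∷ as) + fuse a (trs X) as
  ∑∑-contraction X a as = begin
    ∑∑ (λ x y → conv (h x y) a * trs X as + P X (suc a) y x * ∂trs X as x y)
      ≡⟨ ∑∑-cong (λ x y → cong (_+ P X (suc a) y x * ∂trs X as x y) (*-comm (conv (h x y) a) (trs X as))) ⟩
    ∑∑ (λ x y → trs X as * conv (h x y) a + P X (suc a) y x * ∂trs X as x y)
      ≡⟨ ∑∑-+ (λ x y → trs X as * conv (h x y) a) (λ x y → P X (suc a) y x * ∂trs X as x y) ⟩
    ∑∑ (λ x y → trs X as * conv (h x y) a) + ∑∑ (λ x y → P X (suc a) y x * ∂trs X as x y)
      ≡⟨ cong₂ _+_ (trans (∑∑-*ˡ (trs X as) (λ x y → conv (h x y) a)) (cong (trs X as *_) split)) (∑∑-P∂trs X a as) ⟩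
    trs X as * (conv (λ s t → tr (P X s) * tr (P X t)) a + ℕ→ℚ (suc a) * tr (P X a)) + fuse a (trs X) as
      ≡⟨ cong (_+ fuse a (trs X) as) (trans (distrib (trs X as) (conv (λ s t → tr (P X s) * tr (P X t)) a) (ℕ→ℚ (suc a)) (tr (P X a))) (cong (_+ ℕ→ℚ (suc a) * trs X (a ∷ as)) inside)) ⟩
    conv (λ s t → trs X (s ∷ t ∷ as)) a + ℕ→ℚ (suc a) * trs X (a ∷ as) + fuse a (trs X) as ∎
    where
    open ≡-Reasoning
    h : Fin n → Fin n → ℕ → ℕ → ℚ
    h x y s t = P X s y x * P X t y x + P X s y y * P X t x x
    distrib : ∀ r c a t → r * (c + a * t) ≡ r * c + a * (t * r)
    distrib = solve-∀ ℚ-ring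
    rotate : ∀ r s t → r * (s * t) ≡ s * (t * r)
    rotate = solve-∀ ℚ-ring
    inside : trs X as * conv (λ s t → tr (P X s) * tr (P X t)) a ≡ conv (λ s t → trs X (s ∷ t ∷ as)) a
    inside = trans (sym (conv-*ˡ (trs X as) (λ s t → tr (P X s) * tr (P X t)) a)) (conv-cong (λ s t → rotate (trs X as) (tr (P X s)) (tr (P X t))) a)
    pair : ∀ s t → ∑∑ (λ x y → h x y s t) ≡ tr (P X s) * tr (P X t) + tr (P X (s ℕ.+ t))
    pair s t = begin
      ∑∑ (λ x y → P X s y x * P X t y x + P X s y y * P X t x x)
        ≡⟨ ∑∑-+ (λ x y → P X s y x * P X t y x) (λ x y → P X s y y * P X t x x) ⟩
      ∑∑ (λ x y → P X s y x * P X t y x) + ∑∑ (λ x y → P X s y y * P X t x x)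
        ≡⟨ cong₂ _+_ (trans (∑∑-cong (λ x y → cong (P X s y x *_) (P-symmetric X t y x))) (∑∑-P X s t))
             (trans (∑-comm (λ x y → P X s y y * P X t x x)) (∑∑-* (λ y → P X s y y) (λ x → P X t x x))) ⟩
      tr (P X (s ℕ.+ t)) + tr (P X s) * tr (P X t)
        ≡⟨ +-comm (tr (P X (s ℕ.+ t))) (tr (P X s) * tr (P X t)) ⟩
      tr (P X s) * tr (P X t) + tr (P X (s ℕ.+ t)) ∎
    split : ∑∑ (λ x y → conv (h x y) a) ≡ conv (λ s t → tr (P X s) * tr (P X t)) a + ℕ→ℚ (suc a) * tr (P X a)
    split = begin
      ∑∑ (λ x y → conv (h x y) a)
        ≡⟨ sum-cong-≗ (λ x → conv-∑ (h x) a) ⟩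
      ∑ (λ x → conv (λ s t → ∑ λ y → h x y s t) a)
        ≡⟨ conv-∑ (λ x s t → ∑ λ y → h x y s t) a ⟩
      conv (λ s t → ∑∑ (λ x y → h x y s t)) a
        ≡⟨ conv-cong pair a ⟩
      conv (λ s t → tr (P X s) * tr (P X t) + tr (P X (s ℕ.+ t))) a
        ≡⟨ conv-+ (λ s t → tr (P X s) * tr (P X t)) (λ s t → tr (P X (s ℕ.+ t))) a ⟩
      conv (λ s t → tr (P X s) * tr (P X t)) a + conv (λ s t → tr (P X (s ℕ.+ t))) a
        ≡⟨ cong (conv (λ s t → tr (P X s) * tr (P X t)) a +_) (conv-diagonal (λ c → tr (P X c)) a) ⟩
      conv (λ s t → tr (P X s) * tr (P X t)) a + ℕ→ℚ (suc a) * tr (P X a) ∎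

  Exp-∑∑ : ∀ (g : Fin n → Fin n → Graph n → ℚ) → Exp (N n) (λ X → ∑∑ (λ x y → g x y X)) ≡ ∑∑ (λ x y → Exp (N n) (g x y))
  Exp-∑∑ g = trans (Exp-∑ (N n) (λ x X → ∑ λ y → g x y X)) (sum-cong-≗ λ x → Exp-∑ (N n) (g x))

  -- The Schwinger-Dyson equation of a real symmetric random matrix, as an inequality: one entry of
  -- A is exposed in the first trace, and integration by parts is applied to it.
  F-loop : ∀ a as → F (suc (suc a) ∷ as) ≤ conv (λ s t → F (s ∷ t ∷ as)) a + ℕ→ℚ (suc a) * F (a ∷ as) + fuse a F as
  F-loop a as = begin
    Exp (N n) (λ X → tr (P X (suc (suc a))) * trs X as)
      ≡⟨ Exp-cong (N n) (λ X → trans (*-comm (tr (P X (suc (suc a)))) (trs X as)) (trans (sym (∑∑-*ˡ (trs X as) (λ x y → adj X x y * P X (suc a) y x)))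
           (∑∑-cong (λ x y → rotate (trs X as) (adj X x y) (P X (suc a) y x))))) ⟩
    Exp (N n) (λ X → ∑∑ (λ x y → adj X x y * (P X (suc a) y x * trs X as)))
      ≡⟨ Exp-∑∑ (λ x y X → adj X x y * (P X (suc a) y x * trs X as)) ⟩
    ∑∑ (λ x y → Exp (N n) (λ X → adj X x y * (P X (suc a) y x * trs X as)))
      ≤⟨ ∑-mono-≤ (λ x → ∑-mono-≤ (λ y → Exp-adj-parts a as x y)) ⟩
    ∑∑ (λ x y → Exp (N n) (contraction a as x y))
      ≡⟨ sym (Exp-∑∑ (contraction a as)) ⟩
    Exp (N n) (λ X → ∑∑ (λ x y → contraction a as x y X))
      ≡⟨ Exp-cong (N n) (λ X → ∑∑-contraction X a as) ⟩
    Exp (N n) (λ X → conv (λ s t → trs X (s ∷ t ∷ as)) a + ℕ→ℚ (suc a) * trs X (a ∷ as) + fuse a (trs X) as)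
      ≡⟨ Exp-+ (N n) (λ X → conv (λ s t → trs X (s ∷ t ∷ as)) a + ℕ→ℚ (suc a) * trs X (a ∷ as)) (λ X → fuse a (trs X) as) ⟩
    Exp (N n) (λ X → conv (λ s t → trs X (s ∷ t ∷ as)) a + ℕ→ℚ (suc a) * trs X (a ∷ as)) + Exp (N n) (λ X → fuse a (trs X) as)
      ≡⟨ cong₂ _+_ (Exp-+ (N n) (λ X → conv (λ s t → trs X (s ∷ t ∷ as)) a) (λ X → ℕ→ℚ (suc a) * trs X (a ∷ as))) (Exp-fuse (N n) a trs as) ⟩
    Exp (N n) (λ X → conv (λ s t → trs X (s ∷ t ∷ as)) a) + Exp (N n) (λ X → ℕ→ℚ (suc a) * trs X (a ∷ as)) + fuse a F as
      ≡⟨ cong (_+ fuse a F as) (cong₂ _+_ (Exp-conv (N n) (λ s t X → trs X (s ∷ t ∷ as)) a) (Exp-*ˡ (N n) (ℕ→ℚ (suc a)) (λ X → trs X (a ∷ as)))) ⟩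
    conv (λ s t → F (s ∷ t ∷ as)) a + ℕ→ℚ (suc a) * F (a ∷ as) + fuse a F as ∎
    where
    open ≤-Reasoning
    rotate : ∀ t a p → t * (a * p) ≡ a * (p * t)
    rotate = solve-∀ ℚ-ring

  F-[] : F [] ≡ 1ℚ
  F-[] = go (N n)
    where
    go : ∀ m → Exp m (λ _ → 1ℚ) ≡ 1ℚ
    go zero = refl
    go (suc m) = cong (λ z → ½ * (z + z)) (go m)

  F-0 : ∀ as → F (0 ∷ as) ≡ ℕ→ℚ n * F as
  F-0 as = trans (Exp-cong (N n) (λ X → cong (_* trs X as) (trans (sum-cong-≗ {n} δ-refl) (trans (∑-const n 1ℚ) (*-identityʳ (ℕ→ℚ n)))))) (Exp-*ˡ (N n) (ℕ→ℚ n) (λ X → trs X as))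

  F-1 : ∀ as → F (1 ∷ as) ≡ 0ℚ
  F-1 as = trans (Exp-cong (N n) (λ X → trans (cong (_* trs X as) (trans (sum-cong-≗ {n} (λ i → trans (pow-1 (adj X) i i) (adj-diagonal i X))) (∑-zero n))) (*-zeroˡ (trs X as)))) (Exp-0 (N n))

-- Weights majorising the loop inequality

conv-nonNeg : ∀ {h : ℕ → ℕ → ℚ} → (∀ s t → 0ℚ ≤ h s t) → ∀ a → 0ℚ ≤ conv h a
conv-nonNeg 0≤h zero = 0≤h 0 0
conv-nonNeg 0≤h (suc a) = +-nonNeg (0≤h 0 (suc a)) (conv-nonNeg (λ s → 0≤h (suc s)) a)

∑≤ : ℕ → (ℕ → ℚ) → ℚ
∑≤ zero h = h 0
∑≤ (suc M) h = h 0 + ∑≤ M (h ∘ suc)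

∑≤-nonNeg : ∀ M {h : ℕ → ℚ} → (∀ a → 0ℚ ≤ h a) → 0ℚ ≤ ∑≤ M h
∑≤-nonNeg zero 0≤h = 0≤h 0
∑≤-nonNeg (suc M) 0≤h = +-nonNeg (0≤h 0) (∑≤-nonNeg M (0≤h ∘ suc))

∑≤-+ : ∀ M (h k : ℕ → ℚ) → ∑≤ M (λ a → h a + k a) ≡ ∑≤ M h + ∑≤ M k
∑≤-+ zero h k = refl
∑≤-+ (suc M) h k = trans (cong (h 0 + k 0 +_) (∑≤-+ M (h ∘ suc) (k ∘ suc))) (lemma (h 0) (k 0) (∑≤ M (h ∘ suc)) (∑≤ M (k ∘ suc)))
  where
  lemma : ∀ a b c d → a + b + (c + d) ≡ a + c + (b + d)
  lemma = solve-∀ ℚ-ring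

∑≤-*ˡ : ∀ M c (h : ℕ → ℚ) → ∑≤ M (λ a → c * h a) ≡ c * ∑≤ M h
∑≤-*ˡ zero c h = refl
∑≤-*ˡ (suc M) c h = trans (cong (c * h 0 +_) (∑≤-*ˡ M c (h ∘ suc))) (sym (*-distribˡ-+ c (h 0) (∑≤ M (h ∘ suc))))

∑≤-const : ∀ M c → ∑≤ M (λ _ → c) ≡ ℕ→ℚ (suc M) * c
∑≤-const zero c = sym (*-identityˡ c)
∑≤-const (suc M) c = trans (cong (c +_) (∑≤-const M c)) (trans (lemma c (ℕ→ℚ (suc M))) (cong (_* c) (sym (ℕ→ℚ-suc (suc M)))))
  where
  lemma : ∀ c m → c + m * c ≡ (1ℚ + m) * c
  lemma = solve-∀ ℚ-ring

∑≤-suc : ∀ M {h : ℕ → ℚ} → (∀ a → 0ℚ ≤ h a) → ∑≤ M h ≤ ∑≤ (suc M) h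
∑≤-suc zero 0≤h = p≤p+q (0≤h 1)
∑≤-suc (suc M) {h} 0≤h = +-monoʳ-≤ (h 0) (∑≤-suc M (0≤h ∘ suc))

term≤∑≤ : ∀ {M a} {h : ℕ → ℚ} → (∀ a → 0ℚ ≤ h a) → a ℕ.≤ M → h a ≤ ∑≤ M h
term≤∑≤ {zero} 0≤h ℕ.z≤n = ≤-refl
term≤∑≤ {suc M} 0≤h ℕ.z≤n = p≤p+q (∑≤-nonNeg M (0≤h ∘ suc))
term≤∑≤ 0≤h (ℕ.s≤s a≤M) = ≤-trans (term≤∑≤ (0≤h ∘ suc) a≤M) (p≤q+p (0≤h 0))

-- The pairs with s + t ≤ M form a triangle inside the square over which the product on the right
-- sums.
∑≤-conv : ∀ M {h k : ℕ → ℚ} → (∀ a → 0ℚ ≤ h a) → (∀ a → 0ℚ ≤ k a) → ∑≤ M (conv (λ s t → h s * k t)) ≤ ∑≤ M h * ∑≤ M k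
∑≤-conv zero 0≤h 0≤k = ≤-refl
∑≤-conv (suc M) {h} {k} 0≤h 0≤k = begin
  h 0 * k 0 + ∑≤ M (λ a → h 0 * k (suc a) + conv (λ s t → h (suc s) * k t) a)
    ≡⟨ cong (h 0 * k 0 +_) (trans (∑≤-+ M (λ a → h 0 * k (suc a)) (conv (λ s t → h (suc s) * k t))) (cong (_+ ∑≤ M (conv (λ s t → h (suc s) * k t))) (∑≤-*ˡ M (h 0) (k ∘ suc)))) ⟩
  h 0 * k 0 + (h 0 * ∑≤ M (k ∘ suc) + ∑≤ M (conv (λ s t → h (suc s) * k t)))
    ≤⟨ +-monoʳ-≤ (h 0 * k 0) (+-monoʳ-≤ (h 0 * ∑≤ M (k ∘ suc)) (≤-trans (∑≤-conv M (0≤h ∘ suc) 0≤k) (*-monoˡ-≤ (∑≤-nonNeg M (0≤h ∘ suc)) (∑≤-suc M 0≤k)))) ⟩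
  h 0 * k 0 + (h 0 * ∑≤ M (k ∘ suc) + ∑≤ M (h ∘ suc) * (k 0 + ∑≤ M (k ∘ suc)))
    ≡⟨ lemma (h 0) (k 0) (∑≤ M (h ∘ suc)) (∑≤ M (k ∘ suc)) ⟩
  (h 0 + ∑≤ M (h ∘ suc)) * (k 0 + ∑≤ M (k ∘ suc)) ∎
  where
  open ≤-Reasoning
  lemma : ∀ h k H K → h * k + (h * K + H * (k + K)) ≡ (h + H) * (k + K)
  lemma = solve-∀ ℚ-ring

-- Iterates of the map h ↦ (α, θ, θ + conv (h ⊗ h)), whose fixed point has a generating function solving G = α + θ (z + z² + …) + z² G²;
-- at z = 1 the quadratic inequality α + M θ + G² ≤ G is solved by G = ½.
weight : (α θ : ℚ) → ℕ → ℕ → ℚ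
weight α θ zero a = 0ℚ
weight α θ (suc t) zero = α
weight α θ (suc t) (suc zero) = θ
weight α θ (suc t) (suc (suc a)) = θ + conv (λ s u → weight α θ t s * weight α θ t u) a

module _ {α θ : ℚ} (0≤θ : 0ℚ ≤ θ) (θ≤α : θ ≤ α) where

  weight-nonNeg : ∀ t a → 0ℚ ≤ weight α θ t a
  weight-nonNeg zero a = ≤-refl
  weight-nonNeg (suc t) zero = ≤-trans 0≤θ θ≤α
  weight-nonNeg (suc t) (suc zero) = 0≤θ
  weight-nonNeg (suc t) (suc (suc a)) = +-nonNeg 0≤θ (conv-nonNeg (λ s u → *-nonNeg (weight-nonNeg t s) (weight-nonNeg t u)) a)

  weight-mono : ∀ t a → weight α θ t a ≤ weight α θ (suc t) a
  weight-mono zero a = weight-nonNeg 1 a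
  weight-mono (suc t) zero = ≤-refl
  weight-mono (suc t) (suc zero) = ≤-refl
  weight-mono (suc t) (suc (suc a)) = +-monoʳ-≤ θ (conv-mono-≤ a (λ s u _ → *-mono-≤ (weight-nonNeg t s) (weight-mono t s) (weight-nonNeg t u) (weight-mono t u)))

  -- The Catalan recursion alone would give odd lengths weight zero, while two odd loops can fuse
  -- into an even one. The floor θ keeps all lengths comparable. It starts at iterate `suc t` since
  -- iterate zero vanishes.
  θ≤weight : ∀ t a → θ ≤ weight α θ (suc t) a
  θ≤weight t zero = θ≤α
  θ≤weight t (suc zero) = ≤-refl
  θ≤weight t (suc (suc a)) = p≤p+q (conv-nonNeg (λ s u → *-nonNeg (weight-nonNeg t s) (weight-nonNeg t u)) a)

  ∑≤-weight : ∀ t M → α + ℕ→ℚ M * θ ≤ ½ * ½ → ∑≤ M (weight α θ t) ≤ ½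
  ∑≤-weight zero M _ = ≤-trans (≤-reflexive (trans (∑≤-const M 0ℚ) (*-zeroʳ (ℕ→ℚ (suc M))))) (nonNegative⁻¹ ½)
  ∑≤-weight (suc t) zero small = ≤-trans (≤-trans (p≤p+q (*-nonNeg (0≤ℕ→ℚ 0) 0≤θ)) small) (toWitness {a? = ½ * ½ ≤? ½} _)
  ∑≤-weight (suc t) (suc zero) small = ≤-trans (≤-trans (≤-reflexive (cong (α +_) (sym (*-identityˡ θ)))) small) (toWitness {a? = ½ * ½ ≤? ½} _)
  ∑≤-weight (suc t) (suc (suc M)) small = begin
    α + (θ + ∑≤ M (λ a → θ + conv w² a))
      ≡⟨ cong (λ z → α + (θ + z)) (trans (∑≤-+ M (λ _ → θ) (conv w²)) (cong (_+ ∑≤ M (conv w²)) (∑≤-const M θ))) ⟩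
    α + (θ + (ℕ→ℚ (suc M) * θ + ∑≤ M (conv w²)))
      ≡⟨ lemma α θ (ℕ→ℚ (suc M)) (∑≤ M (conv w²)) ⟩
    α + (1ℚ + ℕ→ℚ (suc M)) * θ + ∑≤ M (conv w²)
      ≡⟨ cong (λ m → α + m * θ + ∑≤ M (conv w²)) (sym (ℕ→ℚ-suc (suc M))) ⟩
    α + ℕ→ℚ (suc (suc M)) * θ + ∑≤ M (conv w²)
      ≤⟨ +-mono-≤ small (∑≤-conv M (weight-nonNeg t) (weight-nonNeg t)) ⟩
    ½ * ½ + ∑≤ M (weight α θ t) * ∑≤ M (weight α θ t)
      ≤⟨ +-monoʳ-≤ (½ * ½) (*-mono-≤ 0≤S S≤½ 0≤S S≤½) ⟩
    ½ * ½ + ½ * ½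
      ≡⟨⟩
    ½ ∎
    where
    open ≤-Reasoning
    w² : ℕ → ℕ → ℚ
    w² s u = weight α θ t s * weight α θ t u
    lemma : ∀ α θ m c → α + (θ + (m * θ + c)) ≡ α + (1ℚ + m) * θ + c
    lemma = solve-∀ ℚ-ring
    0≤S : 0ℚ ≤ ∑≤ M (weight α θ t)
    0≤S = ∑≤-nonNeg M (weight-nonNeg t)
    S≤½ : ∑≤ M (weight α θ t) ≤ ½
    S≤½ = ∑≤-weight t M (≤-trans (+-monoʳ-≤ α (*-monoʳ-≤ 0≤θ (ℕ→ℚ-mono-≤ (ℕₚ.m≤n+m M 2)))) small)

  weight≤½ : ∀ t {M a} → α + ℕ→ℚ M * θ ≤ ½ * ½ → a ℕ.≤ M → weight α θ t a ≤ ½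
  weight≤½ t {M} small a≤M = ≤-trans (term≤∑≤ (weight-nonNeg t) a≤M) (∑≤-weight t M small)

-- The power of `r` with exponent ⌊a/2⌋. It is applied only to the total length of a list, which
-- every term of the loop inequality lowers by exactly two, so no square root of `r` is needed even
-- if single loops are odd.
halfPow : ℚ → ℕ → ℚ
halfPow r zero = 1ℚ
halfPow r (suc zero) = 1ℚ
halfPow r (suc (suc a)) = r * halfPow r a

halfPow-nonNeg : ∀ {r} → 0ℚ ≤ r → ∀ a → 0ℚ ≤ halfPow r a
halfPow-nonNeg 0≤r zero = 0≤1
halfPow-nonNeg 0≤r (suc zero) = 0≤1
halfPow-nonNeg 0≤r (suc (suc a)) = *-nonNeg 0≤r (halfPow-nonNeg 0≤r a)

-- `M` caps the total length. `small` keeps the sum of the weights up to `M` at most ½; `n≤rα` pays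
-- for the loop of length zero, whose trace is n; `M≤rθ` pays for the reversed reconnections and the
-- number of fusions; `1≤rθθ` pays for the loop lost in a fusion.
module _ {n M : ℕ} {α θ r : ℚ} (0≤r : 0ℚ ≤ r) (0≤θ : 0ℚ ≤ θ) (θ≤α : θ ≤ α)
  (small : α + ℕ→ℚ M * θ ≤ ½ * ½) (n≤rα : ℕ→ℚ n ≤ r * α) (M≤rθ : ℕ→ℚ M ≤ r * θ) (1≤rθθ : 1ℚ ≤ r * θ * θ) where

  private
    w : ℕ → ℕ → ℚ
    w = weight α θ

    0≤w : ∀ t a → 0ℚ ≤ w t a
    0≤w = weight-nonNeg 0≤θ θ≤α

  weights : ℕ → List ℕ → ℚ
  weights t [] = 1ℚ
  weights t (a ∷ as) = r * w t a * weights t as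

  weights-nonNeg : ∀ t as → 0ℚ ≤ weights t as
  weights-nonNeg t [] = 0≤1
  weights-nonNeg t (a ∷ as) = *-nonNeg (*-nonNeg 0≤r (0≤w t a)) (weights-nonNeg t as)

  weights-mono : ∀ t as → weights t as ≤ weights (suc t) as
  weights-mono t [] = ≤-refl
  weights-mono t (a ∷ as) = *-mono-≤ (*-nonNeg 0≤r (0≤w t a)) (*-monoˡ-≤ 0≤r (weight-mono 0≤θ θ≤α t a)) (weights-nonNeg t as) (weights-mono t as)

  -- A fusion loses a loop and with it a factor r w(b) of the product. This is made up for by 2
  -- w(a+b) ≤ 1 ≤ rθ·θ ≤ rθ·w(b): the bound ½ on weights absorbs the two, and the floor θ bounds the
  -- lost weight from below.
  fuse-weights : ∀ t a bs → a ℕ.+ sum bs ℕ.≤ M → fuse a (weights (suc t)) bs ≤ ℕ→ℚ (sum bs) * (r * θ) * weights (suc t) bs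
  fuse-weights t a [] _ = ≤-reflexive (lemma (r * θ))
    where
    lemma : ∀ z → 0ℚ ≡ 0ℚ * z * 1ℚ
    lemma = solve-∀ ℚ-ring
  fuse-weights t a (b ∷ bs) a+b+∑≤M = begin
    2ℚ * ℕ→ℚ b * (r * w′ (a ℕ.+ b) * W) + fuse a (λ cs → r * w′ b * weights (suc t) cs) bs
      ≡⟨ cong (2ℚ * ℕ→ℚ b * (r * w′ (a ℕ.+ b) * W) +_) (fuse-*ˡ a (r * w′ b) (weights (suc t)) bs) ⟩
    2ℚ * ℕ→ℚ b * (r * w′ (a ℕ.+ b) * W) + r * w′ b * fuse a (weights (suc t)) bs
      ≤⟨ +-mono-≤ fused (*-monoˡ-≤ (*-nonNeg 0≤r (0≤w (suc t) b)) (fuse-weights t a bs (ℕₚ.≤-trans (ℕₚ.+-monoʳ-≤ a (ℕₚ.m≤n+m (sum bs) b)) a+b+∑≤M))) ⟩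
    ℕ→ℚ b * (r * θ) * (r * w′ b * W) + r * w′ b * (ℕ→ℚ (sum bs) * (r * θ) * W)
      ≡⟨ collect (ℕ→ℚ b) (ℕ→ℚ (sum bs)) (r * θ) (r * w′ b) W ⟩
    (ℕ→ℚ b + ℕ→ℚ (sum bs)) * (r * θ) * (r * w′ b * W)
      ≡⟨ cong (λ z → z * (r * θ) * (r * w′ b * W)) (sym (ℕ→ℚ-+ b (sum bs))) ⟩
    ℕ→ℚ (b ℕ.+ sum bs) * (r * θ) * (r * w′ b * W) ∎
    where
    open ≤-Reasoning
    w′ : ℕ → ℚ
    w′ = w (suc t)
    W : ℚ
    W = weights (suc t) bs
    0≤brW : 0ℚ ≤ ℕ→ℚ b * r * W
    0≤brW = *-nonNeg (*-nonNeg (0≤ℕ→ℚ b) 0≤r) (weights-nonNeg (suc t) bs)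
    collect : ∀ b s z y W → b * z * (y * W) + y * (s * z * W) ≡ (b + s) * z * (y * W)
    collect = solve-∀ ℚ-ring
    reorder : ∀ b r v W → 2ℚ * b * (r * v * W) ≡ 2ℚ * (b * r * W) * v
    reorder = solve-∀ ℚ-ring
    halve : ∀ z → 2ℚ * z * ½ ≡ z * 1ℚ
    halve = solve-∀ ℚ-ring
    reorder′ : ∀ b r W θ v → b * r * W * (r * θ * v) ≡ b * (r * θ) * (r * v * W)
    reorder′ = solve-∀ ℚ-ring
    fused : 2ℚ * ℕ→ℚ b * (r * w′ (a ℕ.+ b) * W) ≤ ℕ→ℚ b * (r * θ) * (r * w′ b * W)
    fused = begin
      2ℚ * ℕ→ℚ b * (r * w′ (a ℕ.+ b) * W)     ≡⟨ reorder (ℕ→ℚ b) r (w′ (a ℕ.+ b)) W ⟩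
      2ℚ * (ℕ→ℚ b * r * W) * w′ (a ℕ.+ b)     ≤⟨ *-monoˡ-≤ (*-nonNeg (nonNegative⁻¹ 2ℚ) 0≤brW) (weight≤½ 0≤θ θ≤α (suc t) {M} small (ℕₚ.≤-trans (ℕₚ.+-monoʳ-≤ a (ℕₚ.m≤m+n b (sum bs))) a+b+∑≤M)) ⟩
      2ℚ * (ℕ→ℚ b * r * W) * ½                ≡⟨ halve (ℕ→ℚ b * r * W) ⟩
      ℕ→ℚ b * r * W * 1ℚ                      ≤⟨ *-monoˡ-≤ 0≤brW (≤-trans 1≤rθθ (*-monoˡ-≤ (*-nonNeg 0≤r 0≤θ) (θ≤weight 0≤θ θ≤α t b))) ⟩
      ℕ→ℚ b * r * W * (r * θ * w′ b)          ≡⟨ reorder′ (ℕ→ℚ b) r W θ (w′ b) ⟩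
      ℕ→ℚ b * (r * θ) * (r * w′ b * W)        ∎

  -- Induction on `t`, and for fixed `t` on the list, where loops of length zero are stripped. Each
  -- use of the loop inequality passes to a smaller `t` and thus to an earlier iterate of the
  -- weights, while `M` stays fixed because the estimates on the weights refer to it.
  F-bound : ∀ t as → sum as ℕ.≤ t → sum as ℕ.≤ M → F {n} as ≤ halfPow r (sum as) * weights (suc t) as
  F-bound t [] _ _ = ≤-reflexive (F-[] {n})
  F-bound t (zero ∷ as) ∑≤t ∑≤M = begin
    F {n} (0 ∷ as)                                          ≡⟨ F-0 {n} as ⟩
    ℕ→ℚ n * F {n} as                                        ≤⟨ *-monoˡ-≤ (0≤ℕ→ℚ n) (F-bound t as ∑≤t ∑≤M) ⟩
    ℕ→ℚ n * (halfPow r (sum as) * weights (suc t) as)   ≤⟨ *-monoʳ-≤ (*-nonNeg (halfPow-nonNeg 0≤r (sum as)) (weights-nonNeg (suc t) as)) n≤rα ⟩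
    r * α * (halfPow r (sum as) * weights (suc t) as)   ≡⟨ lemma (r * α) (halfPow r (sum as)) (weights (suc t) as) ⟩
    halfPow r (sum as) * (r * α * weights (suc t) as)   ∎
    where
    open ≤-Reasoning
    lemma : ∀ x p W → x * (p * W) ≡ p * (x * W)
    lemma = solve-∀ ℚ-ring
  F-bound t (suc zero ∷ as) _ _ = ≤-trans (≤-reflexive (F-1 {n} as)) (*-nonNeg (halfPow-nonNeg 0≤r (suc (sum as))) (weights-nonNeg (suc t) (1 ∷ as)))
  F-bound (suc t) (suc (suc a) ∷ as) (ℕ.s≤s ∑≤t) ∑≤M = begin
    F {n} (suc (suc a) ∷ as)
      ≤⟨ F-loop {n} a as ⟩
    conv (λ s u → F {n} (s ∷ u ∷ as)) a + ℕ→ℚ (suc a) * F {n} (a ∷ as) + fuse a (F {n}) as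
      ≤⟨ +-mono-≤ (+-mono-≤ splits (*-monoˡ-≤ (0≤ℕ→ℚ (suc a)) (F-bound t (a ∷ as) ∑′≤t ∑′≤M))) fusions ⟩
    p * (r * r * W) * conv ww a + ℕ→ℚ (suc a) * (p * (r * w (suc t) a * W)) + p * (ℕ→ℚ (sum as) * (r * θ) * W)
      ≡⟨ collect p r W (conv ww a) (ℕ→ℚ (suc a)) (w (suc t) a) (ℕ→ℚ (sum as)) θ ⟩
    p * W * r * (r * conv ww a + (ℕ→ℚ (suc a) * w (suc t) a + ℕ→ℚ (sum as) * θ))
      -- Both error terms together are absorbed by the θ in the recursion of `weight`, which exists
      -- for this purpose.
      ≤⟨ *-monoˡ-≤ (*-nonNeg (*-nonNeg 0≤p (weights-nonNeg (suc t) as)) 0≤r) (+-monoʳ-≤ (r * conv ww a) error) ⟩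
    p * W * r * (r * conv ww a + r * θ)
      ≡⟨ reorder p W r (conv ww a) θ ⟩
    r * p * (r * (θ + conv ww a)) * W
      ≤⟨ *-monoˡ-≤ (*-nonNeg (*-nonNeg 0≤r 0≤p) (*-nonNeg 0≤r (0≤w (suc (suc t)) (suc (suc a))))) (weights-mono (suc t) as) ⟩
    r * p * (r * (θ + conv ww a)) * weights (suc (suc t)) as
      ≡⟨ *-assoc (r * p) (r * (θ + conv ww a)) (weights (suc (suc t)) as) ⟩
    r * p * (r * (θ + conv ww a) * weights (suc (suc t)) as) ∎
    where
    open ≤-Reasoning
    p W : ℚ
    p = halfPow r (a ℕ.+ sum as)
    W = weights (suc t) as
    ww : ℕ → ℕ → ℚ
    ww s u = w (suc t) s * w (suc t) u
    0≤p : 0ℚ ≤ p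
    0≤p = halfPow-nonNeg 0≤r (a ℕ.+ sum as)
    ∑′≤t : a ℕ.+ sum as ℕ.≤ t
    ∑′≤t = ℕₚ.≤-trans (ℕₚ.n≤1+n (a ℕ.+ sum as)) ∑≤t
    ∑′≤M : a ℕ.+ sum as ℕ.≤ M
    ∑′≤M = ℕₚ.≤-trans (ℕₚ.m≤n+m (a ℕ.+ sum as) 2) ∑≤M
    splits : conv (λ s u → F {n} (s ∷ u ∷ as)) a ≤ p * (r * r * W) * conv ww a
    splits = ≤-trans (conv-mono-≤ a split) (≤-reflexive (conv-*ˡ (p * (r * r * W)) ww a))
      where
      lemma : ∀ p r x y W → p * (r * x * (r * y * W)) ≡ p * (r * r * W) * (x * y)
      lemma = solve-∀ ℚ-ring
      split : ∀ s u → s ℕ.+ u ≡ a → F {n} (s ∷ u ∷ as) ≤ p * (r * r * W) * ww s u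
      split s u refl = subst (F {n} (s ∷ u ∷ as) ≤_)
        (trans (cong (λ c → halfPow r c * weights (suc t) (s ∷ u ∷ as)) (sym (ℕₚ.+-assoc s u (sum as)))) (lemma p r (w (suc t) s) (w (suc t) u) W))
        (F-bound t (s ∷ u ∷ as) (subst (ℕ._≤ t) (ℕₚ.+-assoc s u (sum as)) ∑′≤t) (subst (ℕ._≤ M) (ℕₚ.+-assoc s u (sum as)) ∑′≤M))
    fusions : fuse a (F {n}) as ≤ p * (ℕ→ℚ (sum as) * (r * θ) * W)
    fusions = ≤-trans (fuse-mono-≤ a as (λ cs eq → subst (λ c → F {n} cs ≤ halfPow r c * weights (suc t) cs) eq (F-bound t cs (subst (ℕ._≤ t) (sym eq) ∑′≤t) (subst (ℕ._≤ M) (sym eq) ∑′≤M))))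
      (≤-trans (≤-reflexive (fuse-*ˡ a p (weights (suc t)) as)) (*-monoˡ-≤ 0≤p (fuse-weights t a as ∑′≤M)))
    ½≤1 : ½ ≤ 1ℚ
    ½≤1 = toWitness {a? = ½ ≤? 1ℚ} _
    θ≤1 : θ ≤ 1ℚ
    θ≤1 = ≤-trans (≤-trans θ≤α (weight≤½ 0≤θ θ≤α 1 {M} small ℕ.z≤n)) ½≤1
    error : ℕ→ℚ (suc a) * w (suc t) a + ℕ→ℚ (sum as) * θ ≤ r * θ
    error = begin
      ℕ→ℚ (suc a) * w (suc t) a + ℕ→ℚ (sum as) * θ  ≤⟨ +-mono-≤ (*-monoˡ-≤ (0≤ℕ→ℚ (suc a)) (≤-trans (weight≤½ 0≤θ θ≤α (suc t) {M} small (ℕₚ.≤-trans (ℕₚ.m≤m+n a (sum as)) ∑′≤M)) ½≤1)) (*-monoˡ-≤ (0≤ℕ→ℚ (sum as)) θ≤1) ⟩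
      ℕ→ℚ (suc a) * 1ℚ + ℕ→ℚ (sum as) * 1ℚ          ≡⟨ cong₂ _+_ (*-identityʳ (ℕ→ℚ (suc a))) (*-identityʳ (ℕ→ℚ (sum as))) ⟩
      ℕ→ℚ (suc a) + ℕ→ℚ (sum as)                    ≡⟨ sym (ℕ→ℚ-+ (suc a) (sum as)) ⟩
      ℕ→ℚ (suc a ℕ.+ sum as)                        ≤⟨ ℕ→ℚ-mono-≤ (ℕₚ.≤-trans (ℕₚ.n≤1+n (suc a ℕ.+ sum as)) ∑≤M) ⟩
      ℕ→ℚ M                                         ≤⟨ M≤rθ ⟩
      r * θ                                         ∎
    collect : ∀ p r W c k v s θ → p * (r * r * W) * c + k * (p * (r * v * W)) + p * (s * (r * θ) * W) ≡ p * W * r * (r * c + (k * v + s * θ))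
    collect = solve-∀ ℚ-ring
    reorder : ∀ p W r c θ → p * W * r * (r * c + r * θ) ≡ r * p * (r * (θ + c)) * W
    reorder = solve-∀ ℚ-ring

  F-trace-bound : F {n} (M ∷ []) ≤ halfPow r M * (r * ½)
  F-trace-bound = begin
    F {n} (M ∷ [])                                     ≤⟨ F-bound M (M ∷ []) (ℕₚ.≤-reflexive (ℕₚ.+-identityʳ M)) (ℕₚ.≤-reflexive (ℕₚ.+-identityʳ M)) ⟩
    halfPow r (M ℕ.+ 0) * (r * w (suc M) M * 1ℚ)       ≡⟨ cong₂ _*_ (cong (halfPow r) (ℕₚ.+-identityʳ M)) (*-identityʳ (r * w (suc M) M)) ⟩
    halfPow r M * (r * w (suc M) M)                    ≤⟨ *-monoˡ-≤ (halfPow-nonNeg 0≤r M) (*-monoˡ-≤ 0≤r (weight≤½ 0≤θ θ≤α (suc M) {M} small ℕₚ.≤-refl)) ⟩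
    halfPow r M * (r * ½)                              ∎
    where open ≤-Reasoning

-- Traces of even powers dominate Rayleigh quotients

infixr 8 _▸_
_▸_ : ∀ {n} → Mat n → (Fin n → ℚ) → Fin n → ℚ
(B ▸ v) i = ∑ λ j → B i j * v j

∑-square : ∀ {n} → (Fin n → ℚ) → ℚ
∑-square v = ∑ λ i → v i * v i

module _ {n} (A : Mat n) (A-sym : Symmetric A) where

  self-adjoint : ∀ a (u v : Fin n → ℚ) → ∑ (λ i → u i * (pow A a ▸ v) i) ≡ ∑ (λ i → (pow A a ▸ u) i * v i)
  self-adjoint a u v = begin
    ∑ (λ i → u i * ∑ λ j → pow A a i j * v j)
      ≡⟨ sum-cong-≗ (λ i → *-distribˡ-sum (u i) (λ j → pow A a i j * v j)) ⟩
    ∑∑ (λ i j → u i * (pow A a i j * v j))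
      ≡⟨ ∑-comm (λ i j → u i * (pow A a i j * v j)) ⟩
    ∑∑ (λ j i → u i * (pow A a i j * v j))
      ≡⟨ ∑∑-cong (λ j i → trans (cong (λ p → u i * (p * v j)) (pow-symmetric A A-sym a i j)) (lemma (u i) (pow A a j i) (v j))) ⟩
    ∑∑ (λ j i → pow A a j i * u i * v j)
      ≡⟨ sum-cong-≗ (λ j → sym (*-distribʳ-sum (v j) (λ i → pow A a j i * u i))) ⟩
    ∑ (λ j → (pow A a ▸ u) j * v j) ∎
    where
    open ≡-Reasoning
    lemma : ∀ u p v → u * (p * v) ≡ p * u * v
    lemma = solve-∀ ℚ-ring

  pow-+-▸ : ∀ a b v i → (pow A (a ℕ.+ b) ▸ v) i ≡ (pow A a ▸ pow A b ▸ v) i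
  pow-+-▸ a b v i = begin
    ∑ (λ j → pow A (a ℕ.+ b) i j * v j)
      ≡⟨ sum-cong-≗ (λ j → trans (cong (_* v j) (pow-+ A a b i j)) (*-distribʳ-sum (v j) (λ k → pow A a i k * pow A b k j))) ⟩
    ∑∑ (λ j k → pow A a i k * pow A b k j * v j)
      ≡⟨ ∑-comm (λ j k → pow A a i k * pow A b k j * v j) ⟩
    ∑∑ (λ k j → pow A a i k * pow A b k j * v j)
      ≡⟨ sum-cong-≗ (λ k → trans (sum-cong-≗ (λ j → *-assoc (pow A a i k) (pow A b k j) (v j))) (sym (*-distribˡ-sum (pow A a i k) (λ j → pow A b k j * v j)))) ⟩
    ∑ (λ k → pow A a i k * (pow A b ▸ v) k) ∎
    where open ≡-Reasoning

  quadratic : (Fin n → ℚ) → ℕ → ℚ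
  quadratic v a = ∑ λ i → v i * (pow A a ▸ v) i

  quadratic-double : ∀ v a → quadratic v (a ℕ.+ a) ≡ ∑-square (pow A a ▸ v)
  quadratic-double v a = trans (sum-cong-≗ (λ i → cong (v i *_) (pow-+-▸ a a v i))) (self-adjoint a v (pow A a ▸ v))

  quadratic² : ∀ v a → quadratic v a * quadratic v a ≤ ∑-square v * quadratic v (a ℕ.+ a)
  quadratic² v a = ≤-trans (cauchy-schwarz v (pow A a ▸ v)) (≤-reflexive (cong (∑-square v *_) (sym (quadratic-double v a))))

  tr-double : ∀ a → tr (pow A (a ℕ.+ a)) ≡ ∑ (λ i → ∑-square (pow A a i))
  tr-double a = sum-cong-≗ (λ i → trans (pow-+ A a a i i) (sum-cong-≗ (λ k → cong (pow A a i k *_) (pow-symmetric A A-sym a k i))))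

  -- The Hilbert-Schmidt norm of A^a, whose square is tr A^(2a), dominates its operator norm. This
  -- replaces the comparison of eigenvalues with the trace.
  quadratic≤tr : ∀ v a → quadratic v (a ℕ.+ a) ≤ ∑-square v * tr (pow A (a ℕ.+ a))
  quadratic≤tr v a = begin
    quadratic v (a ℕ.+ a)                         ≡⟨ quadratic-double v a ⟩
    ∑-square (pow A a ▸ v)                        ≤⟨ ∑-mono-≤ (λ i → cauchy-schwarz (pow A a i) v) ⟩
    ∑ (λ i → ∑-square (pow A a i) * ∑-square v)   ≡⟨ sym (*-distribʳ-sum (∑-square v) (λ i → ∑-square (pow A a i))) ⟩
    ∑ (λ i → ∑-square (pow A a i)) * ∑-square v   ≡⟨ cong (_* ∑-square v) (sym (tr-double a)) ⟩
    tr (pow A (a ℕ.+ a)) * ∑-square v             ≡⟨ *-comm (tr (pow A (a ℕ.+ a))) (∑-square v) ⟩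
    ∑-square v * tr (pow A (a ℕ.+ a))             ∎
    where open ≤-Reasoning

  -- Cauchy-Schwarz along the diagonal of A^a, whose squares are part of the sum of squares tr
  -- A^(2a). It turns the second moment of a trace into the first moment of a longer one.
  tr² : ∀ a → tr (pow A a) * tr (pow A a) ≤ ℕ→ℚ n * tr (pow A (a ℕ.+ a))
  tr² a = begin
    tr (pow A a) * tr (pow A a)
      ≡⟨ cong (λ t → t * t) (sum-cong-≗ (λ i → sym (*-identityˡ (pow A a i i)))) ⟩
    ∑ (λ i → 1ℚ * pow A a i i) * ∑ (λ i → 1ℚ * pow A a i i)
      ≤⟨ cauchy-schwarz (λ _ → 1ℚ) (λ i → pow A a i i) ⟩
    ∑ {n} (λ _ → 1ℚ) * ∑-square (λ i → pow A a i i)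
      ≡⟨ cong (_* ∑-square (λ i → pow A a i i)) (trans (∑-const n 1ℚ) (*-identityʳ (ℕ→ℚ n))) ⟩
    ℕ→ℚ n * ∑-square (λ i → pow A a i i)
      ≤⟨ *-monoˡ-≤ (0≤ℕ→ℚ n) (∑-mono-≤ (λ i → term≤∑ {f = λ k → pow A a i k * pow A a i k} (λ k → square-nonNeg (pow A a i k)) i)) ⟩
    ℕ→ℚ n * ∑ (λ i → ∑-square (pow A a i))
      ≡⟨ cong (ℕ→ℚ n *_) (sym (tr-double a)) ⟩
    ℕ→ℚ n * tr (pow A (a ℕ.+ a)) ∎
    where open ≤-Reasoning

  module _ (v : Fin n → ℚ) (0<s : 0ℚ < ∑-square v) {τ : ℚ} (0≤τ : 0ℚ ≤ τ) (sτ≤|Av|² : ∑-square v * τ ≤ ∑-square (A ▸ v)) where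

    private
      s : ℚ
      s = ∑-square v

    -- Each doubling squares the bound, by `quadratic²`. The start is |Av|² instead of ⟨v, Av⟩,
    -- because the Rayleigh quotient 1 - s of a colour class is negative for s > 1; hence `τ` is on
    -- the squared scale.
    quadratic-growth : ∀ j → s * τ ^ (2 ℕ.^ j) ≤ quadratic v (2 ℕ.^ j ℕ.+ 2 ℕ.^ j)
    quadratic-growth zero = begin
      s * (τ * 1ℚ)              ≡⟨ cong (s *_) (*-identityʳ τ) ⟩
      s * τ                     ≤⟨ sτ≤|Av|² ⟩
      ∑-square (A ▸ v)          ≡⟨ sum-cong-≗ (λ i → cong (λ z → z * z) (sum-cong-≗ (λ j → cong (_* v j) (sym (pow-1 A i j))))) ⟩
      ∑-square (pow A 1 ▸ v)    ≡⟨ sym (quadratic-double v 1) ⟩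
      quadratic v 2             ∎
      where open ≤-Reasoning
    quadratic-growth (suc j) = *-cancelˡ-≤ 0<s (begin
      s * (s * τ ^ (m ℕ.+ (m ℕ.+ 0)))                 ≡⟨ cong (λ k → s * (s * τ ^ (m ℕ.+ k))) (ℕₚ.+-identityʳ m) ⟩
      s * (s * τ ^ (m ℕ.+ m))                         ≡⟨ cong (λ z → s * (s * z)) (^-homo-* τ m m) ⟩
      s * (s * (τ ^ m * τ ^ m))                       ≡⟨ lemma s (τ ^ m) ⟩
      s * τ ^ m * (s * τ ^ m)                         ≤⟨ *-mono-≤ 0≤sτ^m (quadratic-growth j) 0≤sτ^m (quadratic-growth j) ⟩
      quadratic v (m ℕ.+ m) * quadratic v (m ℕ.+ m)   ≤⟨ quadratic² v (m ℕ.+ m) ⟩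
      s * quadratic v (m ℕ.+ m ℕ.+ (m ℕ.+ m))         ≡⟨ cong (λ k → s * quadratic v (m ℕ.+ k ℕ.+ (m ℕ.+ k))) (sym (ℕₚ.+-identityʳ m)) ⟩
      s * quadratic v (m ℕ.+ (m ℕ.+ 0) ℕ.+ (m ℕ.+ (m ℕ.+ 0))) ∎)
      where
      open ≤-Reasoning
      m : ℕ
      m = 2 ℕ.^ j
      0≤sτ^m : 0ℚ ≤ s * τ ^ m
      0≤sτ^m = *-nonNeg (<⇒≤ 0<s) (^-nonNeg m 0≤τ)
      lemma : ∀ s t → s * (s * (t * t)) ≡ s * t * (s * t)
      lemma = solve-∀ ℚ-ring

    tr-lower-bound : ∀ j → τ ^ (2 ℕ.^ j) ≤ tr (pow A (2 ℕ.^ j ℕ.+ 2 ℕ.^ j))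
    tr-lower-bound j = *-cancelˡ-≤ 0<s (≤-trans (quadratic-growth j) (quadratic≤tr v (2 ℕ.^ j)))

-- Colour classes

largest : ∀ {q} (f : Fin (suc q) → ℚ) → ∃ λ k → ∀ j → f j ≤ f k
largest {zero} f = zero , λ { zero → ≤-refl }
largest {suc q} f with largest (f ∘ suc)
... | k , f≤fk with ≤-total (f zero) (f (suc k))
...   | inj₁ f0≤fk = suc k , λ { zero → f0≤fk ; (suc j) → f≤fk j }
...   | inj₂ fk≤f0 = zero , λ { zero → ≤-refl ; (suc j) → ≤-trans (f≤fk j) fk≤f0 }

pigeonhole : ∀ {q} (f : Fin (suc q) → ℚ) → ∃ λ k → ∑ f ≤ ℕ→ℚ (suc q) * f k
pigeonhole {q} f with largest f
... | k , f≤fk = k , ≤-trans (∑-mono-≤ f≤fk) (≤-reflexive (∑-const (suc q) (f k)))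

lookup-between : ∀ {n} {x y : Fin n} (x≢y : x ≢ y) → lookup (pairs n) (between x≢y) ≡ (x , y) ⊎ lookup (pairs n) (between x≢y) ≡ (y , x)
lookup-between {x = x} {y} x≢y with Finₚ.<-cmp x y
... | tri< x<y _ _ = inj₁ (lookup-edge x<y)
... | tri≈ _ x≡y _ = contradiction x≡y x≢y
... | tri> _ _ y<x = inj₂ (lookup-edge y<x)

module _ {n q : ℕ} (X : Graph n) (colouring : Colorable n q X) where

  private
    c : Fin n → Fin q
    c = proj₁ colouring

  adj-monochromatic : ∀ {x y} → x ≢ y → c x ≡ c y → adj {n} X x y ≡ - 1ℚ
  adj-monochromatic {x} {y} x≢y cx≡cy = trans (adj-≢ x≢y X) (cong sign absent)
    where
    e : Fin (N n)
    e = between x≢y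
    absent : X e ≡ false
    absent with X e in present
    ... | false = refl
    ... | true with lookup-between x≢y
    ...   | inj₁ eq = contradiction (subst (λ p → c (proj₁ p) ≡ c (proj₂ p)) (sym eq) cx≡cy) (proj₂ colouring e present)
    ...   | inj₂ eq = contradiction (subst (λ p → c (proj₁ p) ≡ c (proj₂ p)) (sym eq) (sym cx≡cy)) (proj₂ colouring e present)

  indicator : Fin q → Fin n → ℚ
  indicator k i = δ (c i) k

  indicator² : ∀ k i → indicator k i * indicator k i ≡ indicator k i
  indicator² k i with c i Finₚ.≟ k
  ... | yes ci≡k = trans (cong (λ z → z * z) δ≡1) (sym δ≡1)
    where
    δ≡1 : δ (c i) k ≡ 1ℚ
    δ≡1 = trans (cong (λ l → δ l k) ci≡k) (δ-refl k)
  ... | no ci≢k = trans (cong (λ z → z * z) (δ-≢ (c i) k ci≢k)) (sym (δ-≢ (c i) k ci≢k))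

  classSize : Fin q → ℚ
  classSize k = ∑ (indicator k)

  ∑-classSize : ∑ classSize ≡ ℕ→ℚ n
  ∑-classSize = begin
    ∑∑′ (λ k i → δ (c i) k)         ≡⟨ ∑-comm (λ k i → δ (c i) k) ⟩
    ∑∑′ (λ i k → δ (c i) k)         ≡⟨ sum-cong-≗ (λ i → trans (sum-cong-≗ (λ k → sym (*-identityʳ (δ (c i) k)))) (∑-δ (c i) (λ _ → 1ℚ))) ⟩
    ∑ {n} (λ _ → 1ℚ)                ≡⟨ trans (∑-const n 1ℚ) (*-identityʳ (ℕ→ℚ n)) ⟩
    ℕ→ℚ n                           ∎
    where
    open ≡-Reasoning
    ∑∑′ : ∀ {a b} → (Fin a → Fin b → ℚ) → ℚ
    ∑∑′ f = ∑ λ i → ∑ λ j → f i j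

  adj-▸-indicator : ∀ k i → c i ≡ k → (adj {n} X ▸ indicator k) i ≡ 1ℚ - classSize k
  adj-▸-indicator k i ci≡k = begin
    ∑ (λ j → adj X i j * v j)                     ≡⟨ sum-cong-≗ entry ⟩
    ∑ (λ j → δ i j * v j + - 1ℚ * v j)            ≡⟨ ∑-distrib-+ (λ j → δ i j * v j) (λ j → - 1ℚ * v j) ⟩
    ∑ (λ j → δ i j * v j) + ∑ (λ j → - 1ℚ * v j)  ≡⟨ cong₂ _+_ (trans (∑-δ i v) (trans (cong (λ l → δ l k) ci≡k) (δ-refl k))) (sym (*-distribˡ-sum (- 1ℚ) v)) ⟩
    1ℚ + - 1ℚ * classSize k                       ≡⟨ lemma (classSize k) ⟩
    1ℚ - classSize k                              ∎
    where
    open ≡-Reasoning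
    v : Fin n → ℚ
    v = indicator k
    lemma : ∀ s → 1ℚ + - 1ℚ * s ≡ 1ℚ - s
    lemma = solve-∀ ℚ-ring
    cancel : ∀ z → 0ℚ * z ≡ 1ℚ * z + - 1ℚ * z
    cancel = solve-∀ ℚ-ring
    drop : ∀ z → - 1ℚ * z ≡ 0ℚ * z + - 1ℚ * z
    drop = solve-∀ ℚ-ring
    vanish : ∀ a d → a * 0ℚ ≡ d * 0ℚ + - 1ℚ * 0ℚ
    vanish = solve-∀ ℚ-ring
    entry : ∀ j → adj X i j * v j ≡ δ i j * v j + - 1ℚ * v j
    entry j with i Finₚ.≟ j | c j Finₚ.≟ k
    ... | yes refl | _ = trans (cong (_* v i) (adj-diagonal i X)) (trans (cancel (v i)) (cong (λ d → d * v i + - 1ℚ * v i) (sym (δ-refl i))))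
    ... | no i≢j | yes cj≡k = trans (cong (_* v j) (adj-monochromatic i≢j (trans ci≡k (sym cj≡k)))) (trans (drop (v j)) (cong (λ d → d * v j + - 1ℚ * v j) (sym (δ-≢ i j i≢j))))
    ... | no i≢j | no cj≢k = subst (λ z → adj X i j * z ≡ δ i j * z + - 1ℚ * z) (sym (δ-≢ (c j) k cj≢k)) (vanish (adj X i j) (δ i j))

  ∑-square-indicator : ∀ k → ∑-square (indicator k) ≡ classSize k
  ∑-square-indicator k = sum-cong-≗ (indicator² k)

  -- Rows outside the class are unknown, but their squares are nonnegative and may be dropped; each
  -- of the s rows inside contributes (1 - s)².
  ∑-square-adj-▸ : ∀ k → classSize k * ((classSize k - 1ℚ) * (classSize k - 1ℚ)) ≤ ∑-square (adj {n} X ▸ indicator k)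
  ∑-square-adj-▸ k = ≤-trans (≤-reflexive (*-distribʳ-sum ((s - 1ℚ) * (s - 1ℚ)) (indicator k))) (∑-mono-≤ entry)
    where
    s : ℚ
    s = classSize k
    lemma : ∀ s → 1ℚ * ((s - 1ℚ) * (s - 1ℚ)) ≡ (1ℚ - s) * (1ℚ - s)
    lemma = solve-∀ ℚ-ring
    entry : ∀ i → indicator k i * ((s - 1ℚ) * (s - 1ℚ)) ≤ (adj X ▸ indicator k) i * (adj X ▸ indicator k) i
    entry i with c i Finₚ.≟ k
    ... | yes ci≡k = ≤-reflexive (trans (cong (_* ((s - 1ℚ) * (s - 1ℚ))) (trans (cong (λ l → δ l k) ci≡k) (δ-refl k))) (trans (lemma s) (sym (cong (λ z → z * z) (adj-▸-indicator k i ci≡k)))))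
    ... | no ci≢k = ≤-trans (≤-reflexive (trans (cong (_* ((s - 1ℚ) * (s - 1ℚ))) (δ-≢ (c i) k ci≢k)) (*-zeroˡ ((s - 1ℚ) * (s - 1ℚ))))) (square-nonNeg ((adj X ▸ indicator k) i))

-- Degrees

degree-++ : ∀ {m d} (p q : Poly m) → degree p ℕ.≤ d → degree q ℕ.≤ d → degree (p ++ q) ℕ.≤ d
degree-++ [] q _ q≤d = q≤d
degree-++ ((c , μ) ∷ p) q p≤d q≤d = ℕₚ.⊔-lub (ℕₚ.m⊔n≤o⇒m≤o (length μ) (degree p) p≤d) (degree-++ p q (ℕₚ.m⊔n≤o⇒n≤o (length μ) (degree p) p≤d) q≤d)

degree-mulTerm : ∀ {m a b} c (μ : Monomial m) (p : Poly m) → length μ ℕ.≤ a → degree p ℕ.≤ b → degree (mulTerm (c , μ) p) ℕ.≤ a ℕ.+ b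
degree-mulTerm c μ [] _ _ = ℕ.z≤n
degree-mulTerm {a = a} {b} c μ ((d , ν) ∷ p) μ≤a p≤b = ℕₚ.⊔-lub
  (subst (ℕ._≤ a ℕ.+ b) (sym (length-++ μ)) (ℕₚ.+-mono-≤ μ≤a (ℕₚ.m⊔n≤o⇒m≤o (length ν) (degree p) p≤b)))
  (degree-mulTerm c μ p μ≤a (ℕₚ.m⊔n≤o⇒n≤o (length ν) (degree p) p≤b))

degree-⊗ : ∀ {m a b} (p q : Poly m) → degree p ℕ.≤ a → degree q ℕ.≤ b → degree (p ⊗ q) ℕ.≤ a ℕ.+ b
degree-⊗ [] q _ _ = ℕ.z≤n
degree-⊗ ((c , μ) ∷ p) q p≤a q≤b = degree-++ (mulTerm (c , μ) q) (p ⊗ q)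
  (degree-mulTerm c μ q (ℕₚ.m⊔n≤o⇒m≤o (length μ) (degree p) p≤a) q≤b)
  (degree-⊗ p q (ℕₚ.m⊔n≤o⇒n≤o (length μ) (degree p) p≤a) q≤b)

degree-∑ᴾ : ∀ {m k d} (p : Fin k → Poly m) → (∀ i → degree (p i) ℕ.≤ d) → degree (∑ᴾ p) ℕ.≤ d
degree-∑ᴾ {k = zero} p p≤d = ℕ.z≤n
degree-∑ᴾ {k = suc k} p p≤d = degree-++ (p zero) (∑ᴾ (p ∘ suc)) (p≤d zero) (degree-∑ᴾ (p ∘ suc) (p≤d ∘ suc))

degree-powᴾ : ∀ {n} a (i j : Fin n) → degree (powᴾ a i j) ℕ.≤ a
degree-powᴾ zero i j = ℕ.z≤n
degree-powᴾ (suc a) i j = degree-∑ᴾ (λ k → adjᴾ i k ⊗ powᴾ a k j) (λ k → degree-⊗ (adjᴾ i k) (powᴾ a k j) (adjᴾ-degree i k) (degree-powᴾ a k j))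

degree-trᴾ : ∀ {n} a → degree (trᴾ {n} a) ℕ.≤ a
degree-trᴾ {n} a = degree-∑ᴾ {k = n} (λ i → powᴾ a i i) (λ i → degree-powᴾ a i i)

-- Logarithms and exponents

m≤2^⌈log₂m⌉ : ∀ m → m ℕ.≤ 2 ℕ.^ ⌈log₂ m ⌉
m≤2^⌈log₂m⌉ = <-rec (λ m → m ℕ.≤ 2 ℕ.^ ⌈log₂ m ⌉) step
  where
  m≤2⌈m/2⌉ : ∀ m → m ℕ.≤ 2 ℕ.* ℕ.⌈ m /2⌉
  m≤2⌈m/2⌉ m = begin
    m                                ≡⟨ sym (ℕₚ.⌊n/2⌋+⌈n/2⌉≡n m) ⟩
    ℕ.⌊ m /2⌋ ℕ.+ ℕ.⌈ m /2⌉          ≤⟨ ℕₚ.+-mono-≤ (ℕₚ.⌊n/2⌋≤⌈n/2⌉ m) (ℕₚ.≤-reflexive (sym (ℕₚ.+-identityʳ ℕ.⌈ m /2⌉))) ⟩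
    2 ℕ.* ℕ.⌈ m /2⌉                  ∎
    where open ℕₚ.≤-Reasoning
  step : ∀ m → (∀ {k} → k ℕ.< m → k ℕ.≤ 2 ℕ.^ ⌈log₂ k ⌉) → m ℕ.≤ 2 ℕ.^ ⌈log₂ m ⌉
  step zero _ = ℕ.z≤n
  step (suc zero) _ = ℕₚ.≤-refl
  step m@(suc (suc m-2)) rec = begin
    m                                     ≤⟨ m≤2⌈m/2⌉ m ⟩
    2 ℕ.* ℕ.⌈ m /2⌉                       ≤⟨ ℕₚ.*-monoʳ-≤ 2 (rec (ℕₚ.⌈n/2⌉<n m-2)) ⟩
    2 ℕ.^ suc ⌈log₂ ℕ.⌈ m /2⌉ ⌉           ≡⟨ cong (λ k → 2 ℕ.^ suc k) (⌈log₂⌈n/2⌉⌉≡⌈log₂n⌉∸1 m) ⟩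
    2 ℕ.^ suc (⌈log₂ m ⌉ ℕ.∸ 1)           ≡⟨ cong (2 ℕ.^_) (ℕₚ.m+[n∸m]≡n (⌈log₂⌉-mono-≤ {2} {m} (ℕ.s≤s (ℕ.s≤s ℕ.z≤n)))) ⟩
    2 ℕ.^ ⌈log₂ m ⌉                       ∎
    where open ℕₚ.≤-Reasoning

-- If half of the power were still at least m, the rounded logarithm would be smaller by one.
2^⌈log₂m⌉≤2m : ∀ {m} → 0 ℕ.< m → 2 ℕ.^ ⌈log₂ m ⌉ ℕ.≤ 2 ℕ.* m
2^⌈log₂m⌉≤2m {m} 0<m = bound ⌈log₂ m ⌉ refl
  where
  bound : ∀ k → k ≡ ⌈log₂ m ⌉ → 2 ℕ.^ k ℕ.≤ 2 ℕ.* m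
  bound zero _ = ℕₚ.≤-trans 0<m (ℕₚ.m≤n*m m 2)
  bound (suc k) 1+k≡log with m ℕₚ.≤? 2 ℕ.^ k
  ... | no m≰2^k = ℕₚ.*-monoʳ-≤ 2 (ℕₚ.≰⇒≥ m≰2^k)
  ... | yes m≤2^k = contradiction (subst₂ ℕ._≤_ (sym 1+k≡log) (⌈log₂2^n⌉≡n k) (⌈log₂⌉-mono-≤ m≤2^k)) (ℕₚ.<⇒≱ (ℕₚ.n<1+n k))

cube≤2^ : ∀ k → k ℕ.* k ℕ.* k ℕ.≤ 13 ℕ.* 2 ℕ.^ k
cube≤2^ k = ℕₚ.≤-trans (ℕₚ.m≤m+n (k ℕ.* k ℕ.* k) (3 ℕ.* (k ℕ.* k) ℕ.+ 9 ℕ.* k ℕ.+ 13)) (stronger k)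
  where
  -- The lower-order terms make the sequence at most double at each step.
  stronger : ∀ k → k ℕ.* k ℕ.* k ℕ.+ (3 ℕ.* (k ℕ.* k) ℕ.+ 9 ℕ.* k ℕ.+ 13) ℕ.≤ 13 ℕ.* 2 ℕ.^ k
  stronger zero = ℕₚ.≤-refl
  stronger (suc k) = begin
    suc k ℕ.* suc k ℕ.* suc k ℕ.+ (3 ℕ.* (suc k ℕ.* suc k) ℕ.+ 9 ℕ.* suc k ℕ.+ 13)
      ≤⟨ ℕₚ.m≤m+n _ (k ℕ.* k ℕ.* k) ⟩
    suc k ℕ.* suc k ℕ.* suc k ℕ.+ (3 ℕ.* (suc k ℕ.* suc k) ℕ.+ 9 ℕ.* suc k ℕ.+ 13) ℕ.+ k ℕ.* k ℕ.* k
      ≡⟨ double k ⟩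
    2 ℕ.* (k ℕ.* k ℕ.* k ℕ.+ (3 ℕ.* (k ℕ.* k) ℕ.+ 9 ℕ.* k ℕ.+ 13))
      ≤⟨ ℕₚ.*-monoʳ-≤ 2 (stronger k) ⟩
    2 ℕ.* (13 ℕ.* 2 ℕ.^ k)
      ≡⟨ swap (2 ℕ.^ k) ⟩
    13 ℕ.* (2 ℕ.* 2 ℕ.^ k) ∎
    where
    open ℕₚ.≤-Reasoning
    double : ∀ k → (1 ℕ.+ k) ℕ.* (1 ℕ.+ k) ℕ.* (1 ℕ.+ k) ℕ.+ (3 ℕ.* ((1 ℕ.+ k) ℕ.* (1 ℕ.+ k)) ℕ.+ 9 ℕ.* (1 ℕ.+ k) ℕ.+ 13) ℕ.+ k ℕ.* k ℕ.* k
      ≡ 2 ℕ.* (k ℕ.* k ℕ.* k ℕ.+ (3 ℕ.* (k ℕ.* k) ℕ.+ 9 ℕ.* k ℕ.+ 13))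
    double = ℕ-Solver.solve-∀
    swap : ∀ z → 2 ℕ.* (13 ℕ.* z) ≡ 13 ℕ.* (2 ℕ.* z)
    swap = ℕ-Solver.solve-∀

-- With ℓ = log n, ℓ³ ≤ 13·2^ℓ ≤ 26n. As soon as ℓ ≥ 26D, which n ≥ 2^(26D) ensures, one of the
-- three factors ℓ pays for 26D.
log²-small : ∀ D → ∃ λ n₀ → ∀ n → n₀ ℕ.≤ n → D ℕ.* (logN n ℕ.* logN n) ℕ.≤ n
log²-small D = suc (2 ℕ.^ (26 ℕ.* D)) , bound
  where
  bound : ∀ n → suc (2 ℕ.^ (26 ℕ.* D)) ℕ.≤ n → D ℕ.* (logN n ℕ.* logN n) ℕ.≤ n
  bound n n₀≤n = ℕₚ.*-cancelˡ-≤ 26 (begin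
    26 ℕ.* (D ℕ.* (ℓ ℕ.* ℓ))   ≡⟨ lemma D ℓ ⟩
    ℓ ℕ.* ℓ ℕ.* (26 ℕ.* D)     ≤⟨ ℕₚ.*-monoʳ-≤ (ℓ ℕ.* ℓ) 26D≤ℓ ⟩
    ℓ ℕ.* ℓ ℕ.* ℓ              ≤⟨ cube≤2^ ℓ ⟩
    13 ℕ.* 2 ℕ.^ ℓ             ≤⟨ ℕₚ.*-monoʳ-≤ 13 (2^⌈log₂m⌉≤2m (ℕₚ.≤-trans (ℕ.s≤s ℕ.z≤n) n₀≤n)) ⟩
    13 ℕ.* (2 ℕ.* n)           ≡⟨ sym (ℕₚ.*-assoc 13 2 n) ⟩
    26 ℕ.* n                   ∎)
    where
    open ℕₚ.≤-Reasoning
    ℓ : ℕ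
    ℓ = logN n
    26D≤ℓ : 26 ℕ.* D ℕ.≤ ℓ
    26D≤ℓ = subst (ℕ._≤ ℓ) (⌈log₂2^n⌉≡n (26 ℕ.* D)) (⌈log₂⌉-mono-≤ (ℕₚ.≤-trans (ℕₚ.n≤1+n (2 ℕ.^ (26 ℕ.* D))) n₀≤n))
    lemma : ∀ D ℓ → 26 ℕ.* (D ℕ.* (ℓ ℕ.* ℓ)) ≡ ℓ ℕ.* ℓ ℕ.* (26 ℕ.* D)
    lemma = ℕ-Solver.solve-∀

powerOfTwo : ∀ {m} → 0 ℕ.< m → ∃ λ j → m ℕ.≤ 2 ℕ.^ j × 2 ℕ.^ j ℕ.≤ 2 ℕ.* m
powerOfTwo {m} 0<m = ⌈log₂ m ⌉ , m≤2^⌈log₂m⌉ m , 2^⌈log₂m⌉≤2m 0<m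

-- 1 - ρ^m is (1 - ρ) times a geometric sum of m terms, each at least ρ^m. This makes ρ^K as small
-- as desired for an explicit K.
geometric-decay : ∀ {ρ} → 0ℚ ≤ ρ → ρ ≤ 1ℚ → ∀ m → ℕ→ℚ m * (1ℚ - ρ) * ρ ^ m ≤ 1ℚ - ρ ^ m
geometric-decay {ρ} 0≤ρ ρ≤1 zero = ≤-reflexive (lemma ρ)
  where
  lemma : ∀ ρ → 0ℚ * (1ℚ - ρ) * 1ℚ ≡ 1ℚ - 1ℚ
  lemma = solve-∀ ℚ-ring
geometric-decay {ρ} 0≤ρ ρ≤1 (suc m) = begin
  ℕ→ℚ (suc m) * (1ℚ - ρ) * (ρ * ρ ^ m)
    ≡⟨ cong (λ k → k * (1ℚ - ρ) * (ρ * ρ ^ m)) (ℕ→ℚ-suc m) ⟩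
  (1ℚ + ℕ→ℚ m) * (1ℚ - ρ) * (ρ * ρ ^ m)
    ≡⟨ split (ℕ→ℚ m) ρ (ρ ^ m) ⟩
  ρ * (ℕ→ℚ m * (1ℚ - ρ) * ρ ^ m) + (1ℚ - ρ) * (ρ * ρ ^ m)
    ≤⟨ +-monoˡ-≤ ((1ℚ - ρ) * (ρ * ρ ^ m)) (*-monoˡ-≤ 0≤ρ (geometric-decay 0≤ρ ρ≤1 m)) ⟩
  ρ * (1ℚ - ρ ^ m) + (1ℚ - ρ) * (ρ * ρ ^ m)
    ≤⟨ p≤p+q (*-nonNeg (≤⇒0≤- ρ≤1) (≤⇒0≤- (^-antimono-≤ {j = 0} {suc m} 0≤ρ ρ≤1 ℕ.z≤n))) ⟩
  ρ * (1ℚ - ρ ^ m) + (1ℚ - ρ) * (ρ * ρ ^ m) + (1ℚ - ρ) * (1ℚ - ρ * ρ ^ m)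
    ≡⟨ collect ρ (ρ ^ m) ⟩
  1ℚ - ρ * ρ ^ m ∎
  where
  open ≤-Reasoning
  split : ∀ m ρ p → (1ℚ + m) * (1ℚ - ρ) * (ρ * p) ≡ ρ * (m * (1ℚ - ρ) * p) + (1ℚ - ρ) * (ρ * p)
  split = solve-∀ ℚ-ring
  collect : ∀ ρ p → ρ * (1ℚ - p) + (1ℚ - ρ) * (ρ * p) + (1ℚ - ρ) * (1ℚ - ρ * p) ≡ 1ℚ - ρ * p
  collect = solve-∀ ℚ-ring

8ℚ : ℚ
8ℚ = 2ℚ * (2ℚ * 2ℚ)

-- n³ ≤ 8^ℓ for ℓ = log n, and the condition on `K` gives 8ρ^K ≤ 1, so each unit of ℓ contributes a
-- factor at most one.
n³ρ^[K*logn]≤1 : ∀ {ρ} → 0ℚ ≤ ρ → ρ ≤ 1ℚ → ∀ {K} → 8ℚ ≤ ℕ→ℚ K * (1ℚ - ρ) → ∀ n →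
  ℕ→ℚ n * (ℕ→ℚ n * ℕ→ℚ n) * ρ ^ (K ℕ.* logN n) ≤ 1ℚ
n³ρ^[K*logn]≤1 {ρ} 0≤ρ ρ≤1 {K} 8≤K[1-ρ] n = begin
  ℕ→ℚ n * (ℕ→ℚ n * ℕ→ℚ n) * ρ ^ (K ℕ.* ℓ)
    ≤⟨ *-monoʳ-≤ (^-nonNeg (K ℕ.* ℓ) 0≤ρ) (*-mono-≤ 0≤n n≤2^ℓ (*-nonNeg 0≤n 0≤n) (*-mono-≤ 0≤n n≤2^ℓ 0≤n n≤2^ℓ)) ⟩
  2ℚ ^ ℓ * (2ℚ ^ ℓ * 2ℚ ^ ℓ) * ρ ^ (K ℕ.* ℓ)
    ≡⟨ cong₂ _*_ (trans (cong (2ℚ ^ ℓ *_) (sym (^-distrib-* 2ℚ 2ℚ ℓ))) (sym (^-distrib-* 2ℚ (2ℚ * 2ℚ) ℓ))) (sym (^-assocʳ ρ K ℓ)) ⟩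
  8ℚ ^ ℓ * (ρ ^ K) ^ ℓ
    ≡⟨ sym (^-distrib-* 8ℚ (ρ ^ K) ℓ) ⟩
  (8ℚ * ρ ^ K) ^ ℓ
    ≤⟨ ^-mono-≤ ℓ (*-nonNeg (nonNegative⁻¹ 8ℚ) (^-nonNeg K 0≤ρ)) 8ρ^K≤1 ⟩
  1ℚ ^ ℓ
    ≡⟨ 1^k≡1 ℓ ⟩
  1ℚ ∎
  where
  open ≤-Reasoning
  ℓ : ℕ
  ℓ = logN n
  0≤n : 0ℚ ≤ ℕ→ℚ n
  0≤n = 0≤ℕ→ℚ n
  n≤2^ℓ : ℕ→ℚ n ≤ 2ℚ ^ ℓ
  n≤2^ℓ = ≤-trans (ℕ→ℚ-mono-≤ (m≤2^⌈log₂m⌉ n)) (≤-reflexive (ℕ→ℚ-^ 2 ℓ))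
  8ρ^K≤1 : 8ℚ * ρ ^ K ≤ 1ℚ
  8ρ^K≤1 = begin
    8ℚ * ρ ^ K                      ≤⟨ *-monoʳ-≤ (^-nonNeg K 0≤ρ) 8≤K[1-ρ] ⟩
    ℕ→ℚ K * (1ℚ - ρ) * ρ ^ K        ≤⟨ geometric-decay 0≤ρ ρ≤1 K ⟩
    1ℚ - ρ ^ K                      ≤⟨ p≤p+q (^-nonNeg K 0≤ρ) ⟩
    1ℚ - ρ ^ K + ρ ^ K              ≡⟨ lemma (ρ ^ K) ⟩
    1ℚ                              ∎
    where
    lemma : ∀ z → 1ℚ - z + z ≡ 1ℚ
    lemma = solve-∀ ℚ-ring

halfPow-double : ∀ r k → halfPow r (k ℕ.+ k) ≡ r ^ k
halfPow-double r zero = refl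
halfPow-double r (suc k) = trans (cong (halfPow r ∘ suc) (ℕₚ.+-suc k k)) (cong (r *_) (halfPow-double r k))

-- The separating polynomial

-- The constants satisfy c < μ < α < ¼ and κ = 1/α, and each gap has a use. Between `c` and `μ`,
-- quantified by `L`: replacing the class size s by s - 1. Between `μ` and `α`, quantified by `K`:
-- the decay of (μ/α)^m against n³. Between `α` and ¼, quantified by `D`: room for the error weights
-- of the loop inequality.
module Separator {c μ α κ : ℚ} {K L D : ℕ}
  (c≤1 : c ≤ 1ℚ) (0<μ : 0ℚ < μ) (μ≤½ : μ ≤ ½) (μ≤α : μ ≤ α) (κα≡1 : κ * α ≡ 1ℚ) (0<κ : 0ℚ < κ)
  (0<γ : 0ℚ < ½ * ½ - α) (γ≤α : ½ * ½ - α ≤ α)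
  (0<K : 0 ℕ.< K) (8≤K[1-μκ] : 8ℚ ≤ ℕ→ℚ K * (1ℚ - μ * κ))
  (0<L : 0 ℕ.< L) (1≤L[μ-c] : 1ℚ ≤ ℕ→ℚ L * (μ - c))
  ([8K]²≤Dγ² : ℕ→ℚ (8 ℕ.* K ℕ.* (8 ℕ.* K)) ≤ ℕ→ℚ D * ((½ * ½ - α) * (½ * ½ - α))) where

  private
    γ ρ : ℚ
    γ = ½ * ½ - α
    ρ = μ * κ

    0≤γ : 0ℚ ≤ γ
    0≤γ = <⇒≤ 0<γ

    α≤1 : α ≤ 1ℚ
    α≤1 = ≤-trans (0≤-⇒≤ 0≤γ) (toWitness {a? = ½ * ½ ≤? 1ℚ} _)

    γ≤1 : γ ≤ 1ℚ
    γ≤1 = ≤-trans γ≤α α≤1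

    0≤ρ : 0ℚ ≤ ρ
    0≤ρ = *-nonNeg (<⇒≤ 0<μ) (<⇒≤ 0<κ)

    ρ≤1 : ρ ≤ 1ℚ
    ρ≤1 = ≤-trans (*-monoʳ-≤ (<⇒≤ 0<κ) μ≤α) (≤-reflexive (trans (*-comm α κ) κα≡1))

  -- μ(s - 1)² exceeds cs² by s(s(μ - c) - 1) + (1 - 2μ)s + μ. The first summand is nonnegative once
  -- s ≥ L, which follows from L² ≤ n ≤ cs² ≤ s²; the others are so because 0 < μ ≤ ½.
  n≤μ[s-1]² : ∀ {n s} → L ℕ.* L ℕ.≤ n → 0ℚ ≤ s → ℕ→ℚ n ≤ c * (s * s) → 0ℚ < s × ℕ→ℚ n ≤ μ * ((s - 1ℚ) * (s - 1ℚ))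
  n≤μ[s-1]² {n} {s} L²≤n 0≤s n≤cs² = <-≤-trans (0<ℕ→ℚ 0<L) L≤s , (begin
    ℕ→ℚ n
      ≤⟨ n≤cs² ⟩
    c * (s * s)
      ≤⟨ p≤p+q (+-nonNeg (+-nonNeg (*-nonNeg 0≤s (≤⇒0≤- 1≤s[μ-c])) (*-nonNeg 0≤1-2μ 0≤s)) (<⇒≤ 0<μ)) ⟩
    c * (s * s) + (s * (s * (μ - c) - 1ℚ) + (1ℚ - 2ℚ * μ) * s + μ)
      ≡⟨ complete c μ s ⟩
    μ * ((s - 1ℚ) * (s - 1ℚ)) ∎)
    where
    open ≤-Reasoning
    L≤s : ℕ→ℚ L ≤ s
    L≤s = square-cancel-≤ 0≤s (begin
      ℕ→ℚ L * ℕ→ℚ L     ≡⟨ sym (ℕ→ℚ-* L L) ⟩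
      ℕ→ℚ (L ℕ.* L)     ≤⟨ ℕ→ℚ-mono-≤ L²≤n ⟩
      ℕ→ℚ n             ≤⟨ n≤cs² ⟩
      c * (s * s)       ≤⟨ *-monoʳ-≤ (square-nonNeg s) c≤1 ⟩
      1ℚ * (s * s)      ≡⟨ *-identityˡ (s * s) ⟩
      s * s             ∎)
    0≤μ-c : 0ℚ ≤ μ - c
    0≤μ-c = *-cancelˡ-≤ (0<ℕ→ℚ 0<L) (≤-trans (≤-reflexive (*-zeroʳ (ℕ→ℚ L))) (≤-trans 0≤1 1≤L[μ-c]))
    1≤s[μ-c] : 1ℚ ≤ s * (μ - c)
    1≤s[μ-c] = ≤-trans 1≤L[μ-c] (*-monoʳ-≤ 0≤μ-c L≤s)
    0≤1-2μ : 0ℚ ≤ 1ℚ - 2ℚ * μ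
    0≤1-2μ = subst (0ℚ ≤_) (double μ) (*-nonNeg {2ℚ} {½ - μ} (nonNegative⁻¹ 2ℚ) (≤⇒0≤- μ≤½))
      where
      double : ∀ μ → 2ℚ * (½ - μ) ≡ 1ℚ - 2ℚ * μ
      double = solve-∀ ℚ-ring
    complete : ∀ c μ s → c * (s * s) + (s * (s * (μ - c) - 1ℚ) + (1ℚ - 2ℚ * μ) * s + μ) ≡ μ * ((s - 1ℚ) * (s - 1ℚ))
    complete = solve-∀ ℚ-ring

  -- The largest class satisfies n ≤ qs; squaring and inserting q² ≤ cn leaves a common factor n to
  -- cancel.
  largeClass : ∀ {n q} → 0 ℕ.< n → ℕ→ℚ (q ℕ.* q) ≤ c * ℕ→ℚ n → (X : Graph n) (colouring : Colorable n q X) →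
    ∃ λ k → ℕ→ℚ n ≤ c * (classSize X colouring k * classSize X colouring k)
  largeClass {n} {zero} 0<n _ X colouring = contradiction (proj₁ colouring (Fin.fromℕ< 0<n)) λ ()
  largeClass {n} {suc q-1} 0<n q²≤cn X colouring = k , *-cancelˡ-≤ {ℕ→ℚ n} (0<ℕ→ℚ 0<n) (begin
    ℕ→ℚ n * ℕ→ℚ n               ≤⟨ *-mono-≤ (0≤ℕ→ℚ n) n≤qs (0≤ℕ→ℚ n) n≤qs ⟩
    ℕ→ℚ q * s * (ℕ→ℚ q * s)     ≡⟨ regroup (ℕ→ℚ q) s ⟩
    ℕ→ℚ q * ℕ→ℚ q * (s * s)     ≡⟨ cong (_* (s * s)) (sym (ℕ→ℚ-* q q)) ⟩
    ℕ→ℚ (q ℕ.* q) * (s * s)     ≤⟨ *-monoʳ-≤ (square-nonNeg s) q²≤cn ⟩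
    c * ℕ→ℚ n * (s * s)         ≡⟨ reorder c (ℕ→ℚ n) (s * s) ⟩
    ℕ→ℚ n * (c * (s * s))       ∎)
    where
    open ≤-Reasoning
    q : ℕ
    q = suc q-1
    largest-class : ∃ λ k → ∑ (classSize X colouring) ≤ ℕ→ℚ q * classSize X colouring k
    largest-class = pigeonhole (classSize X colouring)
    k : Fin q
    k = proj₁ largest-class
    s : ℚ
    s = classSize X colouring k
    n≤qs : ℕ→ℚ n ≤ ℕ→ℚ q * s
    n≤qs = ≤-trans (≤-reflexive (sym (∑-classSize X colouring))) (proj₂ largest-class)
    regroup : ∀ q s → q * s * (q * s) ≡ q * q * (s * s)
    regroup = solve-∀ ℚ-ring
    reorder : ∀ c n t → c * n * t ≡ n * (c * t)
    reorder = solve-∀ ℚ-ring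

  tr-signal : ∀ {n q} → 0 ℕ.< n → L ℕ.* L ℕ.≤ n → ℕ→ℚ (q ℕ.* q) ≤ c * ℕ→ℚ n → (X : Graph n) → Colorable n q X →
    ∀ {τ} → 0ℚ ≤ τ → μ * τ ≤ ℕ→ℚ n → ∀ j → τ ^ (2 ℕ.^ j) ≤ tr (P {n} X (2 ℕ.^ j ℕ.+ 2 ℕ.^ j))
  tr-signal {n} {q} 0<n L²≤n q²≤cn X colouring {τ} 0≤τ μτ≤n = tr-lower-bound (adj {n} X) (adj-symmetric X) v (subst (0ℚ <_) (sym |v|²≡s) 0<s) 0≤τ (begin
    ∑-square v * τ                    ≡⟨ cong (_* τ) |v|²≡s ⟩
    s * τ                             ≤⟨ *-monoˡ-≤ (<⇒≤ 0<s) (*-cancelˡ-≤ {μ} 0<μ (≤-trans μτ≤n (proj₂ s-large))) ⟩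
    s * ((s - 1ℚ) * (s - 1ℚ))         ≤⟨ ∑-square-adj-▸ X colouring k ⟩
    ∑-square (adj {n} X ▸ v)          ∎)
    where
    open ≤-Reasoning
    k : Fin q
    k = proj₁ (largeClass {n} {q} 0<n q²≤cn X colouring)
    v : Fin n → ℚ
    v = indicator X colouring k
    s : ℚ
    s = classSize X colouring k
    s-large : 0ℚ < s × ℕ→ℚ n ≤ μ * ((s - 1ℚ) * (s - 1ℚ))
    s-large = n≤μ[s-1]² {n} {s} L²≤n (∑-nonNeg {f = v} (λ i → 0≤δ (proj₁ colouring i) k)) (proj₂ (largeClass {n} {q} 0<n q²≤cn X colouring))
    0<s : 0ℚ < s
    0<s = proj₁ s-large
    |v|²≡s : ∑-square v ≡ s
    |v|²≡s = ∑-square-indicator X colouring k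

  -- 2 ≤ n makes log n positive, hence also the exponent; the second condition serves the signal and
  -- the third the bound on the noise. All three hold eventually, and they are decidable, so the
  -- polynomial can be defined by cases.
  Large : ℕ → Set
  Large n = 2 ℕ.≤ n × L ℕ.* L ℕ.≤ n × D ℕ.* (logN n ℕ.* logN n) ℕ.≤ n

  large? : ∀ n → Dec (Large n)
  large? n = (2 ℕₚ.≤? n) ×-dec ((L ℕ.* L ℕₚ.≤? n) ×-dec (D ℕ.* (logN n ℕ.* logN n) ℕₚ.≤? n))

  module AtSize {n : ℕ} (large : Large n) where

    private
      2≤n : 2 ℕ.≤ n
      2≤n = proj₁ large

      0<n : 0 ℕ.< n
      0<n = ℕₚ.≤-trans (ℕ.s≤s ℕ.z≤n) 2≤n

      0<n′ : 0ℚ < ℕ→ℚ n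
      0<n′ = 0<ℕ→ℚ 0<n

      ℓ : ℕ
      ℓ = logN n

      exponent : ∃ λ j → K ℕ.* ℓ ℕ.≤ 2 ℕ.^ j × 2 ℕ.^ j ℕ.≤ 2 ℕ.* (K ℕ.* ℓ)
      exponent = powerOfTwo (ℕₚ.*-mono-≤ 0<K (⌈log₂⌉-mono-≤ 2≤n))

      j m M : ℕ
      j = proj₁ exponent
      m = 2 ℕ.^ j
      -- Twice the length m + m of the trace in `polynomial`, bracketed as `tr²` and
      -- `halfPow-double` produce it.
      M = m ℕ.+ m ℕ.+ (m ℕ.+ m)

      Kℓ≤m : K ℕ.* ℓ ℕ.≤ m
      Kℓ≤m = proj₁ (proj₂ exponent)

      m≤2Kℓ : m ℕ.≤ 2 ℕ.* (K ℕ.* ℓ)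
      m≤2Kℓ = proj₂ (proj₂ exponent)

      n⁻¹ u r : ℚ
      n⁻¹ = proj₁ (reciprocal 0<n′)
      -- The inverse of the signal level n/μ, so that the signal is normalised to one; `r` is the
      -- noise level n/α.
      u = μ * n⁻¹
      r = ℕ→ℚ n * κ

      0≤n⁻¹ : 0ℚ ≤ n⁻¹
      0≤n⁻¹ = <⇒≤ (proj₁ (proj₂ (reciprocal 0<n′)))

      n⁻¹n≡1 : n⁻¹ * ℕ→ℚ n ≡ 1ℚ
      n⁻¹n≡1 = proj₂ (proj₂ (reciprocal 0<n′))

      0≤u : 0ℚ ≤ u
      0≤u = *-nonNeg (<⇒≤ 0<μ) 0≤n⁻¹

    polynomial : Poly (N n)
    polynomial = mulTerm (u ^ m , []) (trᴾ {n} (m ℕ.+ m))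

    eval-polynomial : ∀ X → evalPM polynomial X ≡ u ^ m * tr (P {n} X (m ℕ.+ m))
    eval-polynomial X = trans (eval-mulTerm (sign ∘ X) (u ^ m) [] (trᴾ {n} (m ℕ.+ m))) (cong₂ _*_ (*-identityʳ (u ^ m)) (eval-trᴾ {n} (m ℕ.+ m) X))

    degree-polynomial : degree polynomial ℕ.≤ 4 ℕ.* K ℕ.* ℓ
    degree-polynomial = begin
      degree polynomial                                  ≤⟨ degree-mulTerm {a = 0} (u ^ m) [] (trᴾ {n} (m ℕ.+ m)) ℕ.z≤n (degree-trᴾ {n} (m ℕ.+ m)) ⟩
      m ℕ.+ m                                            ≤⟨ ℕₚ.+-mono-≤ m≤2Kℓ m≤2Kℓ ⟩
      2 ℕ.* (K ℕ.* ℓ) ℕ.+ 2 ℕ.* (K ℕ.* ℓ)                ≡⟨ lemma K ℓ ⟩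
      4 ℕ.* K ℕ.* ℓ                                      ∎
      where
      open ℕₚ.≤-Reasoning
      lemma : ∀ K ℓ → 2 ℕ.* (K ℕ.* ℓ) ℕ.+ 2 ℕ.* (K ℕ.* ℓ) ≡ 4 ℕ.* K ℕ.* ℓ
      lemma = ℕ-Solver.solve-∀

    polynomial≥1 : ∀ {q} → ℕ→ℚ (q ℕ.* q) ≤ c * ℕ→ℚ n → ∀ X → Colorable n q X → 1ℚ ≤ evalPM polynomial X
    polynomial≥1 q²≤cn X colouring = begin
      1ℚ                                 ≡⟨ sym (1^k≡1 m) ⟩
      1ℚ ^ m                             ≡⟨ cong (_^ m) (sym uτ≡1) ⟩
      (u * τ) ^ m                        ≡⟨ ^-distrib-* u τ m ⟩
      u ^ m * τ ^ m                      ≤⟨ *-monoˡ-≤ (^-nonNeg m 0≤u) (tr-signal 0<n (proj₁ (proj₂ large)) q²≤cn X colouring 0≤τ (≤-reflexive μτ≡n) j) ⟩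
      u ^ m * tr (P {n} X (m ℕ.+ m))     ≡⟨ sym (eval-polynomial X) ⟩
      evalPM polynomial X                ∎
      where
      open ≤-Reasoning
      μ⁻¹ τ : ℚ
      μ⁻¹ = proj₁ (reciprocal 0<μ)
      τ = ℕ→ℚ n * μ⁻¹
      0≤τ : 0ℚ ≤ τ
      0≤τ = *-nonNeg (0≤ℕ→ℚ n) (<⇒≤ (proj₁ (proj₂ (reciprocal 0<μ))))
      μτ≡n : μ * τ ≡ ℕ→ℚ n
      μτ≡n = trans (lemma μ (ℕ→ℚ n) μ⁻¹) (trans (cong (ℕ→ℚ n *_) (proj₂ (proj₂ (reciprocal 0<μ)))) (*-identityʳ (ℕ→ℚ n)))
        where
        lemma : ∀ μ n i → μ * (n * i) ≡ n * (i * μ)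
        lemma = solve-∀ ℚ-ring
      uτ≡1 : u * τ ≡ 1ℚ
      uτ≡1 = trans (lemma μ n⁻¹ τ) (trans (cong (n⁻¹ *_) μτ≡n) n⁻¹n≡1)
        where
        lemma : ∀ μ i τ → μ * i * τ ≡ i * (μ * τ)
        lemma = solve-∀ ℚ-ring

    private
      0<M : 0 ℕ.< M
      0<M = ℕₚ.<-≤-trans (ℕₚ.m^n>0 2 j) (ℕₚ.≤-trans (ℕₚ.m≤m+n m m) (ℕₚ.m≤m+n (m ℕ.+ m) (m ℕ.+ m)))

      0<M′ : 0ℚ < ℕ→ℚ M
      0<M′ = 0<ℕ→ℚ 0<M

      M⁻¹ θ : ℚ
      M⁻¹ = proj₁ (reciprocal 0<M′)
      -- The room γ below ¼ is spread evenly over the lengths 1 to M.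
      θ = γ * M⁻¹

      0≤M⁻¹ : 0ℚ ≤ M⁻¹
      0≤M⁻¹ = <⇒≤ (proj₁ (proj₂ (reciprocal 0<M′)))

      M⁻¹M≡1 : M⁻¹ * ℕ→ℚ M ≡ 1ℚ
      M⁻¹M≡1 = proj₂ (proj₂ (reciprocal 0<M′))

      Mθ≡γ : ℕ→ℚ M * θ ≡ γ
      Mθ≡γ = trans (lemma (ℕ→ℚ M) γ M⁻¹) (trans (cong (γ *_) M⁻¹M≡1) (*-identityʳ γ))
        where
        lemma : ∀ M g i → M * (g * i) ≡ g * (i * M)
        lemma = solve-∀ ℚ-ring

      0≤θ : 0ℚ ≤ θ
      0≤θ = *-nonNeg 0≤γ 0≤M⁻¹

      θ≤α : θ ≤ α
      θ≤α = ≤-trans (begin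
        θ             ≡⟨ sym (*-identityˡ θ) ⟩
        1ℚ * θ        ≤⟨ *-monoʳ-≤ 0≤θ (1≤ℕ→ℚ 0<M) ⟩
        ℕ→ℚ M * θ     ≡⟨ Mθ≡γ ⟩
        γ             ∎) γ≤α
        where open ≤-Reasoning

      small : α + ℕ→ℚ M * θ ≤ ½ * ½
      small = ≤-reflexive (trans (cong (α +_) Mθ≡γ) (lemma α (½ * ½)))
        where
        lemma : ∀ a b → a + (b - a) ≡ b
        lemma = solve-∀ ℚ-ring

      0≤r : 0ℚ ≤ r
      0≤r = *-nonNeg (0≤ℕ→ℚ n) (<⇒≤ 0<κ)

      rα≡n : r * α ≡ ℕ→ℚ n
      rα≡n = trans (*-assoc (ℕ→ℚ n) κ α) (trans (cong (ℕ→ℚ n *_) κα≡1) (*-identityʳ (ℕ→ℚ n)))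

      n≤r : ℕ→ℚ n ≤ r
      n≤r = ≤-trans (≤-reflexive (sym rα≡n)) (≤-trans (*-monoˡ-≤ 0≤r α≤1) (≤-reflexive (*-identityʳ r)))

      -- M = 4m ≤ 8K log n, and `D` was chosen to turn this into M² ≤ nγ². Since Mθ = γ, both
      -- remaining conditions on θ are this inequality divided by M or by M².
      M²≤rγ² : ℕ→ℚ M * ℕ→ℚ M ≤ r * (γ * γ)
      M²≤rγ² = begin
        ℕ→ℚ M * ℕ→ℚ M                                   ≡⟨ sym (ℕ→ℚ-* M M) ⟩
        ℕ→ℚ (M ℕ.* M)                                   ≤⟨ ℕ→ℚ-mono-≤ (ℕₚ.*-mono-≤ M≤8Kℓ M≤8Kℓ) ⟩
        ℕ→ℚ (8 ℕ.* K ℕ.* ℓ ℕ.* (8 ℕ.* K ℕ.* ℓ))         ≡⟨ cong ℕ→ℚ (regroup (8 ℕ.* K) ℓ) ⟩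
        ℕ→ℚ (8 ℕ.* K ℕ.* (8 ℕ.* K) ℕ.* (ℓ ℕ.* ℓ))       ≡⟨ ℕ→ℚ-* (8 ℕ.* K ℕ.* (8 ℕ.* K)) (ℓ ℕ.* ℓ) ⟩
        ℕ→ℚ (8 ℕ.* K ℕ.* (8 ℕ.* K)) * ℕ→ℚ (ℓ ℕ.* ℓ)     ≤⟨ *-monoʳ-≤ (0≤ℕ→ℚ (ℓ ℕ.* ℓ)) [8K]²≤Dγ² ⟩
        ℕ→ℚ D * (γ * γ) * ℕ→ℚ (ℓ ℕ.* ℓ)                 ≡⟨ reorder (ℕ→ℚ D) (γ * γ) (ℕ→ℚ (ℓ ℕ.* ℓ)) ⟩
        ℕ→ℚ D * ℕ→ℚ (ℓ ℕ.* ℓ) * (γ * γ)                 ≡⟨ cong (_* (γ * γ)) (sym (ℕ→ℚ-* D (ℓ ℕ.* ℓ))) ⟩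
        ℕ→ℚ (D ℕ.* (ℓ ℕ.* ℓ)) * (γ * γ)                 ≤⟨ *-monoʳ-≤ (square-nonNeg γ) (≤-trans (ℕ→ℚ-mono-≤ (proj₂ (proj₂ large))) n≤r) ⟩
        r * (γ * γ)                                     ∎
        where
        open ≤-Reasoning
        regroup : ∀ k ℓ → k ℕ.* ℓ ℕ.* (k ℕ.* ℓ) ≡ k ℕ.* k ℕ.* (ℓ ℕ.* ℓ)
        regroup = ℕ-Solver.solve-∀
        reorder : ∀ d g l → d * g * l ≡ d * l * g
        reorder = solve-∀ ℚ-ring
        double : ∀ K ℓ → 2 ℕ.* (K ℕ.* ℓ) ℕ.+ 2 ℕ.* (K ℕ.* ℓ) ℕ.+ (2 ℕ.* (K ℕ.* ℓ) ℕ.+ 2 ℕ.* (K ℕ.* ℓ)) ≡ 8 ℕ.* K ℕ.* ℓ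
        double = ℕ-Solver.solve-∀
        M≤8Kℓ : M ℕ.≤ 8 ℕ.* K ℕ.* ℓ
        M≤8Kℓ = ℕₚ.≤-trans (ℕₚ.+-mono-≤ (ℕₚ.+-mono-≤ m≤2Kℓ m≤2Kℓ) (ℕₚ.+-mono-≤ m≤2Kℓ m≤2Kℓ)) (ℕₚ.≤-reflexive (double K ℓ))

      M≤rθ : ℕ→ℚ M ≤ r * θ
      M≤rθ = *-cancelˡ-≤ 0<M′ (begin
        ℕ→ℚ M * ℕ→ℚ M     ≤⟨ M²≤rγ² ⟩
        r * (γ * γ)       ≤⟨ *-monoˡ-≤ 0≤r (≤-trans (*-monoˡ-≤ 0≤γ γ≤1) (≤-reflexive (*-identityʳ γ))) ⟩
        r * γ             ≡⟨ cong (r *_) (sym Mθ≡γ) ⟩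
        r * (ℕ→ℚ M * θ)   ≡⟨ lemma r (ℕ→ℚ M) θ ⟩
        ℕ→ℚ M * (r * θ)   ∎)
        where
        open ≤-Reasoning
        lemma : ∀ r M t → r * (M * t) ≡ M * (r * t)
        lemma = solve-∀ ℚ-ring

      1≤rθθ : 1ℚ ≤ r * θ * θ
      1≤rθθ = *-cancelˡ-≤ (*-pos 0<M′ 0<M′) (begin
        ℕ→ℚ M * ℕ→ℚ M * 1ℚ                  ≡⟨ *-identityʳ (ℕ→ℚ M * ℕ→ℚ M) ⟩
        ℕ→ℚ M * ℕ→ℚ M                       ≤⟨ M²≤rγ² ⟩
        r * (γ * γ)                         ≡⟨ cong (λ g → r * (g * g)) (sym Mθ≡γ) ⟩
        r * (ℕ→ℚ M * θ * (ℕ→ℚ M * θ))       ≡⟨ lemma r (ℕ→ℚ M) θ ⟩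
        ℕ→ℚ M * ℕ→ℚ M * (r * θ * θ)         ∎)
        where
        open ≤-Reasoning
        lemma : ∀ r M t → r * (M * t * (M * t)) ≡ M * M * (r * t * t)
        lemma = solve-∀ ℚ-ring

    -- Of the three factors n, one comes from `tr²`, one from the extra `r` in `F-trace-bound`, and
    -- one is put in by hand to make the second moment O(1/n).
    second-moment : ℕ→ℚ n * E-G-sq n polynomial ≤ κ * ½
    second-moment = begin
      ℕ→ℚ n * E-G-sq n polynomial
        ≤⟨ *-monoˡ-≤ (0≤ℕ→ℚ n) (Exp-mono-≤ (N n) pointwise) ⟩
      ℕ→ℚ n * Exp (N n) (λ X → u ^ m * u ^ m * ℕ→ℚ n * trs {n} X (M ∷ []))
        ≡⟨ cong (ℕ→ℚ n *_) (Exp-*ˡ (N n) (u ^ m * u ^ m * ℕ→ℚ n) (λ X → trs {n} X (M ∷ []))) ⟩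
      ℕ→ℚ n * (u ^ m * u ^ m * ℕ→ℚ n * F {n} (M ∷ []))
        ≤⟨ *-monoˡ-≤ (0≤ℕ→ℚ n) (*-monoˡ-≤ (*-nonNeg (square-nonNeg (u ^ m)) (0≤ℕ→ℚ n)) (F-trace-bound {n} {M} 0≤r 0≤θ θ≤α small (≤-reflexive (sym rα≡n)) M≤rθ 1≤rθθ)) ⟩
      ℕ→ℚ n * (u ^ m * u ^ m * ℕ→ℚ n * (halfPow r M * (r * ½)))
        ≡⟨ cong (λ z → ℕ→ℚ n * (u ^ m * u ^ m * ℕ→ℚ n * (z * (r * ½)))) (trans (halfPow-double r (m ℕ.+ m)) (^-homo-* r m m)) ⟩
      ℕ→ℚ n * (u ^ m * u ^ m * ℕ→ℚ n * (r ^ m * r ^ m * (r * ½)))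
        ≡⟨ regroup (ℕ→ℚ n) (u ^ m) (r ^ m) κ ⟩
      ℕ→ℚ n * (ℕ→ℚ n * ℕ→ℚ n) * (κ * ½) * (u ^ m * r ^ m) * (u ^ m * r ^ m)
        ≡⟨ cong (λ z → ℕ→ℚ n * (ℕ→ℚ n * ℕ→ℚ n) * (κ * ½) * z * z) (trans (sym (^-distrib-* u r m)) (cong (_^ m) ur≡ρ)) ⟩
      ℕ→ℚ n * (ℕ→ℚ n * ℕ→ℚ n) * (κ * ½) * ρ ^ m * ρ ^ m
        -- One factor ρ^m is enough against n³; the other is bounded by one.
        ≤⟨ *-mono-≤ (*-nonNeg 0≤n³κ/2 0≤ρ^m) (*-monoˡ-≤ 0≤n³κ/2 (^-antimono-≤ 0≤ρ ρ≤1 Kℓ≤m)) 0≤ρ^m (^-antimono-≤ {ρ} {0} {m} 0≤ρ ρ≤1 ℕ.z≤n) ⟩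
      ℕ→ℚ n * (ℕ→ℚ n * ℕ→ℚ n) * (κ * ½) * ρ ^ (K ℕ.* ℓ) * 1ℚ
        ≡⟨ reorder (ℕ→ℚ n * (ℕ→ℚ n * ℕ→ℚ n)) (κ * ½) (ρ ^ (K ℕ.* ℓ)) ⟩
      ℕ→ℚ n * (ℕ→ℚ n * ℕ→ℚ n) * ρ ^ (K ℕ.* ℓ) * (κ * ½)
        ≤⟨ *-monoʳ-≤ 0≤κ/2 (n³ρ^[K*logn]≤1 0≤ρ ρ≤1 {K} 8≤K[1-μκ] n) ⟩
      1ℚ * (κ * ½)
        ≡⟨ *-identityˡ (κ * ½) ⟩
      κ * ½ ∎
      where
      open ≤-Reasoning
      0≤κ/2 : 0ℚ ≤ κ * ½
      0≤κ/2 = *-nonNeg (<⇒≤ 0<κ) (nonNegative⁻¹ ½)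
      0≤n³κ/2 : 0ℚ ≤ ℕ→ℚ n * (ℕ→ℚ n * ℕ→ℚ n) * (κ * ½)
      0≤n³κ/2 = *-nonNeg (*-nonNeg (0≤ℕ→ℚ n) (square-nonNeg (ℕ→ℚ n))) 0≤κ/2
      0≤ρ^m : 0ℚ ≤ ρ ^ m
      0≤ρ^m = ^-nonNeg m 0≤ρ
      square : ∀ w t → w * t * (w * t) ≡ w * w * (t * t)
      square = solve-∀ ℚ-ring
      finish : ∀ w n t → w * (n * t) ≡ w * n * (t * 1ℚ)
      finish = solve-∀ ℚ-ring
      regroup : ∀ n w p κ → n * (w * w * n * (p * p * (n * κ * ½))) ≡ n * (n * n) * (κ * ½) * (w * p) * (w * p)
      regroup = solve-∀ ℚ-ring
      reorder : ∀ n k p → n * k * p * 1ℚ ≡ n * p * k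
      reorder = solve-∀ ℚ-ring
      ur≡ρ : u * r ≡ ρ
      ur≡ρ = trans (lemma μ n⁻¹ (ℕ→ℚ n) κ) (trans (cong (_* ρ) n⁻¹n≡1) (*-identityˡ ρ))
        where
        lemma : ∀ μ i n κ → μ * i * (n * κ) ≡ i * n * (μ * κ)
        lemma = solve-∀ ℚ-ring
      pointwise : ∀ X → evalPM polynomial X * evalPM polynomial X ≤ u ^ m * u ^ m * ℕ→ℚ n * trs {n} X (M ∷ [])
      pointwise X = begin
        evalPM polynomial X * evalPM polynomial X
          ≡⟨ cong (λ z → z * z) (eval-polynomial X) ⟩
        u ^ m * t * (u ^ m * t)
          ≡⟨ square (u ^ m) t ⟩
        u ^ m * u ^ m * (t * t)
          ≤⟨ *-monoˡ-≤ (square-nonNeg (u ^ m)) (tr² (adj {n} X) (adj-symmetric X) (m ℕ.+ m)) ⟩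
        u ^ m * u ^ m * (ℕ→ℚ n * tr (P {n} X M))
          ≡⟨ finish (u ^ m * u ^ m) (ℕ→ℚ n) (tr (P {n} X M)) ⟩
        u ^ m * u ^ m * ℕ→ℚ n * trs {n} X (M ∷ []) ∎
        where
        t : ℚ
        t = tr (P {n} X (m ℕ.+ m))

  -- For the remaining n the constant one has degree zero and is at least one on every graph; its
  -- second moment does not matter in the limit.
  separator : ∀ n → Dec (Large n) → Poly (N n)
  separator n (yes large) = AtSize.polynomial large
  separator n (no _) = (1ℚ , []) ∷ []

  degree-separator : ∀ n d → ℕ→ℚ (degree (separator n d)) ≤ ℕ→ℚ (4 ℕ.* K) * ℕ→ℚ (logN n)
  degree-separator n d = ≤-trans (ℕ→ℚ-mono-≤ (bound d)) (≤-reflexive (ℕ→ℚ-* (4 ℕ.* K) (logN n)))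
    where
    bound : ∀ d → degree (separator n d) ℕ.≤ 4 ℕ.* K ℕ.* logN n
    bound (yes large) = AtSize.degree-polynomial large
    bound (no _) = ℕ.z≤n

  separator≥1 : ∀ {n q} d → (0 ℕ.< n → ℕ→ℚ (q ℕ.* q) ≤ c * ℕ→ℚ n) → ∀ X → Colorable n q X → 1ℚ ≤ evalPM (separator n d) X
  separator≥1 (yes large) q²≤cn X colouring = AtSize.polynomial≥1 large (q²≤cn (ℕₚ.≤-trans (ℕ.s≤s ℕ.z≤n) (proj₁ large))) X colouring
  separator≥1 (no _) _ X _ = ≤-refl

  separator-o[1] : IsLittleO1 (λ n → E-G-sq n (separator n (large? n)))
  separator-o[1] ε 0<ε = n₀ , λ n n₀≤n → bound n n₀≤n (large? n)
    where
    n₁ n₂ n₀ : ℕ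
    -- The second moment is at most κ/(2n), so n ≥ κ/(2ε) brings it below ε.
    n₁ = proj₁ (archimedean 0<ε (κ * ½))
    n₂ = proj₁ (log²-small D)
    n₀ = 2 ℕ.⊔ (L ℕ.* L ℕ.⊔ (n₁ ℕ.⊔ n₂))
    bound : ∀ n → n₀ ℕ.≤ n → (d : Dec (Large n)) → E-G-sq n (separator n d) ≤ ε
    bound n n₀≤n (no ¬large) = contradiction (2≤n , L²≤n , proj₂ (log²-small D) n n₂≤n) ¬large
      where
      2≤n : 2 ℕ.≤ n
      2≤n = ℕₚ.m⊔n≤o⇒m≤o 2 (L ℕ.* L ℕ.⊔ (n₁ ℕ.⊔ n₂)) n₀≤n
      rest : L ℕ.* L ℕ.⊔ (n₁ ℕ.⊔ n₂) ℕ.≤ n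
      rest = ℕₚ.m⊔n≤o⇒n≤o 2 (L ℕ.* L ℕ.⊔ (n₁ ℕ.⊔ n₂)) n₀≤n
      L²≤n : L ℕ.* L ℕ.≤ n
      L²≤n = ℕₚ.m⊔n≤o⇒m≤o (L ℕ.* L) (n₁ ℕ.⊔ n₂) rest
      n₂≤n : n₂ ℕ.≤ n
      n₂≤n = ℕₚ.m⊔n≤o⇒n≤o n₁ n₂ (ℕₚ.m⊔n≤o⇒n≤o (L ℕ.* L) (n₁ ℕ.⊔ n₂) rest)
    bound n n₀≤n (yes large) = *-cancelˡ-≤ {ℕ→ℚ n} (0<ℕ→ℚ {n} (ℕₚ.≤-trans (ℕ.s≤s ℕ.z≤n) (proj₁ large)))
      (≤-trans (AtSize.second-moment large) (≤-trans (proj₂ (archimedean 0<ε (κ * ½))) (*-monoʳ-≤ (<⇒≤ 0<ε) (ℕ→ℚ-mono-≤ n₁≤n))))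
      where
      n₁≤n : n₁ ℕ.≤ n
      n₁≤n = ℕₚ.m⊔n≤o⇒m≤o n₁ n₂ (ℕₚ.m⊔n≤o⇒n≤o (L ℕ.* L) (n₁ ℕ.⊔ n₂) (ℕₚ.m⊔n≤o⇒n≤o 2 (L ℕ.* L ℕ.⊔ (n₁ ℕ.⊔ n₂)) n₀≤n))

-- Choice of the constants and conclusion

archimedean⁺ : ∀ {p} → 0ℚ < p → ∀ q → ∃ λ k → 0 ℕ.< k × q ≤ ℕ→ℚ k * p
archimedean⁺ {p} 0<p q with archimedean 0<p q
... | k , q≤kp = suc k , ℕ.s≤s ℕ.z≤n , ≤-trans q≤kp (*-monoʳ-≤ (<⇒≤ 0<p) (ℕ→ℚ-mono-≤ (ℕₚ.n≤1+n k)))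

Separable : ℚ → Set
Separable b = Σ ℚ λ C → 0ℚ < C ×
    ((q : ℕ → ℕ) → ((n : ℕ) → LeBSqrt b (q n) n) →
    Σ ((n : ℕ) → Poly (N n)) λ f →
    ((n : ℕ) → ℕ→ℚ (degree (f n)) ≤ C * ℕ→ℚ (logN n))
    × StronglySeparates q f)

-- ⅛ is half of the critical value ¼: α ≥ ⅛ gives ¼ - α ≤ α, which is what θ ≤ α rests on. ⅜ is a
-- rational below ½ whose square 9/64 is still at least ⅛.
⅛ ⅜ : ℚ
⅛ = ℤ.+ 1 / 8
⅜ = ℤ.+ 3 / 8

-- `μ` and `α` come from density below ¼, and `K`, `L`, `D` from the Archimedean property applied to
-- the three gaps; none of them depends on n or on the sequence q.
separable : ∀ {b c} → (∀ {q n} → LeBSqrt b q n → 0 ℕ.< n → ℕ→ℚ (q ℕ.* q) ≤ c * ℕ→ℚ n) → ⅛ ≤ c → c < ½ * ½ → Separable b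
separable {b} {c} q²≤cn ⅛≤c c<¼ =
  case <-dense c<¼ of λ { (μ , c<μ , μ<¼) →
  case <-dense μ<¼ of λ { (α , μ<α , α<¼) →
  case reciprocal (0<α c<μ μ<α) of λ { (κ , 0<κ , κα≡1) →
  case archimedean⁺ (<⇒0<- (μκ<1 μ<α 0<κ κα≡1)) 8ℚ of λ { (K , 0<K , 8≤K[1-μκ]) →
  case archimedean⁺ (<⇒0<- c<μ) 1ℚ of λ { (L , 0<L , 1≤L[μ-c]) →
  case archimedean (*-pos (<⇒0<- α<¼) (<⇒0<- α<¼)) (ℕ→ℚ (8 ℕ.* K ℕ.* (8 ℕ.* K))) of λ { (D , [8K]²≤Dγ²) →
    withConstants {μ} {α} {κ} {K} {L} {D} c<μ μ<¼ μ<α α<¼ 0<κ κα≡1 0<K 8≤K[1-μκ] 0<L 1≤L[μ-c] [8K]²≤Dγ² }}}}}}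
  where
  0<⅛ : 0ℚ < ⅛
  0<⅛ = toWitness {a? = 0ℚ <? ⅛} _

  0<α : ∀ {μ α} → c < μ → μ < α → 0ℚ < α
  0<α c<μ μ<α = <-trans (<-≤-trans 0<⅛ ⅛≤c) (<-trans c<μ μ<α)

  μκ<1 : ∀ {μ α κ} → μ < α → 0ℚ < κ → κ * α ≡ 1ℚ → μ * κ < 1ℚ
  μκ<1 {μ} {α} {κ} μ<α 0<κ κα≡1 = subst (μ * κ <_) (trans (*-comm α κ) κα≡1) (*-monoˡ-<-pos κ {{positive 0<κ}} μ<α)

  withConstants : ∀ {μ α κ K L D} → c < μ → μ < ½ * ½ → μ < α → α < ½ * ½ → 0ℚ < κ → κ * α ≡ 1ℚ →
    0 ℕ.< K → 8ℚ ≤ ℕ→ℚ K * (1ℚ - μ * κ) → 0 ℕ.< L → 1ℚ ≤ ℕ→ℚ L * (μ - c) →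
    ℕ→ℚ (8 ℕ.* K ℕ.* (8 ℕ.* K)) ≤ ℕ→ℚ D * ((½ * ½ - α) * (½ * ½ - α)) → Separable b
  withConstants {μ} {α} {κ} {K} {L} {D} c<μ μ<¼ μ<α α<¼ 0<κ κα≡1 0<K 8≤K[1-μκ] 0<L 1≤L[μ-c] [8K]²≤Dγ² =
    -- The trace has length 2m with m ≤ 2K log n.
    ℕ→ℚ (4 ℕ.* K) , 0<ℕ→ℚ (ℕₚ.*-mono-≤ {1} {4} {1} {K} (ℕ.s≤s ℕ.z≤n) 0<K) , λ q q≤b√n →
      (λ n → separator n (large? n)) ,
      (λ n → degree-separator n (large? n)) ,
      (λ n X → separator≥1 {n} {q n} (large? n) (q²≤cn {q n} {n} (q≤b√n n)) X) ,
      separator-o[1]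
    where
    ⅛≤α : ⅛ ≤ α
    ⅛≤α = ≤-trans ⅛≤c (<⇒≤ (<-trans c<μ μ<α))

    γ≤α : ½ * ½ - α ≤ α
    γ≤α = ≤-trans (+-monoʳ-≤ (½ * ½) (neg-antimono-≤ ⅛≤α)) ⅛≤α

    open Separator {c} {μ} {α} {κ} {K} {L} {D}
      (≤-trans (<⇒≤ c<¼) (toWitness {a? = ½ * ½ ≤? 1ℚ} _))
      (<-trans (<-≤-trans 0<⅛ ⅛≤c) c<μ)
      (≤-trans (<⇒≤ μ<¼) (toWitness {a? = ½ * ½ ≤? ½} _))
      (<⇒≤ μ<α) κα≡1 0<κ (<⇒0<- α<¼) γ≤α 0<K 8≤K[1-μκ] 0<L 1≤L[μ-c] [8K]²≤Dγ²

theorem2p17 : (b : ℚ) → b < ½ →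
    Σ ℚ λ C → 0ℚ < C ×
    ((q : ℕ → ℕ) → ((n : ℕ) → LeBSqrt b (q n) n) →
    Σ ((n : ℕ) → Poly (N n)) λ f →
    ((n : ℕ) → ℕ→ℚ (degree (f n)) ≤ C * ℕ→ℚ (logN n))
    × StronglySeparates q f)
theorem2p17 b b<½ = separable {b} {b′ * b′} q²≤b′²n ⅛≤b′² b′²<¼
  where
  -- Raising b to at least 3/8 makes b′² at least 1/8, as the choice of constants requires.
  b′ : ℚ
  b′ = b ⊔ ⅜

  0≤⅜ : 0ℚ ≤ ⅜
  0≤⅜ = toWitness {a? = 0ℚ ≤? ⅜} _

  ⅜≤b′ : ⅜ ≤ b′
  ⅜≤b′ = p≤q⊔p b ⅜

  b′<½ : b′ < ½
  b′<½ with ≤-total b ⅜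
  ... | inj₁ b≤⅜ = subst (_< ½) (sym (p≤q⇒p⊔q≡q b≤⅜)) (toWitness {a? = ⅜ <? ½} _)
  ... | inj₂ ⅜≤b = subst (_< ½) (sym (p≥q⇒p⊔q≡p ⅜≤b)) b<½

  ⅛≤b′² : ⅛ ≤ b′ * b′
  ⅛≤b′² = ≤-trans (toWitness {a? = ⅛ ≤? ⅜ * ⅜} _) (*-mono-≤ {⅜} {b′} {⅜} {b′} 0≤⅜ ⅜≤b′ 0≤⅜ ⅜≤b′)

  b′²<¼ : b′ * b′ < ½ * ½
  b′²<¼ = ≤-<-trans (*-monoˡ-≤ {b′} {b′} {½} (≤-trans 0≤⅜ ⅜≤b′) (<⇒≤ b′<½)) (*-monoˡ-<-pos ½ b′<½)

  q²≤b′²n : ∀ {q n} → LeBSqrt b q n → 0 ℕ.< n → ℕ→ℚ (q ℕ.* q) ≤ b′ * b′ * ℕ→ℚ n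
  q²≤b′²n (inj₁ (_ , refl)) ()
  q²≤b′²n {q} {n} (inj₂ (0≤b , q²≤b²n)) _ = ≤-trans q²≤b²n (*-monoʳ-≤ {ℕ→ℚ n} {b * b} {b′ * b′} (0≤ℕ→ℚ n) (*-mono-≤ {b} {b′} {b} {b′} 0≤b (p≤p⊔q b ⅜) 0≤b (p≤p⊔q b ⅜)))
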